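{- Every elementary recursive function can be extracted from a proof of totality: for every $n$ and every elementary recursive function $g:\mathbb{N}^n\to\mathbb{N}$, there exist a first-order term $f$ with $\Sigma\vdash_{ok}f:\mathtt{nat}\to\dots\to\mathtt{nat}\to\mathtt{nat}$ ($n$ arguments), an integer $k\ge0$, and a term $t$ such that the sequent $$;\ \vdash t:\forall x_1:\mathtt{nat},\dots,\forall x_n:\mathtt{nat},\ N\,x_1\multimap\dots\multimap N\,x_n\multimap\,!^kN\,(f\,x_1\cdots x_n)$$ (with empty typing context and no hypotheses) is derivable, and the pure $\lambda$-term $\overline{t}$ obtained by erasing type information from $t$ represents $g$.
   Context: **Syntax.** There are three disjoint infinite sets of variables: type variables ($\alpha,\beta,\dots$), first-order variables ($x,y,z,\dots$) and second-order variables ($X,Y,Z,\dots$), with a fixed injection $X\mapsto\alpha_X$ of second-order variables into type variables. Types (system F): $\tau,\sigma::=\alpha\mid\forall\alpha,\tau\mid\sigma\to\tau$. First-order terms (Church-style): $s,t::=x\mid(s\,t)\mid(t\,\tau)\mid\lambda x:\tau.t\mid\Lambda\alpha.t$. Formulas: $P,Q::=X\,t_1\cdots t_n\mid P\multimap Q\mid\forall X:[\tau_1,\dots,\tau_n],P\mid\forall x:\tau,P\mid\forall\alpha,P\mid\,!P$; $!^kP$ is $P$ preceded by $k$ exclamation marks. Everything is taken up to $\alpha$-equivalence and substitution is capture-avoiding; $P[Q/X\,x_1\cdots x_n]$ replaces each occurrence $X\,t_1\cdots t_n$ in $P$ by $Q[t_1/x_1]\cdots[t_n/x_n]$. A context is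 an ordered list of declarations $\alpha:Type$, $x:\tau$, $X:[\tau_1,\dots,\tau_n]$; it is well-formed if declared variables are distinct and every type occurring in it is well-formed in the preceding part. $\Gamma\vdash_{ok}\tau:Type$ means that $\tau$ is a type over the type variables of $\Gamma$; $\Gamma\vdash_{ok}t:\tau$ is the usual typing of Church-style system F; $\Gamma\vdash_{ok}P:Prop$ is generated by: $\Gamma\vdash_{ok}X\,t_1\cdots t_n:Prop$ if $X:[\tau_1,\dots,\tau_n]$ is in $\Gamma$ and $\Gamma\vdash_{ok}t_i:\tau_i$; closure under $\multimap$ and $!$; and closure under the three quantifiers, whose bodies are checked in the extended context. Leibniz equality: $t_1=_\tau t_2$ is $\forall X:[\tau],X\,t_1\multimap X\,t_2$. **Models.** $\mathcal{P}$ is the set of programs, i.e. pure (untyped) $\lambda$-terms modulo $\beta$-reduction. A PER is a partial equivalence relation on $\mathcal{P}$. A $\Gamma$-model $\mathcal{M}$ assigns, successively along $\Gamma$: to each $\alpha:Type$ a PER $\mathcal{M}(\alpha)$; to each $x:\tau$ an element of $[\![\tau]\!]_{\mathcal{M}}$; to each $X:[\tau_1,\dots,\tau_n]$ a set $E\subseteq[\![\tau_1]\!]_{\mathcal{M}}\times\dots\times[\![\tau_n]\!]_{\mathcal{M}}$ satisfying the stability condition: if $(t_1,\dots,t_n)\in E$ and $t_i\sim^{\mathcal{M}}_{\tau_i}t_i'$ for all $i$, then $(t_1',\dots,t_n')\in E$. Here $\sim^{\mathcal{M}}_\tau$ is the PER, with domain $[\![\tau]\!]_{\mathcal{M}}$,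 defined by: $\sim^{\mathcal{M}}_\alpha=\mathcal{M}(\alpha)$; $t_1\sim^{\mathcal{M}}_{\sigma\to\tau}t_2$ iff $s_1\sim^{\mathcal{M}}_\sigma s_2$ implies $(t_1\,s_1)\sim^{\mathcal{M}}_\tau(t_2\,s_2)$ for all $s_1,s_2$; $\sim^{\mathcal{M}}_{\forall\alpha,\tau}=\bigcap_{R\text{ PER}}\sim^{\mathcal{M}[\alpha\mapsto R]}_\tau$. For a term $t$, $[\![t]\!]_{\mathcal{M}}$ is the pure $\lambda$-term obtained by erasing type information and replacing free variables by their values in $\mathcal{M}$. Satisfaction: $\mathcal{M}\models X\,t_1\cdots t_n$ iff $([\![t_1]\!]_{\mathcal{M}},\dots,[\![t_n]\!]_{\mathcal{M}})\in\mathcal{M}(X)$; $\mathcal{M}\models P\multimap Q$ iff $\mathcal{M}\models P$ implies $\mathcal{M}\models Q$; $\mathcal{M}\models\,!P$ iff $\mathcal{M}\models P$; $\mathcal{M}\models\forall X:[\tau_1,\dots,\tau_n],P$ iff $\mathcal{M}[X\mapsto E]\models P$ for all $E\subseteq[\![\tau_1]\!]_{\mathcal{M}}\times\dots\times[\![\tau_n]\!]_{\mathcal{M}}$ satisfying the stability condition; $\mathcal{M}\models\forall x:\tau,P$ iff $\mathcal{M}[x\mapsto t]\models P$ for all $t\in[\![\tau]\!]_{\mathcal{M}}$; $\mathcal{M}\models\forall\alpha,P$ iff $\mathcal{M}[\alpha\mapsto R]\models P$ for every PER $R$. For sets of formulas, $\mathcal{M}\models E$ means $\mathcal{M}\models Q$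 for all $Q\in E$; $T\models_\Gamma P$ means that every $\Gamma$-model satisfying $T$ satisfies $P$. **Projection to types.** $(X\,t_1\cdots t_n)^-=\alpha_X$, $(A\multimap B)^-=A^-\to B^-$, $(\forall\alpha,F)^-=F^-$, $(\forall x:\tau,F)^-=F^-$, $(!F)^-=F^-$, $(\forall X:[\tau_1,\dots,\tau_n],F)^-=\forall\alpha_X,F^-$. **Integers.** $\mathtt{nat}=\forall\alpha,(\alpha\to\alpha)\to\alpha\to\alpha$, and $N\,x$ is the formula $\forall X:[\mathtt{nat}],\ !(\forall y:\mathtt{nat},X\,y\multimap X\,(s\,y))\multimap\,!(X\,0\multimap X\,x)$, where $0$ and $s$ are first-order variables declared in $\Sigma$ below. **Parameters $\Sigma$ and $\mathcal{H}$.** $\Sigma$ is the context $0:\mathtt{nat}$; $s,pred:\mathtt{nat}\to\mathtt{nat}$; $mult,minus,plus:\mathtt{nat}\to\mathtt{nat}\to\mathtt{nat}$; $sum,prod:(\mathtt{nat}\to\mathtt{nat})\to\mathtt{nat}\to\mathtt{nat}$. $\mathcal{H}$ is the set of all formulas of the form $\forall x_1:\tau_1,\dots,\forall x_m:\tau_m,\ t_1=_\tau t_2$, well-formed in $\Sigma$, that are $\models_\Sigma$-consequences of the following set $\mathcal{H}_0$ of equations at type $\mathtt{nat}$ (universally quantified over $x,y,n:\mathtt{nat}$ and $f:\mathtt{nat}\to\mathtt{nat}$): $0=\Lambda\alpha.\lambda f:\alpha\to\alpha.\lambda x:\alpha.x$; $s\,n=\Lambda\alpha.\lambda f:\alpha\to\alpha.\lambda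 x:\alpha.n\,\alpha\,f\,(f\,x)$; $plus\,x\,(s\,y)=s\,(plus\,x\,y)$; $plus\,x\,0=x$; $mult\,x\,(s\,y)=plus\,x\,(mult\,x\,y)$; $mult\,x\,0=0$; $pred\,(s\,x)=x$; $pred\,0=0$; $minus\,x\,(s\,y)=pred\,(minus\,x\,y)$; $minus\,x\,0=x$; $sum\,f\,(s\,x)=plus\,(sum\,f\,x)\,(f\,x)$; $sum\,f\,0=0$; $prod\,f\,(s\,x)=mult\,(prod\,f\,x)\,(f\,x)$; $prod\,f\,0=s\,0$. **Proof system.** Sequents $\Gamma;\Delta\vdash t:P$ have $\Gamma$ a context, $\Delta$ an unordered collection of assignments $x:Q$ with distinct variables, $t$ a first-order term, $P$ a formula; formulas of a sequent are well-formed in $\Sigma,\Gamma$. Contexts $\Delta_i$ that are joined have disjoint variables. Rules: - Axiom: $\Gamma;x:P\vdash x:P$ if $\Sigma,\Gamma\vdash_{ok}P:Prop$. - Weakening: from $\Gamma;\Delta\vdash t:Q$ and $\Sigma,\Gamma\vdash_{ok}P:Prop$, infer $\Gamma;\Delta,x:P\vdash t:Q$ ($x\notin\Delta$). - Application: from $\Gamma;\Delta_1\vdash t_1:P\multimap Q$ and $\Gamma;\Delta_2\vdash t_2:P$, infer $\Gamma;\Delta_1,\Delta_2\vdash(t_1\,t_2):Q$. - Abstraction: from $\Gamma;\Delta,x:P\vdash t:Q$, infer $\Gamma;\Delta\vdash\lambda x:P^-.t:P\multimap Q$. - Promotion: from $\Gamma;\Delta_i\vdash t_i:\,!P_i$ ($1\le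 i\le n$) and $\Gamma;x_1:P_1,\dots,x_n:P_n\vdash t:P$, infer $\Gamma;\Delta_1,\dots,\Delta_n\vdash t[t_1/x_1,\dots,t_n/x_n]:\,!P$. - Contraction: from $\Gamma;\Delta,y:\,!P,z:\,!P\vdash t:Q$, infer $\Gamma;\Delta,x:\,!P\vdash t[x/y,x/z]:Q$. - $\forall$-introductions: from $\Gamma,\alpha:Type;\Delta\vdash t:P$ infer $\Gamma;\Delta\vdash t:\forall\alpha,P$; from $\Gamma,x:\tau;\Delta\vdash t:P$ infer $\Gamma;\Delta\vdash t:\forall x:\tau,P$; from $\Gamma,X:[\tau_1,\dots,\tau_n];\Delta\vdash t:P$ infer $\Gamma;\Delta\vdash(\Lambda\alpha_X.t):\forall X:[\tau_1,\dots,\tau_n],P$ (the generalized variable not occurring free in $\Delta$). - $\forall$-eliminations: from $\Gamma;\Delta\vdash t:\forall\alpha,P$ and $\Sigma,\Gamma\vdash_{ok}\tau:Type$ infer $\Gamma;\Delta\vdash t:P[\tau/\alpha]$; from $\Gamma;\Delta\vdash t:\forall x:\tau,P$ and $\Sigma,\Gamma\vdash_{ok}a:\tau$ infer $\Gamma;\Delta\vdash t:P[a/x]$; from $\Gamma;\Delta\vdash t:\forall X:[\tau_1,\dots,\tau_n],P$ and $\Sigma,\Gamma,x_1:\tau_1,\dots,x_n:\tau_n\vdash_{ok}Q:Prop$ infer $\Gamma;\Delta\vdash(t\,Q^-):P[Q/X\,x_1\cdots x_n]$. - Equality: from $\Gamma;\Delta\vdash t:P_1$ infer $\Gamma;\Delta\vdash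 t:P_2$ whenever $\mathcal{H}\models_{\Sigma,\Gamma}t_1=_\tau t_2$ and there is a formula $Q$, well-formed in $\Sigma,\Gamma,x:\tau$, with $P_1\equiv Q[t_1/x]$ and $P_2\equiv Q[t_2/x]$. **Elementary recursive functions and representation.** The elementary recursive functions are (Kalmar's characterization) the smallest class of functions $\mathbb{N}^n\to\mathbb{N}$ containing constants, projections, addition, multiplication and (truncated) subtraction, and stable under composition, bounded sum and bounded product. $\lceil m\rceil$ is the $m$-th Church numeral. A program $u\in\mathcal{P}$ represents a total function $g:\mathbb{N}^n\to\mathbb{N}$ if for all integers $m_1,\dots,m_n$ the term $(u\,\lceil m_1\rceil\cdots\lceil m_n\rceil)$ may be normalized to the Church numeral $\lceil g(m_1,\dots,m_n)\rceil$. -}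

module Defs where

open import Data.Fin.Base using (Fin; zero; suc; toℕ; _↑ˡ_; _↑ʳ_; lift; opposite)
open import Data.Fin.Patterns using (0F; 1F; 2F; 3F; 4F; 5F; 6F; 7F)
open import Data.Fin.Permutation using (Permutation; _⟨$⟩ʳ_)
open import Data.List.Base using (List; []; _∷_; length)
open import Data.List.Membership.Propositional using (_∈_)
open import Data.List.Relation.Unary.All as All using (All; []; _∷_)
open import Data.List.Relation.Unary.Any using (here; there; index)
open import Data.Nat.Base using (ℕ; zero; suc; _+_; _*_; _∸_)
open import Data.Product.Base using (Σ-syntax; _×_)
open import Data.Vec.Base as Vec using (Vec; []; _∷_; _++_; lookup; map; tabulate; foldl; foldr)
open import Data.Vec.Functional as Vector using (Vector)
open import Function.Base using (id; _∘_)
open import Level using (Level; Lift)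
open import Relation.Binary.Construct.Closure.Equivalence using (EqClosure)
open import Relation.Binary.Construct.Closure.ReflexiveTransitive using (Star)
open import Relation.Binary.PropositionalEquality.Core using (_≡_; refl)
open import Relation.Binary.Structures using (IsPartialEquivalence)

private
  variable
    ℓ : Level
    a b d d₁ d₂ j k m n : ℕ
    Φ Ψ : List ℕ

infix  4 _⟶_ _⟶*_ _=β_ _⊢_⦂_ _⊢_∶Prop _⊩_∼_⦂_ _⊩_∼*_⦂_ _⊨_ _⊨[_]_
infix  3 _⨾_⊢_⦂_ _⨾_⊢*_⦂!_
infixr 6 _⇒_ _⊸_
infixl 7 _·_ _·ᵗ_ _∙_
infixl 5 _▸ᵗ _▸_ _▸²_ _▸*_
infix  5 Sig,,_
infix  5 _≐[_]_

-- Everything is well-scoped de Bruijn, with a separate index space for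
-- each of the three sorts of variables: a type variables, n first-order
-- variables, and second-order variables listed in Φ by arity.

data Ty (a : ℕ) : Set where
  var : Fin a → Ty a
  _⇒_ : Ty a → Ty a → Ty a
  ∀̇   : Ty (suc a) → Ty a

data Tm (a n : ℕ) : Set where
  var  : Fin n → Tm a n
  _·_  : Tm a n → Tm a n → Tm a n
  _·ᵗ_ : Tm a n → Ty a → Tm a n
  ƛ    : Ty a → Tm a (suc n) → Tm a n
  Λ    : Tm (suc a) n → Tm a n

data Fm (a n : ℕ) (Φ : List ℕ) : Set where
  atom : k ∈ Φ → Vec (Tm a n) k → Fm a n Φ
  _⊸_  : Fm a n Φ → Fm a n Φ → Fm a n Φ
  ∀²   : Vec (Ty a) k → Fm a n (k ∷ Φ) → Fm a n Φ
  ∀¹   : Ty a → Fm a (suc n) Φ → Fm a n Φ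
  ∀ᵗ   : Fm (suc a) n Φ → Fm a n Φ
  !    : Fm a n Φ → Fm a n Φ

!^ : ℕ → Fm a n Φ → Fm a n Φ
!^ zero    P = P
!^ (suc k) P = ! (!^ k P)

renTy : (Fin a → Fin b) → Ty a → Ty b
renTy ρ (var α) = var (ρ α)
renTy ρ (σ ⇒ τ) = renTy ρ σ ⇒ renTy ρ τ
renTy ρ (∀̇ τ)   = ∀̇ (renTy (lift 1 ρ) τ)

liftTy : (Fin a → Ty b) → Fin (suc a) → Ty (suc b)
liftTy σ = var zero Vector.∷ (renTy suc ∘ σ)

subTy : (Fin a → Ty b) → Ty a → Ty b
subTy σ (var α)  = σ α
subTy σ (τ ⇒ τ′) = subTy σ τ ⇒ subTy σ τ′
subTy σ (∀̇ τ)    = ∀̇ (subTy (liftTy σ) τ)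

renTm : (Fin a → Fin b) → (Fin m → Fin n) → Tm a m → Tm b n
renTm ρ ξ (var x)  = var (ξ x)
renTm ρ ξ (t · u)  = renTm ρ ξ t · renTm ρ ξ u
renTm ρ ξ (t ·ᵗ τ) = renTm ρ ξ t ·ᵗ renTy ρ τ
renTm ρ ξ (ƛ τ t)  = ƛ (renTy ρ τ) (renTm ρ (lift 1 ξ) t)
renTm ρ ξ (Λ t)    = Λ (renTm (lift 1 ρ) ξ t)

liftTm : (Fin m → Tm a n) → Fin (suc m) → Tm a (suc n)
liftTm θ = var zero Vector.∷ (renTm id suc ∘ θ)

subTm : (Fin a → Ty b) → (Fin m → Tm b n) → Tm a m → Tm b n
subTm σ θ (var x)  = θ x
subTm σ θ (t · u)  = subTm σ θ t · subTm σ θ u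
subTm σ θ (t ·ᵗ τ) = subTm σ θ t ·ᵗ subTy σ τ
subTm σ θ (ƛ τ t)  = ƛ (subTy σ τ) (subTm σ (liftTm θ) t)
subTm σ θ (Λ t)    = Λ (subTm (liftTy σ) (renTm suc id ∘ θ) t)

liftPr : (∀ {j} → j ∈ Φ → j ∈ Ψ) → ∀ {j} → j ∈ k ∷ Φ → j ∈ k ∷ Ψ
liftPr ζ (here eq) = here eq
liftPr ζ (there X) = there (ζ X)

renFm : (Fin a → Fin b) → (Fin m → Fin n) → (∀ {j} → j ∈ Φ → j ∈ Ψ) →
        Fm a m Φ → Fm b n Ψ
renFm ρ ξ ζ (atom X ts) = atom (ζ X) (map (renTm ρ ξ) ts)
renFm ρ ξ ζ (P ⊸ Q)     = renFm ρ ξ ζ P ⊸ renFm ρ ξ ζ Q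
renFm ρ ξ ζ (∀² τs P)   = ∀² (map (renTy ρ) τs) (renFm ρ ξ (liftPr ζ) P)
renFm ρ ξ ζ (∀¹ τ P)    = ∀¹ (renTy ρ τ) (renFm ρ (lift 1 ξ) ζ P)
renFm ρ ξ ζ (∀ᵗ P)      = ∀ᵗ (renFm (lift 1 ρ) ξ ζ P)
renFm ρ ξ ζ (! P)       = ! (renFm ρ ξ ζ P)

subFm : (Fin a → Ty b) → (Fin m → Tm b n) → Fm a m Φ → Fm b n Φ
subFm σ θ (atom X ts) = atom X (map (subTm σ θ) ts)
subFm σ θ (P ⊸ Q)     = subFm σ θ P ⊸ subFm σ θ Q
subFm σ θ (∀² τs P)   = ∀² (map (subTy σ) τs) (subFm σ θ P)
subFm σ θ (∀¹ τ P)    = ∀¹ (subTy σ τ) (subFm σ (liftTm θ) P)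
subFm σ θ (∀ᵗ P)      = ∀ᵗ (subFm (liftTy σ) (renTm suc id ∘ θ) P)
subFm σ θ (! P)       = ! (subFm σ θ P)

wkᵗ : Fm a n Φ → Fm (suc a) n Φ
wkᵗ = renFm suc id id

wk¹ : Fm a n Φ → Fm a (suc n) Φ
wk¹ = renFm id suc id

wk² : Fm a n Φ → Fm a n (k ∷ Φ)
wk² = renFm id id there

_[_]Ty : Ty (suc a) → Ty a → Ty a
τ [ σ ]Ty = subTy (σ Vector.∷ var) τ

_[_]ᵗ : Fm (suc a) n Φ → Ty a → Fm a n Φ
P [ τ ]ᵗ = subFm (τ Vector.∷ var) var P

_[_]¹ : Fm a (suc n) Φ → Tm a n → Fm a n Φ
P [ t ]¹ = subFm var (t Vector.∷ var) P

-- Substitution of a formula Q in k extra first-order variables for a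
-- k-ary second-order variable; the i-th extra variable (index i) stands
-- for the i-th argument.

PrSub : ℕ → ℕ → List ℕ → List ℕ → Set
PrSub a n Φ Ψ = ∀ {k} → k ∈ Φ → Fm a (k + n) Ψ

generic : k ∈ Φ → Fm a (k + n) Φ
generic {n = n} X = atom X (tabulate λ i → var (i ↑ˡ n))

lift² : PrSub a n Φ Ψ → PrSub a n (j ∷ Φ) (j ∷ Ψ)
lift² θ (here eq)     = generic (here eq)
lift² θ (there X)     = wk² (θ X)

substPr : PrSub a n Φ Ψ → Fm a n Φ → Fm a n Ψ
substPr θ (atom X ts) = subFm var (lookup ts Vector.++ var) (θ X)
substPr θ (P ⊸ Q)     = substPr θ P ⊸ substPr θ Q
substPr θ (∀² τs P)   = ∀² τs (substPr (lift² θ) P)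
substPr θ (∀¹ τ P)    =
  ∀¹ τ (substPr (λ {k} X → renFm id (lift k suc) id (θ X)) P)
substPr θ (∀ᵗ P)      = ∀ᵗ (substPr (λ X → wkᵗ (θ X)) P)
substPr θ (! P)       = ! (substPr θ P)

single² : Fm a (k + n) Φ → PrSub a n (k ∷ Φ) Φ
single² Q (here refl) = Q
single² Q (there X)   = generic X

_[_]² : Fm a n (k ∷ Φ) → Fm a (k + n) Φ → Fm a n Φ
P [ Q ]² = substPr (single² Q) P

-- Scoping makes every context well-formed and every τ : Ty a a type over
-- the type variables of Γ.

data Ctx : ℕ → ℕ → List ℕ → Set where
  ∅    : Ctx 0 0 []
  _▸ᵗ  : Ctx a n Φ → Ctx (suc a) n Φ
  _▸_  : Ctx a n Φ → Ty a → Ctx a (suc n) Φ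
  _▸²_ : Ctx a n Φ → Vec (Ty a) k → Ctx a n (k ∷ Φ)

typeOf : Ctx a n Φ → Fin n → Ty a
typeOf (Γ ▸ᵗ)    x       = renTy suc (typeOf Γ x)
typeOf (Γ ▸ τ)   zero    = τ
typeOf (Γ ▸ τ)   (suc x) = typeOf Γ x
typeOf (Γ ▸² τs) x       = typeOf Γ x

sortOf : Ctx a n Φ → k ∈ Φ → Vec (Ty a) k
sortOf (Γ ▸ᵗ)    X           = map (renTy suc) (sortOf Γ X)
sortOf (Γ ▸ τ)   X           = sortOf Γ X
sortOf (Γ ▸² τs) (here refl) = τs
sortOf (Γ ▸² τs) (there X)   = sortOf Γ X

-- Γ , x₁ : τ₁ , … , xₖ : τₖ, declared from the last to the first so that
-- xᵢ gets index i; the declarations do not depend on each other.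
_▸*_ : Ctx a n Φ → Vec (Ty a) k → Ctx a (k + n) Φ
Γ ▸* []       = Γ
Γ ▸* (τ ∷ τs) = (Γ ▸* τs) ▸ τ

data _⊢_⦂_ (Γ : Ctx a n Φ) : Tm a n → Ty a → Set where
  ⊢var : ∀ x → Γ ⊢ var x ⦂ typeOf Γ x
  ⊢·   : ∀ {t u σ τ} → Γ ⊢ t ⦂ σ ⇒ τ → Γ ⊢ u ⦂ σ → Γ ⊢ t · u ⦂ τ
  ⊢·ᵗ  : ∀ {t τ} → Γ ⊢ t ⦂ ∀̇ τ → ∀ σ → Γ ⊢ t ·ᵗ σ ⦂ τ [ σ ]Ty
  ⊢ƛ   : ∀ {t σ τ} → Γ ▸ σ ⊢ t ⦂ τ → Γ ⊢ ƛ σ t ⦂ σ ⇒ τ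
  ⊢Λ   : ∀ {t τ} → Γ ▸ᵗ ⊢ t ⦂ τ → Γ ⊢ Λ t ⦂ ∀̇ τ

data _⊢_∶Prop (Γ : Ctx a n Φ) : Fm a n Φ → Set where
  ok-atom : (X : k ∈ Φ) {ts : Vec (Tm a n) k} →
            (∀ i → Γ ⊢ lookup ts i ⦂ lookup (sortOf Γ X) i) →
            Γ ⊢ atom X ts ∶Prop
  ok-⊸    : ∀ {P Q} → Γ ⊢ P ∶Prop → Γ ⊢ Q ∶Prop → Γ ⊢ P ⊸ Q ∶Prop
  ok-∀²   : {τs : Vec (Ty a) k} {P : Fm a n (k ∷ Φ)} →
            Γ ▸² τs ⊢ P ∶Prop → Γ ⊢ ∀² τs P ∶Prop
  ok-∀¹   : ∀ {τ P} → Γ ▸ τ ⊢ P ∶Prop → Γ ⊢ ∀¹ τ P ∶Prop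
  ok-∀ᵗ   : ∀ {P} → Γ ▸ᵗ ⊢ P ∶Prop → Γ ⊢ ∀ᵗ P ∶Prop
  ok-!    : ∀ {P} → Γ ⊢ P ∶Prop → Γ ⊢ ! P ∶Prop

_≐[_]_ : Tm a n → Ty a → Tm a n → Fm a n Φ
t ≐[ τ ] u =
  ∀² (τ ∷ []) (atom (here refl) (t ∷ []) ⊸ atom (here refl) (u ∷ []))

-- The type variable α_X associated with X is the
-- position of X among the second-order variables, so the free type
-- variables of P ⁻ (and of the terms extracted from proofs) are exactly
-- the α_X; they are kept apart from the type variables declared in Γ.
_⁻ : Fm a n Φ → Ty (length Φ)
(atom X ts) ⁻ = var (index X)
(P ⊸ Q) ⁻     = (P ⁻) ⇒ (Q ⁻)
(∀² τs P) ⁻   = ∀̇ (P ⁻)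
(∀¹ τ P) ⁻    = P ⁻
(∀ᵗ P) ⁻      = P ⁻
(! P) ⁻       = P ⁻

-- Pure λ-terms, possibly open (de Bruijn indices range over ℕ); programs
-- are these modulo =β.

data Lam : Set where
  var : ℕ → Lam
  _∙_ : Lam → Lam → Lam
  lam : Lam → Lam

renLam : (ℕ → ℕ) → Lam → Lam
renLam ρ (var x) = var (ρ x)
renLam ρ (t ∙ u) = renLam ρ t ∙ renLam ρ u
renLam ρ (lam t) = lam (renLam (λ { zero → zero ; (suc x) → suc (ρ x) }) t)

shift : Lam → Lam
shift = renLam suc

subLam : (ℕ → Lam) → Lam → Lam
subLam θ (var x) = θ x
subLam θ (t ∙ u) = subLam θ t ∙ subLam θ u
subLam θ (lam t) =
  lam (subLam (λ { zero → var zero ; (suc x) → shift (θ x) }) t)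

_[_] : Lam → Lam → Lam
t [ u ] = subLam (λ { zero → u ; (suc x) → var x }) t

data _⟶_ : Lam → Lam → Set where
  β    : ∀ {t u} → lam t ∙ u ⟶ t [ u ]
  ∙-l  : ∀ {t t′ u} → t ⟶ t′ → t ∙ u ⟶ t′ ∙ u
  ∙-r  : ∀ {t u u′} → u ⟶ u′ → t ∙ u ⟶ t ∙ u′
  lam  : ∀ {t t′} → t ⟶ t′ → lam t ⟶ lam t′

_⟶*_ : Lam → Lam → Set
_⟶*_ = Star _⟶_

_=β_ : Lam → Lam → Set
_=β_ = EqClosure _⟶_

-- Type erasure of t, with free variables replaced by their values in v.
⟦_⟧ : Tm a n → Vector Lam n → Lam
⟦ var x ⟧  v = v x
⟦ t · u ⟧  v = ⟦ t ⟧ v ∙ ⟦ u ⟧ v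
⟦ t ·ᵗ τ ⟧ v = ⟦ t ⟧ v
⟦ ƛ τ t ⟧  v = lam (⟦ t ⟧ (var zero Vector.∷ (shift ∘ v)))
⟦ Λ t ⟧    v = ⟦ t ⟧ v

erase : Tm a n → Lam
erase t = ⟦ t ⟧ (var ∘ toℕ)

-- A PER on programs modulo β is a PER on λ-terms compatible with =β.
record PER : Set₁ where
  field
    rel    : Lam → Lam → Set
    isPER  : IsPartialEquivalence rel
    resp-β : ∀ {t t′ u u′} → t =β t′ → u =β u′ → rel t u → rel t′ u′

-- PERs being Set-valued, the intersection over all PERs puts the
-- interpretation of types one universe higher.
_⊩_∼_⦂_ : Vector PER a → Lam → Lam → Ty a → Set₁
ρ ⊩ t ∼ u ⦂ var α   = Lift _ (PER.rel (ρ α) t u)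
ρ ⊩ t ∼ u ⦂ (σ ⇒ τ) = ∀ {s s′} → ρ ⊩ s ∼ s′ ⦂ σ → ρ ⊩ (t ∙ s) ∼ (u ∙ s′) ⦂ τ
ρ ⊩ t ∼ u ⦂ ∀̇ τ     = ∀ (R : PER) → (R Vector.∷ ρ) ⊩ t ∼ u ⦂ τ

_⊩_∼*_⦂_ : Vector PER a → Vec Lam k → Vec Lam k → Vec (Ty a) k → Set₁
ρ ⊩ ts ∼* us ⦂ τs = ∀ i → ρ ⊩ lookup ts i ∼ lookup us i ⦂ lookup τs i

-- Predicates live in the universe of the interpretation of types, so that
-- the ∼-classes are among them.
Pred : ℕ → Set₂
Pred k = Vec Lam k → Set₁

-- E ⊆ ⟦τ₁⟧ × … × ⟦τₖ⟧ with the stability condition.  As each ∼ is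
-- compatible with =β, the two fields imply that E is too.
record Stable (ρ : Vector PER a) (τs : Vec (Ty a) k) (E : Pred k) : Set₁ where
  field
    dom  : ∀ {ts} → E ts → ρ ⊩ ts ∼* ts ⦂ τs
    stab : ∀ {ts us} → E ts → ρ ⊩ ts ∼* us ⦂ τs → E us

record Env (a n : ℕ) (Φ : List ℕ) : Set₂ where
  constructor env
  field
    types : Vector PER a
    terms : Vector Lam n
    preds : All Pred Φ

open Env

record IsModel (Γ : Ctx a n Φ) (M : Env a n Φ) : Set₁ where
  field
    terms-ok : ∀ x → types M ⊩ terms M x ∼ terms M x ⦂ typeOf Γ x
    preds-ok : ∀ {k} (X : k ∈ Φ) →
               Stable (types M) (sortOf Γ X) (All.lookup (preds M) X)

_⊨_ : Env a n Φ → Fm a n Φ → Set₂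
M ⊨ atom X ts = Lift _ (All.lookup (preds M) X (map (λ t → ⟦ t ⟧ (terms M)) ts))
M ⊨ (P ⊸ Q)   = M ⊨ P → M ⊨ Q
env ρ v η ⊨ ∀² τs P = ∀ E → Stable ρ τs E → env ρ v (E ∷ η) ⊨ P
env ρ v η ⊨ ∀¹ τ P  = ∀ t → ρ ⊩ t ∼ t ⦂ τ → env ρ (t Vector.∷ v) η ⊨ P
env ρ v η ⊨ ∀ᵗ P    = ∀ R → env (R Vector.∷ ρ) v η ⊨ P
M ⊨ (! P)     = M ⊨ P

_⊨[_]_ : (Fm a n Φ → Set ℓ) → Ctx a n Φ → Fm a n Φ → Set _
T ⊨[ Γ ] P = ∀ M → IsModel Γ M → (∀ Q → T Q → M ⊨ Q) → M ⊨ P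

nat : Ty a
nat = ∀̇ ((var 0F ⇒ var 0F) ⇒ var 0F ⇒ var 0F)

Sig : Ctx 0 8 []
Sig = ∅
  ▸ nat
  ▸ nat ⇒ nat
  ▸ nat ⇒ nat
  ▸ nat ⇒ nat ⇒ nat
  ▸ nat ⇒ nat ⇒ nat
  ▸ nat ⇒ nat ⇒ nat
  ▸ (nat ⇒ nat) ⇒ nat ⇒ nat
  ▸ (nat ⇒ nat) ⇒ nat ⇒ nat

-- Sig is the context Σ, and Sig,, Γ is Σ , Γ.
Sig,,_ : Ctx a n Φ → Ctx a (n + 8) Φ
Sig,, ∅         = Sig
Sig,, (Γ ▸ᵗ)    = (Sig,, Γ) ▸ᵗ
Sig,, (Γ ▸ τ)   = (Sig,, Γ) ▸ τ
Sig,, (Γ ▸² τs) = (Sig,, Γ) ▸² τs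

-- The variables of Σ, seen in the scope of Σ , Γ where Γ declares n
-- first-order variables.
module _ (n : ℕ) where

  o′ s′ pred′ mult′ minus′ plus′ sum′ prod′ : Tm a (n + 8)
  o′     = var (n ↑ʳ 7F)
  s′     = var (n ↑ʳ 6F)
  pred′  = var (n ↑ʳ 5F)
  mult′  = var (n ↑ʳ 4F)
  minus′ = var (n ↑ʳ 3F)
  plus′  = var (n ↑ʳ 2F)
  sum′   = var (n ↑ʳ 1F)
  prod′  = var (n ↑ʳ 0F)

N : ∀ n → Tm a (n + 8) → Fm a (n + 8) Φ
N n x = ∀² (nat ∷ [])
  (! (∀¹ nat (X (var 0F) ⊸ X (s′ (suc n) · var 0F))) ⊸ ! (X (o′ n) ⊸ X x))
  where
  X : Tm a m → Fm a m (1 ∷ Φ)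
  X t = atom (here refl) (t ∷ [])

data ℋ₀ : Fm 0 8 [] → Set where
  zero-def  : ℋ₀ (o′ 0 ≐[ nat ] Λ (ƛ (var 0F ⇒ var 0F) (ƛ (var 0F) (var 0F))))
  suc-def   : ℋ₀ (∀¹ nat (s′ 1 · var 0F ≐[ nat ]
                Λ (ƛ (var 0F ⇒ var 0F) (ƛ (var 0F)
                  (var 2F ·ᵗ var 0F · var 1F · (var 1F · var 0F))))))
  plus-suc  : ℋ₀ (∀¹ nat (∀¹ nat
                (plus′ 2 · var 1F · (s′ 2 · var 0F) ≐[ nat ]
                 s′ 2 · (plus′ 2 · var 1F · var 0F))))
  plus-0    : ℋ₀ (∀¹ nat (plus′ 1 · var 0F · o′ 1 ≐[ nat ] var 0F))
  mult-suc  : ℋ₀ (∀¹ nat (∀¹ nat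
                (mult′ 2 · var 1F · (s′ 2 · var 0F) ≐[ nat ]
                 plus′ 2 · var 1F · (mult′ 2 · var 1F · var 0F))))
  mult-0    : ℋ₀ (∀¹ nat (mult′ 1 · var 0F · o′ 1 ≐[ nat ] o′ 1))
  pred-suc  : ℋ₀ (∀¹ nat (pred′ 1 · (s′ 1 · var 0F) ≐[ nat ] var 0F))
  pred-0    : ℋ₀ (pred′ 0 · o′ 0 ≐[ nat ] o′ 0)
  minus-suc : ℋ₀ (∀¹ nat (∀¹ nat
                (minus′ 2 · var 1F · (s′ 2 · var 0F) ≐[ nat ]
                 pred′ 2 · (minus′ 2 · var 1F · var 0F))))
  minus-0   : ℋ₀ (∀¹ nat (minus′ 1 · var 0F · o′ 1 ≐[ nat ] var 0F))
  sum-suc   : ℋ₀ (∀¹ (nat ⇒ nat) (∀¹ nat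
                (sum′ 2 · var 1F · (s′ 2 · var 0F) ≐[ nat ]
                 plus′ 2 · (sum′ 2 · var 1F · var 0F) · (var 1F · var 0F))))
  sum-0     : ℋ₀ (∀¹ (nat ⇒ nat) (sum′ 1 · var 0F · o′ 1 ≐[ nat ] o′ 1))
  prod-suc  : ℋ₀ (∀¹ (nat ⇒ nat) (∀¹ nat
                (prod′ 2 · var 1F · (s′ 2 · var 0F) ≐[ nat ]
                 mult′ 2 · (prod′ 2 · var 1F · var 0F) · (var 1F · var 0F))))
  prod-0    : ℋ₀ (∀¹ (nat ⇒ nat) (prod′ 1 · var 0F · o′ 1 ≐[ nat ] s′ 1 · o′ 1))

data IsEquation : Fm a n Φ → Set where
  eqn : ∀ {t u : Tm a n} {τ} → IsEquation {Φ = Φ} (t ≐[ τ ] u)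
  gen : ∀ {τ} {P : Fm a (suc n) Φ} → IsEquation P → IsEquation (∀¹ τ P)

ℋ : Fm 0 8 [] → Set₂
ℋ P = IsEquation P × (Sig ⊢ P ∶Prop) × (ℋ₀ ⊨[ Sig ] P)

-- ℋ as a set of formulas over Σ , Γ
ℋ↑ : Fm a (n + 8) Φ → Set₂
ℋ↑ {n = n} P = Σ[ Q ∈ Fm 0 8 [] ] ℋ Q × P ≡ renFm (λ ()) (n ↑ʳ_) (λ ()) Q

-- Γ ⨾ Δ ⊢ t ⦂ P: the formulas live over Σ , Γ; the term t has the
-- variables of Δ as first-order variables and the α_X as type variables.
-- Δ is a vector together with an explicit exchange rule.

contract : Fin (suc (suc d)) → Fin (suc d)
contract zero    = zero
contract (suc i) = i

mutual

  data _⨾_⊢_⦂_ (Γ : Ctx a n Φ) :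
       Vec (Fm a (n + 8) Φ) d → Tm (length Φ) d → Fm a (n + 8) Φ → Set₂ where

    exchange : ∀ {Δ : Vec _ d₁} {Δ′ : Vec _ d₂} {t P} →
      (π : Permutation d₁ d₂) →
      (∀ i → lookup Δ i ≡ lookup Δ′ (π ⟨$⟩ʳ i)) →
      Γ ⨾ Δ ⊢ t ⦂ P →
      Γ ⨾ Δ′ ⊢ renTm id (π ⟨$⟩ʳ_) t ⦂ P

    axiom : ∀ {P} →
      Sig,, Γ ⊢ P ∶Prop →
      Γ ⨾ P ∷ [] ⊢ var zero ⦂ P

    weakening : ∀ {Δ : Vec _ d} {t P Q} →
      Γ ⨾ Δ ⊢ t ⦂ Q →
      Sig,, Γ ⊢ P ∶Prop →
      Γ ⨾ P ∷ Δ ⊢ renTm id suc t ⦂ Q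

    application : ∀ {Δ₁ : Vec _ d₁} {Δ₂ : Vec _ d₂} {t₁ t₂ P Q} →
      Γ ⨾ Δ₁ ⊢ t₁ ⦂ P ⊸ Q →
      Γ ⨾ Δ₂ ⊢ t₂ ⦂ P →
      Γ ⨾ Δ₁ ++ Δ₂ ⊢ renTm id (_↑ˡ d₂) t₁ · renTm id (d₁ ↑ʳ_) t₂ ⦂ Q

    abstraction : ∀ {Δ : Vec _ d} {t P Q} →
      Γ ⨾ P ∷ Δ ⊢ t ⦂ Q →
      Γ ⨾ Δ ⊢ ƛ (P ⁻) t ⦂ P ⊸ Q

    promotion : ∀ {Δ : Vec _ d} {Ps : Vec _ m} {ts t P} →
      Γ ⨾ Δ ⊢* ts ⦂! Ps →
      Γ ⨾ Ps ⊢ t ⦂ P →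
      Γ ⨾ Δ ⊢ subTm var (lookup ts) t ⦂ ! P

    contraction : ∀ {Δ : Vec _ d} {t P Q} →
      Γ ⨾ ! P ∷ ! P ∷ Δ ⊢ t ⦂ Q →
      Γ ⨾ ! P ∷ Δ ⊢ renTm id contract t ⦂ Q

    ∀ᵗ-intro : ∀ {Δ : Vec _ d} {t P} →
      Γ ▸ᵗ ⨾ map wkᵗ Δ ⊢ t ⦂ P →
      Γ ⨾ Δ ⊢ t ⦂ ∀ᵗ P

    ∀¹-intro : ∀ {Δ : Vec _ d} {t τ P} →
      Γ ▸ τ ⨾ map wk¹ Δ ⊢ t ⦂ P →
      Γ ⨾ Δ ⊢ t ⦂ ∀¹ τ P

    ∀²-intro : ∀ {Δ : Vec _ d} {t P} {τs : Vec (Ty a) k} →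
      Γ ▸² τs ⨾ map wk² Δ ⊢ t ⦂ P →
      Γ ⨾ Δ ⊢ Λ t ⦂ ∀² τs P

    ∀ᵗ-elim : ∀ {Δ : Vec _ d} {t P} →
      Γ ⨾ Δ ⊢ t ⦂ ∀ᵗ P →
      (τ : Ty a) →
      Γ ⨾ Δ ⊢ t ⦂ P [ τ ]ᵗ

    ∀¹-elim : ∀ {Δ : Vec _ d} {t τ P u} →
      Γ ⨾ Δ ⊢ t ⦂ ∀¹ τ P →
      Sig,, Γ ⊢ u ⦂ τ →
      Γ ⨾ Δ ⊢ t ⦂ P [ u ]¹

    ∀²-elim : ∀ {Δ : Vec _ d} {t P} {τs : Vec (Ty a) k} {Q} →
      Γ ⨾ Δ ⊢ t ⦂ ∀² τs P →
      (Sig,, Γ) ▸* τs ⊢ Q ∶Prop →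
      Γ ⨾ Δ ⊢ t ·ᵗ (Q ⁻) ⦂ P [ Q ]²

    equality : ∀ {Δ : Vec _ d} {t τ u₁ u₂} (Q : Fm a (suc n + 8) Φ) →
      (Sig,, Γ) ▸ τ ⊢ Q ∶Prop →
      Sig,, Γ ⊢ u₁ ⦂ τ →
      Sig,, Γ ⊢ u₂ ⦂ τ →
      ℋ↑ {n = n} ⊨[ Sig,, Γ ] (u₁ ≐[ τ ] u₂) →
      Γ ⨾ Δ ⊢ t ⦂ Q [ u₁ ]¹ →
      Γ ⨾ Δ ⊢ t ⦂ Q [ u₂ ]¹

  -- The family of premises Γ ⨾ Δᵢ ⊢ tᵢ ⦂ ! Pᵢ of promotion, with the Δᵢ
  -- concatenated and each tᵢ weakened accordingly.
  data _⨾_⊢*_⦂!_ (Γ : Ctx a n Φ) :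
       Vec (Fm a (n + 8) Φ) d → Vec (Tm (length Φ) d) m →
       Vec (Fm a (n + 8) Φ) m → Set₂ where

    [] : Γ ⨾ [] ⊢* [] ⦂! []

    _∷_ : ∀ {Δ₁ : Vec _ d₁} {Δ₂ : Vec _ d₂} {t P} {ts} {Ps : Vec _ m} →
      Γ ⨾ Δ₁ ⊢ t ⦂ ! P →
      Γ ⨾ Δ₂ ⊢* ts ⦂! Ps →
      Γ ⨾ Δ₁ ++ Δ₂ ⊢* renTm id (_↑ˡ d₂) t ∷ map (renTm id (d₁ ↑ʳ_)) ts ⦂! P ∷ Ps

natFun : ℕ → Ty a
natFun zero    = nat
natFun (suc n) = nat ⇒ natFun n

∀nats : ∀ n → Fm a (n + m) Φ → Fm a m Φ
∀nats zero    P = P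
∀nats (suc n) P = ∀nats n (∀¹ nat P)

-- x₁ , … , xₙ under n quantifiers, where xᵢ has index n - i.
vars : ∀ n → Vec (Tm a (n + m)) n
vars {m = m} n = tabulate λ i → var (opposite i ↑ˡ m)

Totality : ∀ n → ℕ → Tm 0 8 → Fm 0 8 []
Totality n k f =
  ∀nats n (foldr _ (λ x P → N n x ⊸ P)
                   (!^ k (N n (foldl _ _·_ (renTm id (n ↑ʳ_) f) (vars n))))
                   (vars n))

Σ< Π< : ℕ → (ℕ → ℕ) → ℕ
Σ< zero    f = 0
Σ< (suc y) f = Σ< y f + f y
Π< zero    f = 1
Π< (suc y) f = Π< y f * f y

onPair : (ℕ → ℕ → ℕ) → Vec ℕ 2 → ℕ
onPair op (x ∷ y ∷ []) = op x y

bounded : (ℕ → (ℕ → ℕ) → ℕ) → (Vec ℕ (suc n) → ℕ) → Vec ℕ (suc n) → ℕ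
bounded op f (y ∷ xs) = op y (λ i → f (i ∷ xs))

-- The constructor ext makes this a class of functions up to pointwise
-- equality.
data Elementary : ∀ n → (Vec ℕ n → ℕ) → Set where
  constant   : ∀ c → Elementary n (λ _ → c)
  projection : ∀ i → Elementary n (λ xs → lookup xs i)
  addition   : Elementary 2 (onPair _+_)
  multiply   : Elementary 2 (onPair _*_)
  subtract   : Elementary 2 (onPair _∸_)
  compose    : ∀ {f : Vec ℕ m → ℕ} {gs : Fin m → Vec ℕ n → ℕ} →
               Elementary m f → (∀ i → Elementary n (gs i)) →
               Elementary n (λ xs → f (tabulate λ i → gs i xs))
  boundedSum  : ∀ {f} → Elementary (suc n) f → Elementary (suc n) (bounded Σ< f)
  boundedProd : ∀ {f} → Elementary (suc n) f → Elementary (suc n) (bounded Π< f)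
  ext        : ∀ {f g} → (∀ xs → f xs ≡ g xs) → Elementary n f → Elementary n g

iterate : ℕ → Lam → Lam → Lam
iterate zero    f x = x
iterate (suc m) f x = f ∙ iterate m f x

⌜_⌝ : ℕ → Lam
⌜ m ⌝ = lam (lam (iterate m (var 1) (var 0)))

Represents : Lam → (Vec ℕ n → ℕ) → Set
Represents u g = ∀ ms → foldl (λ _ → Lam) _∙_ u (map ⌜_⌝ ms) ⟶* ⌜ g ms ⌝

{-# OPTIONS --safe #-}
module Submission where

-- Apart from o and s, the terms f use no function symbol of Σ: they are
-- System F terms that iterate Church numerals, iterT τ y G u = y τ G u.
-- Proofs about them need only β and the equation
-- (s y) τ G u = y τ G (G u).  In a model the latter is a genuine
-- β-equality, because ∼ at nat implies equality after application to any
-- two arguments (take the PER =β).  Accordingly, except in the proof of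
-- N x ⊸ ! (N x), the induction packaged in N y is used in the form
--   N y ⊸ ! (∀ u, A u ⊸ A (G u)) ⊸ ! (∀ u, A u ⊸ A (y τ G u)),
-- the quantifier over u absorbing the change of argument.  Addition and
-- multiplication take A to be the predicate variable of the goal, so they
-- cost no exclamation mark; bounded sums and products take for A a formula
-- on states h : nat → nat → nat with a banged, hence duplicable, counter.
--
-- An elementary function is given a proof of ! N x₁ ⊸ … ⊸ ! N xₙ ⊸
-- !^ (suc k) N (f x₁ … xₙ).  Banged hypotheses can be duplicated, so such
-- proofs compose as in a reader monad, through closed combinators with n
-- parameters whose reductions give the behaviour of the program.

open import Defs
open import Data.Fin.Base using (Fin; zero; suc; _↑ˡ_; _↑ʳ_; lift; opposite)
open import Data.Fin.Patterns using (0F; 1F; 2F; 3F; 4F; 6F; 7F)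
open import Data.Fin.Permutation using (permutation)
open import Data.Fin.Properties using (_≟_; all?)
open import Data.List.Base using (List; []; _∷_; length)
open import Data.List.Membership.Propositional using (_∈_)
open import Data.List.Relation.Unary.Any using (here; there)
open import Data.Nat.Base using (ℕ; zero; suc; _+_; _*_; _∸_; pred)
open import Data.Nat.Properties using (+-comm; +-identityʳ; +-suc; *-comm; pred[m∸n]≡m∸[1+n])
open import Data.Product.Base using (Σ-syntax; ∃-syntax; _×_; _,_)
open import Data.Vec.Base using (Vec; []; _∷_; _++_; lookup; map; foldl; foldr; tabulate)
import Data.Vec.Properties as Vec
open import Data.Vec.Functional as Vector using (Vector)
open import Data.Vec.Relation.Unary.All using (All; []; _∷_)
open import Data.Vec.Relation.Unary.All.Properties using (lookup⁺; tabulate⁺)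
open import Function.Base using (id; _∘_)
open import Level using (Level; lower)
import Relation.Binary.Construct.Closure.Equivalence as Eq
open import Relation.Binary.Construct.Closure.ReflexiveTransitive as Star using (ε; _◅_; _◅◅_)
open import Relation.Binary.Construct.Closure.Symmetric using (fwd)
open import Relation.Binary.PropositionalEquality hiding ([_])
open import Relation.Binary.Structures using (IsPartialEquivalence)
open import Relation.Nullary.Decidable using (True; toWitness)

-- The proof system has no rule for `! P ⊸ P` or `! P ⊸ ! ! P`. A promotion takes one bang off every
-- hypothesis it uses and puts one on its conclusion, so an argument can be used only at the depth
-- of bangs at which it is given. For integers the coercion `N x ⊸ ! (N x)` adds bangs, but no rule
-- takes them off. Hence the count `k` attached to an extracted function, the raising of several
-- functions to a common count before they are composed, and the need to derive any other
-- hypothesis, such as the totality of a summand, at the required depth from its integer parameters.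
-- Bangs and first-order quantifiers leave no trace in the extracted term, so this bookkeeping shows
-- up in programs only as coercions and η-expansions. The erasure of each derivation is carried
-- along with it as a function of the environment; all statements about the behaviour of programs
-- are then proved on bare λ-terms, independently of the typed terms.

private
  variable
    ℓ : Level
    a b c d d₁ d₂ k l m n : ℕ
    Φ Ψ : List ℕ
    Γ : Ctx 0 n Φ

-- λ-calculus

renLam-cong : ∀ {ρ ρ′ : ℕ → ℕ} → (∀ x → ρ x ≡ ρ′ x) → ∀ t → renLam ρ t ≡ renLam ρ′ t
renLam-cong eq (var x) = cong var (eq x)
renLam-cong eq (t ∙ u) = cong₂ _∙_ (renLam-cong eq t) (renLam-cong eq u)
renLam-cong eq (lam t) =
  cong lam (renLam-cong (λ { zero → refl ; (suc x) → cong suc (eq x) }) t)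

subLam-cong : ∀ {θ θ′ : ℕ → Lam} → (∀ x → θ x ≡ θ′ x) → ∀ t → subLam θ t ≡ subLam θ′ t
subLam-cong eq (var x) = eq x
subLam-cong eq (t ∙ u) = cong₂ _∙_ (subLam-cong eq t) (subLam-cong eq u)
subLam-cong eq (lam t) =
  cong lam (subLam-cong (λ { zero → refl ; (suc x) → cong shift (eq x) }) t)

subLam-var : ∀ {θ} → (∀ x → θ x ≡ var x) → ∀ t → subLam θ t ≡ t
subLam-var eq (var x) = eq x
subLam-var eq (t ∙ u) = cong₂ _∙_ (subLam-var eq t) (subLam-var eq u)
subLam-var eq (lam t) =
  cong lam (subLam-var (λ { zero → refl ; (suc x) → cong shift (eq x) }) t)

renLam-renLam : ∀ ρ ρ′ t → renLam ρ (renLam ρ′ t) ≡ renLam (ρ ∘ ρ′) t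
renLam-renLam ρ ρ′ (var x) = refl
renLam-renLam ρ ρ′ (t ∙ u) = cong₂ _∙_ (renLam-renLam ρ ρ′ t) (renLam-renLam ρ ρ′ u)
renLam-renLam ρ ρ′ (lam t) = cong lam
  (trans (renLam-renLam _ _ t) (renLam-cong (λ { zero → refl ; (suc x) → refl }) t))

subLam-renLam : ∀ θ ρ t → subLam θ (renLam ρ t) ≡ subLam (θ ∘ ρ) t
subLam-renLam θ ρ (var x) = refl
subLam-renLam θ ρ (t ∙ u) = cong₂ _∙_ (subLam-renLam θ ρ t) (subLam-renLam θ ρ u)
subLam-renLam θ ρ (lam t) = cong lam
  (trans (subLam-renLam _ _ t) (subLam-cong (λ { zero → refl ; (suc x) → refl }) t))

renLam-subLam : ∀ ρ θ t → renLam ρ (subLam θ t) ≡ subLam (renLam ρ ∘ θ) t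
renLam-subLam ρ θ (var x) = refl
renLam-subLam ρ θ (t ∙ u) = cong₂ _∙_ (renLam-subLam ρ θ t) (renLam-subLam ρ θ u)
renLam-subLam ρ θ (lam t) = cong lam (trans (renLam-subLam _ _ t) (subLam-cong
  (λ { zero → refl ; (suc x) → trans (renLam-renLam _ _ (θ x)) (sym (renLam-renLam _ _ (θ x))) }) t))

shift-[] : ∀ t u → shift t [ u ] ≡ t
shift-[] t u = trans (subLam-renLam _ suc t) (subLam-var (λ _ → refl) t)

-- Erasure

⟦⟧-cong : ∀ (t : Tm a n) {v w} → (∀ x → v x ≡ w x) → ⟦ t ⟧ v ≡ ⟦ t ⟧ w
⟦⟧-cong (var x)  eq = eq x
⟦⟧-cong (t · u)  eq = cong₂ _∙_ (⟦⟧-cong t eq) (⟦⟧-cong u eq)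
⟦⟧-cong (t ·ᵗ τ) eq = ⟦⟧-cong t eq
⟦⟧-cong (ƛ τ t)  eq = cong lam (⟦⟧-cong t λ { zero → refl ; (suc x) → cong shift (eq x) })
⟦⟧-cong (Λ t)    eq = ⟦⟧-cong t eq

renLam-⟦⟧ : ∀ ρ (t : Tm a n) v → renLam ρ (⟦ t ⟧ v) ≡ ⟦ t ⟧ (renLam ρ ∘ v)
renLam-⟦⟧ ρ (var x)  v = refl
renLam-⟦⟧ ρ (t · u)  v = cong₂ _∙_ (renLam-⟦⟧ ρ t v) (renLam-⟦⟧ ρ u v)
renLam-⟦⟧ ρ (t ·ᵗ τ) v = renLam-⟦⟧ ρ t v
renLam-⟦⟧ ρ (ƛ τ t)  v = cong lam (trans (renLam-⟦⟧ _ t _) (⟦⟧-cong t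
  λ { zero → refl ; (suc x) → trans (renLam-renLam _ _ (v x)) (sym (renLam-renLam _ _ (v x))) }))
renLam-⟦⟧ ρ (Λ t)    v = renLam-⟦⟧ ρ t v

subLam-⟦⟧ : ∀ θ (t : Tm a n) v → subLam θ (⟦ t ⟧ v) ≡ ⟦ t ⟧ (subLam θ ∘ v)
subLam-⟦⟧ θ (var x)  v = refl
subLam-⟦⟧ θ (t · u)  v = cong₂ _∙_ (subLam-⟦⟧ θ t v) (subLam-⟦⟧ θ u v)
subLam-⟦⟧ θ (t ·ᵗ τ) v = subLam-⟦⟧ θ t v
subLam-⟦⟧ θ (ƛ τ t)  v = cong lam (trans (subLam-⟦⟧ _ t _) (⟦⟧-cong t
  λ { zero → refl ; (suc x) → trans (subLam-renLam _ _ (v x)) (sym (renLam-subLam _ _ (v x))) }))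
subLam-⟦⟧ θ (Λ t)    v = subLam-⟦⟧ θ t v

⟦renTm⟧ : ∀ (ρ : Fin a → Fin b) (ξ : Fin m → Fin n) t v →
          ⟦ renTm ρ ξ t ⟧ v ≡ ⟦ t ⟧ (v ∘ ξ)
⟦renTm⟧ ρ ξ (var x)  v = refl
⟦renTm⟧ ρ ξ (t · u)  v = cong₂ _∙_ (⟦renTm⟧ ρ ξ t v) (⟦renTm⟧ ρ ξ u v)
⟦renTm⟧ ρ ξ (t ·ᵗ τ) v = ⟦renTm⟧ ρ ξ t v
⟦renTm⟧ ρ ξ (ƛ τ t)  v = cong lam (trans (⟦renTm⟧ _ _ t _) (⟦⟧-cong t
  λ { zero → refl ; (suc x) → refl }))
⟦renTm⟧ ρ ξ (Λ t)    v = ⟦renTm⟧ _ _ t v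

⟦subTm⟧ : ∀ (σ : Fin a → Ty b) (θ : Fin m → Tm b n) t v →
          ⟦ subTm σ θ t ⟧ v ≡ ⟦ t ⟧ (λ x → ⟦ θ x ⟧ v)
⟦subTm⟧ σ θ (var x)  v = refl
⟦subTm⟧ σ θ (t · u)  v = cong₂ _∙_ (⟦subTm⟧ σ θ t v) (⟦subTm⟧ σ θ u v)
⟦subTm⟧ σ θ (t ·ᵗ τ) v = ⟦subTm⟧ σ θ t v
⟦subTm⟧ σ θ (ƛ τ t)  v = cong lam (trans (⟦subTm⟧ _ _ t _) (⟦⟧-cong t
  λ { zero → refl
    ; (suc x) → trans (⟦renTm⟧ id suc (θ x) _) (sym (renLam-⟦⟧ suc (θ x) v)) }))
⟦subTm⟧ σ θ (Λ t)    v = trans (⟦subTm⟧ _ _ t v) (⟦⟧-cong t λ x → ⟦renTm⟧ suc id (θ x) v)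

⟦⟧-[] : ∀ (t : Tm a (suc n)) u v →
        (⟦ t ⟧ (var zero Vector.∷ (shift ∘ v))) [ u ] ≡ ⟦ t ⟧ (u Vector.∷ v)
⟦⟧-[] t u v = trans (subLam-⟦⟧ _ t _)
  (⟦⟧-cong t λ { zero → refl ; (suc x) → shift-[] (v x) u })

-- Reduction and conversion

reduces : ∀ {t u} → t ⟶ u → t ⟶* u
reduces r = r ◅ ε

≡⇒⟶* : ∀ {t u} → t ≡ u → t ⟶* u
≡⇒⟶* refl = ε

⟶*-∙ : ∀ {t t′ u u′} → t ⟶* t′ → u ⟶* u′ → t ∙ u ⟶* t′ ∙ u′
⟶*-∙ r s = Star.gmap (_∙ _) ∙-l r ◅◅ Star.gmap (_ ∙_) ∙-r s

⟶*-lam : ∀ {t t′} → t ⟶* t′ → lam t ⟶* lam t′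
⟶*-lam = Star.gmap lam lam

⟶*⇒=β : ∀ {t u} → t ⟶* u → t =β u
⟶*⇒=β = Star.map fwd

=β-refl : ∀ {t} → t =β t
=β-refl = ε

=β-sym : ∀ {t u} → t =β u → u =β t
=β-sym = Eq.symmetric _⟶_

=β-∙ : ∀ {t t′ u u′} → t =β t′ → u =β u′ → t ∙ u =β t′ ∙ u′
=β-∙ p q = Eq.gmap (_∙ _) ∙-l p ◅◅ Eq.gmap (_ ∙_) ∙-r q

≡⇒=β : ∀ {t u} → t ≡ u → t =β u
≡⇒=β refl = ε

β-⟦ƛ⟧ : ∀ τ (t : Tm a (suc n)) v u → ⟦ ƛ τ t ⟧ v ∙ u ⟶* ⟦ t ⟧ (u Vector.∷ v)
β-⟦ƛ⟧ τ t v u = β ◅ ≡⇒⟶* (⟦⟧-[] t u v)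

-- Substitution in types

renTy-cong : {ρ ρ′ : Fin a → Fin b} → (∀ x → ρ x ≡ ρ′ x) → ∀ τ → renTy ρ τ ≡ renTy ρ′ τ
renTy-cong eq (var α) = cong var (eq α)
renTy-cong eq (σ ⇒ τ) = cong₂ _⇒_ (renTy-cong eq σ) (renTy-cong eq τ)
renTy-cong eq (∀̇ τ)   = cong ∀̇ (renTy-cong (λ { zero → refl ; (suc x) → cong suc (eq x) }) τ)

subTy-cong : {σ σ′ : Fin a → Ty b} → (∀ x → σ x ≡ σ′ x) → ∀ τ → subTy σ τ ≡ subTy σ′ τ
subTy-cong eq (var α) = eq α
subTy-cong eq (σ ⇒ τ) = cong₂ _⇒_ (subTy-cong eq σ) (subTy-cong eq τ)
subTy-cong eq (∀̇ τ)   =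
  cong ∀̇ (subTy-cong (λ { zero → refl ; (suc x) → cong (renTy suc) (eq x) }) τ)

renTy-renTy : ∀ (ρ : Fin b → Fin c) (ρ′ : Fin a → Fin b) τ →
              renTy ρ (renTy ρ′ τ) ≡ renTy (ρ ∘ ρ′) τ
renTy-renTy ρ ρ′ (var α) = refl
renTy-renTy ρ ρ′ (σ ⇒ τ) = cong₂ _⇒_ (renTy-renTy ρ ρ′ σ) (renTy-renTy ρ ρ′ τ)
renTy-renTy ρ ρ′ (∀̇ τ)   = cong ∀̇ (trans (renTy-renTy _ _ τ)
  (renTy-cong (λ { zero → refl ; (suc x) → refl }) τ))

subTy-renTy : ∀ (σ : Fin b → Ty c) (ρ : Fin a → Fin b) τ →
              subTy σ (renTy ρ τ) ≡ subTy (σ ∘ ρ) τ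
subTy-renTy σ ρ (var α) = refl
subTy-renTy σ ρ (τ ⇒ υ) = cong₂ _⇒_ (subTy-renTy σ ρ τ) (subTy-renTy σ ρ υ)
subTy-renTy σ ρ (∀̇ τ)   = cong ∀̇ (trans (subTy-renTy _ _ τ)
  (subTy-cong (λ { zero → refl ; (suc x) → refl }) τ))

renTy-subTy : ∀ (ρ : Fin b → Fin c) (σ : Fin a → Ty b) τ →
              renTy ρ (subTy σ τ) ≡ subTy (renTy ρ ∘ σ) τ
renTy-subTy ρ σ (var α) = refl
renTy-subTy ρ σ (τ ⇒ υ) = cong₂ _⇒_ (renTy-subTy ρ σ τ) (renTy-subTy ρ σ υ)
renTy-subTy ρ σ (∀̇ τ)   = cong ∀̇ (trans (renTy-subTy _ _ τ) (subTy-cong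
  (λ { zero → refl ; (suc x) → trans (renTy-renTy _ _ (σ x)) (sym (renTy-renTy _ _ (σ x))) }) τ))

subTy-subTy : ∀ (σ : Fin b → Ty c) (σ′ : Fin a → Ty b) τ →
              subTy σ (subTy σ′ τ) ≡ subTy (subTy σ ∘ σ′) τ
subTy-subTy σ σ′ (var α) = refl
subTy-subTy σ σ′ (τ ⇒ υ) = cong₂ _⇒_ (subTy-subTy σ σ′ τ) (subTy-subTy σ σ′ υ)
subTy-subTy σ σ′ (∀̇ τ)   = cong ∀̇ (trans (subTy-subTy _ _ τ) (subTy-cong
  (λ { zero → refl
     ; (suc x) → trans (subTy-renTy _ _ (σ′ x)) (sym (renTy-subTy _ _ (σ′ x))) }) τ))

subTy-var : {σ : Fin a → Ty a} → (∀ x → σ x ≡ var x) → ∀ τ → subTy σ τ ≡ τ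
subTy-var eq (var α) = eq α
subTy-var eq (σ ⇒ τ) = cong₂ _⇒_ (subTy-var eq σ) (subTy-var eq τ)
subTy-var eq (∀̇ τ)   =
  cong ∀̇ (subTy-var (λ { zero → refl ; (suc x) → cong (renTy suc) (eq x) }) τ)

renTy≡subTy : (ρ : Fin a → Fin b) → ∀ τ → renTy ρ τ ≡ subTy (var ∘ ρ) τ
renTy≡subTy ρ (var α) = refl
renTy≡subTy ρ (σ ⇒ τ) = cong₂ _⇒_ (renTy≡subTy ρ σ) (renTy≡subTy ρ τ)
renTy≡subTy ρ (∀̇ τ)   = cong ∀̇ (trans (renTy≡subTy _ τ)
  (subTy-cong (λ { zero → refl ; (suc x) → refl }) τ))

renTy-id : ∀ (τ : Ty a) → renTy id τ ≡ τ
renTy-id τ = trans (renTy≡subTy id τ) (subTy-var (λ _ → refl) τ)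

renTy-[] : ∀ (ρ : Fin a → Fin b) τ σ →
           renTy (lift 1 ρ) τ [ renTy ρ σ ]Ty ≡ renTy ρ (τ [ σ ]Ty)
renTy-[] ρ τ σ = trans (subTy-renTy _ _ τ) (sym (trans (renTy-subTy _ _ τ)
  (subTy-cong (λ { zero → refl ; (suc x) → refl }) τ)))

subTy-[] : ∀ (σ : Fin a → Ty b) τ υ →
           subTy (liftTy σ) τ [ subTy σ υ ]Ty ≡ subTy σ (τ [ υ ]Ty)
subTy-[] σ τ υ = trans (subTy-subTy _ _ τ) (sym (trans (subTy-subTy _ _ τ) (subTy-cong
  (λ { zero → refl
     ; (suc x) → sym (trans (subTy-renTy _ _ (σ x)) (subTy-var (λ _ → refl) (σ x))) }) τ)))

-- Substitution in terms

renTm-cong : {ρ ρ′ : Fin a → Fin b} {ξ ξ′ : Fin m → Fin n} →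
             (∀ x → ρ x ≡ ρ′ x) → (∀ x → ξ x ≡ ξ′ x) → ∀ t → renTm ρ ξ t ≡ renTm ρ′ ξ′ t
renTm-cong p q (var x)  = cong var (q x)
renTm-cong p q (t · u)  = cong₂ _·_ (renTm-cong p q t) (renTm-cong p q u)
renTm-cong p q (t ·ᵗ τ) = cong₂ _·ᵗ_ (renTm-cong p q t) (renTy-cong p τ)
renTm-cong p q (ƛ τ t)  = cong₂ ƛ (renTy-cong p τ)
  (renTm-cong p (λ { zero → refl ; (suc x) → cong suc (q x) }) t)
renTm-cong p q (Λ t)    =
  cong Λ (renTm-cong (λ { zero → refl ; (suc x) → cong suc (p x) }) q t)

subTm-cong : {σ σ′ : Fin a → Ty b} {θ θ′ : Fin m → Tm b n} →
             (∀ x → σ x ≡ σ′ x) → (∀ x → θ x ≡ θ′ x) → ∀ t → subTm σ θ t ≡ subTm σ′ θ′ t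
subTm-cong p q (var x)  = q x
subTm-cong p q (t · u)  = cong₂ _·_ (subTm-cong p q t) (subTm-cong p q u)
subTm-cong p q (t ·ᵗ τ) = cong₂ _·ᵗ_ (subTm-cong p q t) (subTy-cong p τ)
subTm-cong p q (ƛ τ t)  = cong₂ ƛ (subTy-cong p τ)
  (subTm-cong p (λ { zero → refl ; (suc x) → cong (renTm id suc) (q x) }) t)
subTm-cong p q (Λ t)    = cong Λ (subTm-cong
  (λ { zero → refl ; (suc x) → cong (renTy suc) (p x) }) (λ x → cong (renTm suc id) (q x)) t)

renTm-renTm : ∀ (ρ : Fin b → Fin c) (ξ : Fin m → Fin n) (ρ′ : Fin a → Fin b) (ξ′ : Fin l → Fin m) t →
              renTm ρ ξ (renTm ρ′ ξ′ t) ≡ renTm (ρ ∘ ρ′) (ξ ∘ ξ′) t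
renTm-renTm ρ ξ ρ′ ξ′ (var x)  = refl
renTm-renTm ρ ξ ρ′ ξ′ (t · u)  = cong₂ _·_ (renTm-renTm ρ ξ ρ′ ξ′ t) (renTm-renTm ρ ξ ρ′ ξ′ u)
renTm-renTm ρ ξ ρ′ ξ′ (t ·ᵗ τ) = cong₂ _·ᵗ_ (renTm-renTm ρ ξ ρ′ ξ′ t) (renTy-renTy ρ ρ′ τ)
renTm-renTm ρ ξ ρ′ ξ′ (ƛ τ t)  = cong₂ ƛ (renTy-renTy ρ ρ′ τ) (trans (renTm-renTm _ _ _ _ t)
  (renTm-cong (λ _ → refl) (λ { zero → refl ; (suc x) → refl }) t))
renTm-renTm ρ ξ ρ′ ξ′ (Λ t)    = cong Λ (trans (renTm-renTm _ _ _ _ t)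
  (renTm-cong (λ { zero → refl ; (suc x) → refl }) (λ _ → refl) t))

subTm-renTm : ∀ (σ : Fin b → Ty c) (θ : Fin m → Tm c n) (ρ : Fin a → Fin b) (ξ : Fin l → Fin m) t →
              subTm σ θ (renTm ρ ξ t) ≡ subTm (σ ∘ ρ) (θ ∘ ξ) t
subTm-renTm σ θ ρ ξ (var x)  = refl
subTm-renTm σ θ ρ ξ (t · u)  = cong₂ _·_ (subTm-renTm σ θ ρ ξ t) (subTm-renTm σ θ ρ ξ u)
subTm-renTm σ θ ρ ξ (t ·ᵗ τ) = cong₂ _·ᵗ_ (subTm-renTm σ θ ρ ξ t) (subTy-renTy σ ρ τ)
subTm-renTm σ θ ρ ξ (ƛ τ t)  = cong₂ ƛ (subTy-renTy σ ρ τ) (trans (subTm-renTm _ _ _ _ t)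
  (subTm-cong (λ _ → refl) (λ { zero → refl ; (suc x) → refl }) t))
subTm-renTm σ θ ρ ξ (Λ t)    = cong Λ (trans (subTm-renTm _ _ _ _ t)
  (subTm-cong (λ { zero → refl ; (suc x) → refl }) (λ _ → refl) t))

renTm-subTm : ∀ (ρ : Fin b → Fin c) (ξ : Fin m → Fin n) (σ : Fin a → Ty b) (θ : Fin l → Tm b m) t →
              renTm ρ ξ (subTm σ θ t) ≡ subTm (renTy ρ ∘ σ) (renTm ρ ξ ∘ θ) t
renTm-subTm ρ ξ σ θ (var x)  = refl
renTm-subTm ρ ξ σ θ (t · u)  = cong₂ _·_ (renTm-subTm ρ ξ σ θ t) (renTm-subTm ρ ξ σ θ u)
renTm-subTm ρ ξ σ θ (t ·ᵗ τ) = cong₂ _·ᵗ_ (renTm-subTm ρ ξ σ θ t) (renTy-subTy ρ σ τ)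
renTm-subTm ρ ξ σ θ (ƛ τ t)  = cong₂ ƛ (renTy-subTy ρ σ τ) (trans (renTm-subTm _ _ _ _ t)
  (subTm-cong (λ _ → refl) (λ { zero → refl ; (suc x) →
    trans (renTm-renTm _ _ _ _ (θ x)) (sym (renTm-renTm _ _ _ _ (θ x))) }) t))
renTm-subTm ρ ξ σ θ (Λ t)    = cong Λ (trans (renTm-subTm _ _ _ _ t) (subTm-cong
  (λ { zero → refl ; (suc x) → trans (renTy-renTy _ _ (σ x)) (sym (renTy-renTy _ _ (σ x))) })
  (λ x → trans (renTm-renTm _ _ _ _ (θ x)) (sym (renTm-renTm _ _ _ _ (θ x)))) t))

wk-subTm : ∀ (σ : Fin a → Ty b) (θ : Fin m → Tm b n) t →
           renTm id suc (subTm σ θ t) ≡ subTm σ (renTm id suc ∘ θ) t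
wk-subTm σ θ t = trans (renTm-subTm id suc σ θ t)
  (subTm-cong (λ x → renTy-id (σ x)) (λ _ → refl) t)

subTm-subTm : ∀ (σ : Fin b → Ty c) (θ : Fin m → Tm c n) (σ′ : Fin a → Ty b) (θ′ : Fin l → Tm b m) t →
              subTm σ θ (subTm σ′ θ′ t) ≡ subTm (subTy σ ∘ σ′) (subTm σ θ ∘ θ′) t
subTm-subTm σ θ σ′ θ′ (var x)  = refl
subTm-subTm σ θ σ′ θ′ (t · u)  = cong₂ _·_ (subTm-subTm σ θ σ′ θ′ t) (subTm-subTm σ θ σ′ θ′ u)
subTm-subTm σ θ σ′ θ′ (t ·ᵗ τ) = cong₂ _·ᵗ_ (subTm-subTm σ θ σ′ θ′ t) (subTy-subTy σ σ′ τ)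
subTm-subTm σ θ σ′ θ′ (ƛ τ t)  = cong₂ ƛ (subTy-subTy σ σ′ τ) (trans (subTm-subTm _ _ _ _ t)
  (subTm-cong (λ _ → refl) (λ { zero → refl ; (suc x) →
    trans (subTm-renTm _ _ _ _ (θ′ x)) (sym (wk-subTm _ _ (θ′ x))) }) t))
subTm-subTm σ θ σ′ θ′ (Λ t)    = cong Λ (trans (subTm-subTm _ _ _ _ t) (subTm-cong
  (λ { zero → refl ; (suc x) → trans (subTy-renTy _ _ (σ′ x)) (sym (renTy-subTy _ _ (σ′ x))) })
  (λ x → trans (subTm-renTm _ _ _ _ (θ′ x)) (sym (renTm-subTm _ _ _ _ (θ′ x)))) t))

subTm-var : {σ : Fin a → Ty a} {θ : Fin n → Tm a n} →
            (∀ x → σ x ≡ var x) → (∀ x → θ x ≡ var x) → ∀ t → subTm σ θ t ≡ t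
subTm-var p q (var x)  = q x
subTm-var p q (t · u)  = cong₂ _·_ (subTm-var p q t) (subTm-var p q u)
subTm-var p q (t ·ᵗ τ) = cong₂ _·ᵗ_ (subTm-var p q t) (subTy-var p τ)
subTm-var p q (ƛ τ t)  = cong₂ ƛ (subTy-var p τ)
  (subTm-var p (λ { zero → refl ; (suc x) → cong (renTm id suc) (q x) }) t)
subTm-var p q (Λ t)    = cong Λ (subTm-var
  (λ { zero → refl ; (suc x) → cong (renTy suc) (p x) }) (λ x → cong (renTm suc id) (q x)) t)

renTm≡subTm : ∀ (ρ : Fin a → Fin b) (ξ : Fin m → Fin n) t →
              renTm ρ ξ t ≡ subTm (var ∘ ρ) (var ∘ ξ) t
renTm≡subTm ρ ξ (var x)  = refl
renTm≡subTm ρ ξ (t · u)  = cong₂ _·_ (renTm≡subTm ρ ξ t) (renTm≡subTm ρ ξ u)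
renTm≡subTm ρ ξ (t ·ᵗ τ) = cong₂ _·ᵗ_ (renTm≡subTm ρ ξ t) (renTy≡subTy ρ τ)
renTm≡subTm ρ ξ (ƛ τ t)  = cong₂ ƛ (renTy≡subTy ρ τ) (trans (renTm≡subTm _ _ t)
  (subTm-cong (λ _ → refl) (λ { zero → refl ; (suc x) → refl }) t))
renTm≡subTm ρ ξ (Λ t)    = cong Λ (trans (renTm≡subTm _ _ t)
  (subTm-cong (λ { zero → refl ; (suc x) → refl }) (λ _ → refl) t))

renTm-id : ∀ (t : Tm a n) → renTm id id t ≡ t
renTm-id t = trans (renTm≡subTm id id t) (subTm-var (λ _ → refl) (λ _ → refl) t)

-- Substitution in formulas

subFm-cong : {σ σ′ : Fin a → Ty b} {θ θ′ : Fin m → Tm b n} →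
             (∀ x → σ x ≡ σ′ x) → (∀ x → θ x ≡ θ′ x) →
             ∀ (P : Fm a m Φ) → subFm σ θ P ≡ subFm σ′ θ′ P
subFm-cong p q (atom X ts) = cong (atom X) (Vec.map-cong (subTm-cong p q) ts)
subFm-cong p q (P ⊸ Q)     = cong₂ _⊸_ (subFm-cong p q P) (subFm-cong p q Q)
subFm-cong p q (∀² τs P)   = cong₂ ∀² (Vec.map-cong (subTy-cong p) τs) (subFm-cong p q P)
subFm-cong p q (∀¹ τ P)    = cong₂ ∀¹ (subTy-cong p τ)
  (subFm-cong p (λ { zero → refl ; (suc x) → cong (renTm id suc) (q x) }) P)
subFm-cong p q (∀ᵗ P)      = cong ∀ᵗ (subFm-cong
  (λ { zero → refl ; (suc x) → cong (renTy suc) (p x) }) (λ x → cong (renTm suc id) (q x)) P)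
subFm-cong p q (! P)       = cong ! (subFm-cong p q P)

subFm-subFm : ∀ (σ : Fin b → Ty c) (θ : Fin m → Tm c n) (σ′ : Fin a → Ty b) (θ′ : Fin l → Tm b m)
              (P : Fm a l Φ) →
              subFm σ θ (subFm σ′ θ′ P) ≡ subFm (subTy σ ∘ σ′) (subTm σ θ ∘ θ′) P
subFm-subFm σ θ σ′ θ′ (atom X ts) = cong (atom X)
  (trans (sym (Vec.map-∘ _ _ ts)) (Vec.map-cong (subTm-subTm σ θ σ′ θ′) ts))
subFm-subFm σ θ σ′ θ′ (P ⊸ Q)     = cong₂ _⊸_ (subFm-subFm σ θ σ′ θ′ P) (subFm-subFm σ θ σ′ θ′ Q)
subFm-subFm σ θ σ′ θ′ (∀² τs P)   = cong₂ ∀²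
  (trans (sym (Vec.map-∘ _ _ τs)) (Vec.map-cong (subTy-subTy σ σ′) τs)) (subFm-subFm σ θ σ′ θ′ P)
subFm-subFm σ θ σ′ θ′ (∀¹ τ P)    = cong₂ ∀¹ (subTy-subTy σ σ′ τ) (trans (subFm-subFm _ _ _ _ P)
  (subFm-cong (λ _ → refl) (λ { zero → refl ; (suc x) →
    trans (subTm-renTm _ _ _ _ (θ′ x)) (sym (wk-subTm _ _ (θ′ x))) }) P))
subFm-subFm σ θ σ′ θ′ (∀ᵗ P)      = cong ∀ᵗ (trans (subFm-subFm _ _ _ _ P) (subFm-cong
  (λ { zero → refl ; (suc x) → trans (subTy-renTy _ _ (σ′ x)) (sym (renTy-subTy _ _ (σ′ x))) })
  (λ x → trans (subTm-renTm _ _ _ _ (θ′ x)) (sym (renTm-subTm _ _ _ _ (θ′ x)))) P))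
subFm-subFm σ θ σ′ θ′ (! P)       = cong ! (subFm-subFm σ θ σ′ θ′ P)

subFm-var : {σ : Fin a → Ty a} {θ : Fin n → Tm a n} →
            (∀ x → σ x ≡ var x) → (∀ x → θ x ≡ var x) → ∀ (P : Fm a n Φ) → subFm σ θ P ≡ P
subFm-var p q (atom X ts) =
  cong (atom X) (trans (Vec.map-cong (subTm-var p q) ts) (Vec.map-id ts))
subFm-var p q (P ⊸ Q)     = cong₂ _⊸_ (subFm-var p q P) (subFm-var p q Q)
subFm-var p q (∀² τs P)   =
  cong₂ ∀² (trans (Vec.map-cong (subTy-var p) τs) (Vec.map-id τs)) (subFm-var p q P)
subFm-var p q (∀¹ τ P)    = cong₂ ∀¹ (subTy-var p τ)
  (subFm-var p (λ { zero → refl ; (suc x) → cong (renTm id suc) (q x) }) P)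
subFm-var p q (∀ᵗ P)      = cong ∀ᵗ (subFm-var
  (λ { zero → refl ; (suc x) → cong (renTy suc) (p x) }) (λ x → cong (renTm suc id) (q x)) P)
subFm-var p q (! P)       = cong ! (subFm-var p q P)

-- Reduces weakening of formulas to substitution, so that the single fusion law `subFm-subFm`
-- suffices for them. Types and terms need all four mixed laws, because lifting a substitution under
-- a binder renames its values.
renFm≡subFm : ∀ (ρ : Fin a → Fin b) (ξ : Fin m → Fin n) {ζ : ∀ {j} → j ∈ Φ → j ∈ Φ} →
              (∀ {j} (X : j ∈ Φ) → ζ X ≡ X) → ∀ P → renFm ρ ξ ζ P ≡ subFm (var ∘ ρ) (var ∘ ξ) P
renFm≡subFm ρ ξ p (atom X ts) = cong₂ atom (p X) (Vec.map-cong (renTm≡subTm ρ ξ) ts)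
renFm≡subFm ρ ξ p (P ⊸ Q)     = cong₂ _⊸_ (renFm≡subFm ρ ξ p P) (renFm≡subFm ρ ξ p Q)
renFm≡subFm ρ ξ p (∀² τs P)   = cong₂ ∀² (Vec.map-cong (renTy≡subTy ρ) τs)
  (renFm≡subFm ρ ξ (λ { (here _) → refl ; (there X) → cong there (p X) }) P)
renFm≡subFm ρ ξ p (∀¹ τ P)    = cong₂ ∀¹ (renTy≡subTy ρ τ) (trans (renFm≡subFm _ _ p P)
  (subFm-cong (λ _ → refl) (λ { zero → refl ; (suc x) → refl }) P))
renFm≡subFm ρ ξ p (∀ᵗ P)      = cong ∀ᵗ (trans (renFm≡subFm _ _ p P)
  (subFm-cong (λ { zero → refl ; (suc x) → refl }) (λ _ → refl) P))
renFm≡subFm ρ ξ p (! P)       = cong ! (renFm≡subFm ρ ξ p P)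

wk¹≡subFm : ∀ (P : Fm a n Φ) → wk¹ P ≡ subFm var (λ x → var (suc x)) P
wk¹≡subFm = renFm≡subFm id suc (λ _ → refl)

-- Typing

⊢-cast : {Γ : Ctx a n Φ} {t : Tm a n} {σ τ : Ty a} → σ ≡ τ → Γ ⊢ t ⦂ σ → Γ ⊢ t ⦂ τ
⊢-cast refl d = d

⊢renTm : {Γ : Ctx a m Φ} {Γ′ : Ctx b n Ψ} {ρ : Fin a → Fin b} {ξ : Fin m → Fin n} →
         (∀ x → typeOf Γ′ (ξ x) ≡ renTy ρ (typeOf Γ x)) →
         ∀ {t τ} → Γ ⊢ t ⦂ τ → Γ′ ⊢ renTm ρ ξ t ⦂ renTy ρ τ
⊢renTm p (⊢var x)          = ⊢-cast (p x) (⊢var _)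
⊢renTm p (⊢· d e)          = ⊢· (⊢renTm p d) (⊢renTm p e)
⊢renTm {ρ = ρ} p (⊢·ᵗ {τ = τ} d σ) =
  ⊢-cast (renTy-[] ρ τ σ) (⊢·ᵗ (⊢renTm p d) (renTy ρ σ))
⊢renTm p (⊢ƛ d)            = ⊢ƛ (⊢renTm (λ { zero → refl ; (suc x) → p x }) d)
⊢renTm {Γ = Γ} {ρ = ρ} p (⊢Λ d) = ⊢Λ (⊢renTm (λ x → trans (cong (renTy suc) (p x))
  (trans (renTy-renTy _ _ (typeOf Γ x)) (sym (renTy-renTy _ _ (typeOf Γ x))))) d)

⊢wk² : {Γ : Ctx a n Φ} {τs : Vec (Ty a) k} → ∀ {t τ} → Γ ⊢ t ⦂ τ → Γ ▸² τs ⊢ t ⦂ τ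
⊢wk² {Γ = Γ} d =
  subst₂ (_ ⊢_⦂_) (renTm-id _) (renTy-id _) (⊢renTm (λ x → sym (renTy-id (typeOf Γ x))) d)

⊢subTm : {Γ : Ctx a m Φ} {Γ′ : Ctx b n Ψ} {σ : Fin a → Ty b} {θ : Fin m → Tm b n} →
         (∀ x → Γ′ ⊢ θ x ⦂ subTy σ (typeOf Γ x)) →
         ∀ {t τ} → Γ ⊢ t ⦂ τ → Γ′ ⊢ subTm σ θ t ⦂ subTy σ τ

⊢liftTm : {Γ : Ctx a m Φ} {Γ′ : Ctx b n Ψ} {σ : Fin a → Ty b} {θ : Fin m → Tm b n} →
          (∀ x → Γ′ ⊢ θ x ⦂ subTy σ (typeOf Γ x)) → ∀ {τ} x →
          Γ′ ▸ subTy σ τ ⊢ liftTm θ x ⦂ subTy σ (typeOf (Γ ▸ τ) x)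
⊢liftTm p zero = ⊢var zero
⊢liftTm {Γ′ = Γ′} p (suc x) = ⊢-cast (renTy-id _)
  (⊢renTm (λ y → sym (renTy-id (typeOf Γ′ y))) (p x))

⊢liftᵗ : {Γ : Ctx a m Φ} {Γ′ : Ctx b n Ψ} {σ : Fin a → Ty b} {θ : Fin m → Tm b n} →
         (∀ x → Γ′ ⊢ θ x ⦂ subTy σ (typeOf Γ x)) → ∀ x →
         Γ′ ▸ᵗ ⊢ renTm suc id (θ x) ⦂ subTy (liftTy σ) (typeOf (Γ ▸ᵗ) x)
⊢liftᵗ {Γ = Γ} p x = ⊢-cast
  (trans (renTy-subTy _ _ (typeOf Γ x)) (sym (subTy-renTy _ _ (typeOf Γ x))))
  (⊢renTm (λ _ → refl) (p x))

⊢subTm p (⊢var x)          = p x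
⊢subTm p (⊢· d e)          = ⊢· (⊢subTm p d) (⊢subTm p e)
⊢subTm {σ = σ} p (⊢·ᵗ {τ = τ} d υ) =
  ⊢-cast (subTy-[] σ τ υ) (⊢·ᵗ (⊢subTm p d) (subTy σ υ))
⊢subTm p (⊢ƛ d)            = ⊢ƛ (⊢subTm (⊢liftTm p) d)
⊢subTm {Γ = Γ} p (⊢Λ d)    = ⊢Λ (⊢subTm (⊢liftᵗ {Γ = Γ} p) d)

⊢subFm : {Γ : Ctx a m Φ} {Γ′ : Ctx b n Φ} {σ : Fin a → Ty b} {θ : Fin m → Tm b n} →
         (∀ x → Γ′ ⊢ θ x ⦂ subTy σ (typeOf Γ x)) →
         (∀ {j} (X : j ∈ Φ) → sortOf Γ′ X ≡ map (subTy σ) (sortOf Γ X)) →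
         ∀ {P} → Γ ⊢ P ∶Prop → Γ′ ⊢ subFm σ θ P ∶Prop
⊢subFm {Γ = Γ} {σ = σ} p q (ok-atom X {ts} d) = ok-atom X λ i → subst₂ (_ ⊢_⦂_)
  (sym (Vec.lookup-map i _ ts))
  (trans (sym (Vec.lookup-map i (subTy σ) (sortOf Γ X))) (cong (λ τs → lookup τs i) (sym (q X))))
  (⊢subTm p (d i))
⊢subFm p q (ok-⊸ d e) = ok-⊸ (⊢subFm p q d) (⊢subFm p q e)
⊢subFm {Γ = Γ} {Γ′} {σ} p q (ok-∀² {τs = τs} d) = ok-∀² (⊢subFm {Γ = Γ ▸² τs} {Γ′ ▸² map (subTy σ) τs}
  (λ x → ⊢wk² (p x)) (λ { (here refl) → refl ; (there X) → q X }) d)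
⊢subFm p q (ok-∀¹ d)  = ok-∀¹ (⊢subFm (⊢liftTm p) q d)
⊢subFm {Γ = Γ} p q (ok-∀ᵗ d) = ok-∀ᵗ (⊢subFm (⊢liftᵗ {Γ = Γ} p)
  (λ X → trans (cong (map (renTy suc)) (q X))
    (trans (sym (Vec.map-∘ _ _ (sortOf Γ X))) (trans
      (Vec.map-cong (λ τ → trans (renTy-subTy _ _ τ) (sym (subTy-renTy _ _ τ))) (sortOf Γ X))
      (Vec.map-∘ _ _ (sortOf Γ X))))) d)
⊢subFm p q (ok-! d)   = ok-! (⊢subFm p q d)

-- Models

⊩-resp-β : ∀ {ρ : Vector PER a} τ {t t′ u u′} → t =β t′ → u =β u′ →
           ρ ⊩ t ∼ u ⦂ τ → ρ ⊩ t′ ∼ u′ ⦂ τ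
⊩-resp-β {ρ = ρ} (var α) p q (Level.lift r) = Level.lift (PER.resp-β (ρ α) p q r)
⊩-resp-β (σ ⇒ τ) p q r s = ⊩-resp-β τ (=β-∙ p =β-refl) (=β-∙ q =β-refl) (r s)
⊩-resp-β (∀̇ τ)   p q r R = ⊩-resp-β τ p q (r R)

⊩-sym : ∀ {ρ : Vector PER a} τ {t u} → ρ ⊩ t ∼ u ⦂ τ → ρ ⊩ u ∼ t ⦂ τ
⊩-sym {ρ = ρ} (var α) (Level.lift r) = Level.lift (IsPartialEquivalence.sym (PER.isPER (ρ α)) r)
⊩-sym (σ ⇒ τ) r s = ⊩-sym τ (r (⊩-sym σ s))
⊩-sym (∀̇ τ)   r R = ⊩-sym τ (r R)

⊩-trans : ∀ {ρ : Vector PER a} τ {t u w} →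
          ρ ⊩ t ∼ u ⦂ τ → ρ ⊩ u ∼ w ⦂ τ → ρ ⊩ t ∼ w ⦂ τ
⊩-trans {ρ = ρ} (var α) (Level.lift r) (Level.lift s) =
  Level.lift (IsPartialEquivalence.trans (PER.isPER (ρ α)) r s)
⊩-trans (σ ⇒ τ) r s q = ⊩-trans τ (r q) (s (⊩-trans σ (⊩-sym σ q) q))
⊩-trans (∀̇ τ)   r s R = ⊩-trans τ (r R) (s R)

β-PER : PER
β-PER = record
  { rel    = _=β_
  ; isPER  = record { sym = =β-sym ; trans = _◅◅_ }
  ; resp-β = λ p q r → =β-sym p ◅◅ r ◅◅ q
  }

nat-∼⇒=β : ∀ {ρ : Vector PER a} {t u} → ρ ⊩ t ∼ u ⦂ nat → ∀ f x → t ∙ f ∙ x =β u ∙ f ∙ x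
nat-∼⇒=β r f x =
  lower (r β-PER {f} {f} (λ (Level.lift s) → Level.lift (=β-∙ =β-refl s)) (Level.lift =β-refl))

-- The domain condition on stable predicates makes β-equality of the
-- interpretations sufficient, without typing t or u.
=β⇒≐ : ∀ {T : Fm a n Φ → Set ℓ} {Γ : Ctx a n Φ} {t u τ} →
       (∀ M → IsModel Γ M → (∀ Q → T Q → M ⊨ Q) → ⟦ t ⟧ (Env.terms M) =β ⟦ u ⟧ (Env.terms M)) →
       T ⊨[ Γ ] (t ≐[ τ ] u)
=β⇒≐ {τ = τ} eq (env ρ v η) mod th E st (Level.lift e) = Level.lift (Stable.stab st e λ
  { zero → ⊩-resp-β τ =β-refl (eq (env ρ v η) mod th) (Stable.dom st e zero) })

-- From here on contexts declare no type variables: the proof never generalizes over one. This rules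
-- out the case `_▸ᵗ`, in which the types of Σ would be renamed, and makes any two type
-- substitutions agree by `λ ()`.
typeOf-Sig : ∀ (Γ : Ctx 0 n Φ) i → typeOf (Sig,, Γ) (n ↑ʳ i) ≡ typeOf Sig i
typeOf-Sig ∅        i = refl
typeOf-Sig (Γ ▸ τ)  i = typeOf-Sig Γ i
typeOf-Sig (Γ ▸² _) i = typeOf-Sig Γ i

-- Zero and successor in models of ℋ

zeroN : Tm a n
zeroN = Λ (ƛ (var 0F ⇒ var 0F) (ƛ (var 0F) (var 0F)))

sucN : Tm a (suc n)
sucN = Λ (ƛ (var 0F ⇒ var 0F) (ƛ (var 0F) (var 2F ·ᵗ var 0F · var 1F · (var 1F · var 0F))))

⊢zeroN : {Γ : Ctx a n Φ} → Γ ⊢ zeroN ⦂ nat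
⊢zeroN = ⊢Λ (⊢ƛ (⊢ƛ (⊢var 0F)))

⊢sucN : {Γ : Ctx a n Φ} → Γ ▸ nat ⊢ sucN ⦂ nat
⊢sucN = ⊢Λ (⊢ƛ (⊢ƛ (⊢· (⊢· (⊢·ᵗ (⊢var 2F) (var 0F)) (⊢var 1F)) (⊢· (⊢var 1F) (⊢var 0F)))))

⊢≐ : {Γ : Ctx a n Φ} {t u : Tm a n} {τ : Ty a} → Γ ⊢ t ⦂ τ → Γ ⊢ u ⦂ τ → Γ ⊢ t ≐[ τ ] u ∶Prop
⊢≐ d e = ok-∀² (ok-⊸ (ok-atom _ λ { zero → ⊢wk² d }) (ok-atom _ λ { zero → ⊢wk² e }))

module _ {Γ : Ctx 0 n Φ} {M : Env 0 (n + 8) Φ} (mod : IsModel (Sig,, Γ) M)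
         (th : ∀ Q → ℋ↑ {n = n} Q → M ⊨ Q) where

  open Env M using (types; terms)

  private
    -- The ∼-class of `t`. A Leibniz equation with left side `t`, read at this stable predicate,
    -- turns `t ∼ t` into `t ∼ u`, from which `nat-∼⇒=β` extracts a β-equality.
    ∼-pred : Lam → Pred 1
    ∼-pred t us = types ⊩ t ∼ lookup us 0F ⦂ nat

    ∼-pred-stable : ∀ t → Stable types (nat ∷ []) (∼-pred t)
    ∼-pred-stable t = record
      { dom  = λ { {_ ∷ []} r zero → ⊩-trans {ρ = types} nat (⊩-sym {ρ = types} nat r) r }
      ; stab = λ { {_ ∷ []} {_ ∷ []} r s → ⊩-trans {ρ = types} nat r (s 0F) }
      }

    Sig-ok : ∀ i → types ⊩ terms (n ↑ʳ i) ∼ terms (n ↑ʳ i) ⦂ typeOf Sig i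
    Sig-ok i = subst (types ⊩ _ ∼ _ ⦂_) (typeOf-Sig Γ i) (IsModel.terms-ok mod (n ↑ʳ i))

  o-=β : ∀ f x → terms (n ↑ʳ 7F) ∙ f ∙ x =β x
  o-=β f x = nat-∼⇒=β {ρ = types}
    (lower (th _ (_ , (eqn , ⊢≐ (⊢var 7F) ⊢zeroN , λ M mod th → th _ zero-def) , refl)
      (∼-pred _) (∼-pred-stable _) (Level.lift (Sig-ok 7F)))) f x
    ◅◅ ⟶*⇒=β (⟶*-∙ (β-⟦ƛ⟧ {a = 0} nat (ƛ nat (var 0F)) terms f) Star.ε)
    ◅◅ ⟶*⇒=β (β-⟦ƛ⟧ {a = 0} nat (var 0F) (f Vector.∷ terms) x)

  s-=β : ∀ {t} → types ⊩ t ∼ t ⦂ nat →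
         ∀ f x → terms (n ↑ʳ 6F) ∙ t ∙ f ∙ x =β t ∙ f ∙ (f ∙ x)
  s-=β {t} r f x = nat-∼⇒=β {ρ = types}
    (lower (th _ (_ , (gen eqn , ok-∀¹ (⊢≐ (⊢· (⊢var 7F) (⊢var 0F)) ⊢sucN) , λ M mod th → th _ suc-def) , refl)
      t r (∼-pred _) (∼-pred-stable _) (Level.lift (Sig-ok 6F r)))) f x
    -- Only erasures matter, so `sucN` is replaced by a term with dummy annotations and no type
    -- application.
    ◅◅ ⟶*⇒=β (⟶*-∙ (β-⟦ƛ⟧ {a = 0} nat (ƛ nat (var 2F · var 1F · (var 1F · var 0F))) (t Vector.∷ terms) f) Star.ε)
    ◅◅ ⟶*⇒=β (β-⟦ƛ⟧ {a = 0} nat (var 2F · var 1F · (var 1F · var 0F)) (f Vector.∷ (t Vector.∷ terms)) x)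

-- Derivations together with the program they extract to

record Pf (Γ : Ctx 0 n Φ) (Δ : Vec (Fm 0 (n + 8) Φ) d) (P : Fm 0 (n + 8) Φ)
          (F : Vector Lam d → Lam) : Set₂ where
  constructor pf
  field
    {tm} : Tm (length Φ) d
    der  : Γ ⨾ Δ ⊢ tm ⦂ P
    sem  : ∀ v → ⟦ tm ⟧ v ≡ F v

open Pf

cast : ∀ {Δ : Vec _ d} {P Q F} → P ≡ Q → Pf Γ Δ P F → Pf Γ Δ Q F
cast refl p = p

ax : ∀ {P} → Sig,, Γ ⊢ P ∶Prop → Pf Γ (P ∷ []) P (λ v → v 0F)
ax ok = pf (axiom ok) (λ _ → refl)

wk : ∀ {Δ : Vec _ d} {P Q F} → Sig,, Γ ⊢ P ∶Prop → Pf Γ Δ Q F → Pf Γ (P ∷ Δ) Q (λ v → F (v ∘ suc))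
wk ok (pf {t} p s) = pf (weakening p ok) (λ v → trans (⟦renTm⟧ id suc t v) (s _))

infixl 7 _$_
_$_ : ∀ {Δ₁ : Vec _ d₁} {Δ₂ : Vec _ d₂} {P Q F G} → Pf Γ Δ₁ (P ⊸ Q) F → Pf Γ Δ₂ P G →
      Pf Γ (Δ₁ ++ Δ₂) Q (λ v → F (v ∘ (_↑ˡ d₂)) ∙ G (v ∘ (d₁ ↑ʳ_)))
pf {t} p s $ pf {u} q r = pf (application p q) λ v →
  cong₂ _∙_ (trans (⟦renTm⟧ id _ t v) (s _)) (trans (⟦renTm⟧ id _ u v) (r _))

abs : ∀ {Δ : Vec _ d} {P Q F} → Pf Γ (P ∷ Δ) Q F →
      Pf Γ Δ (P ⊸ Q) (λ v → lam (F (var zero Vector.∷ (shift ∘ v))))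
abs (pf p s) = pf (abstraction p) λ v → cong lam (s _)

contr : ∀ {Δ : Vec _ d} {P Q F} → Pf Γ (! P ∷ ! P ∷ Δ) Q F →
        Pf Γ (! P ∷ Δ) Q (λ v → F (v ∘ contract))
contr (pf {t} p s) = pf (contraction p) λ v → trans (⟦renTm⟧ id contract t v) (s _)

-- Hypothesis `i` of the premise is hypothesis `lookup is i` of the conclusion. The inverse table
-- `js` is given as well, so that for concrete tables both inverse laws are decided by evaluation.
exch : (is js : Vec (Fin d) d)
       {_ : True (all? λ i → lookup is (lookup js i) ≟ i)}
       {_ : True (all? λ i → lookup js (lookup is i) ≟ i)} →
       ∀ {Δ : Vec _ d} {P F} → Pf Γ (map (lookup Δ) is) P F → Pf Γ Δ P (λ v → F (v ∘ lookup is))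
exch is js {p} {q} {Δ} (pf {t} r s) = pf
  (exchange (permutation (lookup is) (lookup js) (toWitness p) (toWitness q))
    (λ i → Vec.lookup-map i (lookup Δ) is) r)
  λ v → trans (⟦renTm⟧ id (lookup is) t v) (s _)

-- The weakened hypotheses are taken up to an equation, since `wk¹` of a composite formula is often
-- not in the form that the rest of the derivation uses.
∀¹I : ∀ {Δ : Vec _ d} {Δ′ : Vec _ d} {τ P F} → map wk¹ Δ ≡ Δ′ → Pf (Γ ▸ τ) Δ′ P F → Pf Γ Δ (∀¹ τ P) F
∀¹I refl (pf p s) = pf (∀¹-intro p) s

∀¹E : ∀ {Δ : Vec _ d} {τ P F u} → Pf Γ Δ (∀¹ τ P) F → Sig,, Γ ⊢ u ⦂ τ → Pf Γ Δ (P [ u ]¹) F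
∀¹E (pf p s) d = pf (∀¹-elim p d) s

∀²I : ∀ {Δ : Vec _ d} {Δ′ : Vec _ d} {τs : Vec _ k} {P F} → map wk² Δ ≡ Δ′ →
      Pf (Γ ▸² τs) Δ′ P F → Pf Γ Δ (∀² τs P) F
∀²I refl (pf p s) = pf (∀²-intro p) s

∀²E : ∀ {Δ : Vec _ d} {τs : Vec _ k} {P Q F} → Pf Γ Δ (∀² τs P) F →
      (Sig,, Γ) ▸* τs ⊢ Q ∶Prop → Pf Γ Δ (P [ Q ]²) F
∀²E (pf p s) ok = pf (∀²-elim p ok) s

prom₁ : ∀ {Δ : Vec _ d} {P Q F H} → Pf Γ Δ (! P) F → Pf Γ (P ∷ []) Q H →
        Pf Γ (Δ ++ []) (! Q) (λ v → H (λ _ → F (v ∘ (_↑ˡ 0))))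
prom₁ p@(pf {t} d s) h@(pf {u} e r) = pf (promotion (d ∷ []) e) λ v →
  trans (⟦subTm⟧ var _ u v) (trans (⟦⟧-cong u λ { 0F → trans (⟦renTm⟧ id _ t v) (s _) }) (r _))

prom₂ : ∀ {Δ₁ : Vec _ d₁} {Δ₂ : Vec _ d₂} {P Q R F G H} →
        Pf Γ Δ₁ (! P) F → Pf Γ Δ₂ (! Q) G → Pf Γ (P ∷ Q ∷ []) R H →
        Pf Γ (Δ₁ ++ Δ₂ ++ []) (! R)
          (λ v → H (lookup (F (v ∘ (_↑ˡ (d₂ + 0))) ∷ G (v ∘ (d₁ ↑ʳ_) ∘ (_↑ˡ 0)) ∷ [])))
prom₂ (pf {t₁} d₁ s₁) (pf {t₂} d₂ s₂) (pf {u} e r) = pf (promotion (d₁ ∷ (d₂ ∷ [])) e) λ v →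
  trans (⟦subTm⟧ var _ u v) (trans (⟦⟧-cong u λ
    { 0F → trans (⟦renTm⟧ id _ t₁ v) (s₁ _)
    ; 1F → trans (⟦renTm⟧ id _ (renTm id _ t₂) v) (trans (⟦renTm⟧ id _ t₂ _) (s₂ _)) }) (r _))

nec : ∀ {P F} → Pf Γ [] P F → Pf Γ [] (! P) F
nec (pf {t} d s) = pf (promotion [] d) λ v →
  trans (⟦subTm⟧ var _ t v) (trans (⟦⟧-cong t λ ()) (s v))

-- Predicates of one argument, up to weakening of the context

-- P ⟪ ξ , t ⟫ is P at the argument t, with the other variables renamed by ξ
-- into the scope of t.
infix 8 _⟪_,_⟫
_⟪_,_⟫ : Fm 0 (suc m) Φ → (Fin m → Fin n) → Tm 0 n → Fm 0 n Φ
P ⟪ ξ , t ⟫ = subFm var (t Vector.∷ (λ x → var (ξ x))) P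

-- It is enough that `θ` act as a renaming on the parameters of `P`. Weakening and instantiation
-- both do, so they only change the argument of a predicate and the embedding of its parameters.
subFm-⟪⟫ : ∀ {θ : Fin m → Tm 0 n} {ξ : Fin k → Fin m} {ξ′ : Fin k → Fin n} {t u} →
           (∀ x → θ (ξ x) ≡ var (ξ′ x)) → subTm var θ t ≡ u →
           ∀ (P : Fm 0 (suc k) Φ) → subFm var θ (P ⟪ ξ , t ⟫) ≡ P ⟪ ξ′ , u ⟫
subFm-⟪⟫ p q P = trans (subFm-subFm _ _ _ _ P)
  (subFm-cong (λ ()) (λ { zero → q ; (suc x) → p x }) P)

renFm-⟪⟫ : ∀ {ρ : Fin m → Fin n} {ξ : Fin k → Fin m} {ξ′ : Fin k → Fin n} {t u} →
           (∀ x → ρ (ξ x) ≡ ξ′ x) → renTm id ρ t ≡ u →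
           ∀ (P : Fm 0 (suc k) Φ) → renFm id ρ id (P ⟪ ξ , t ⟫) ≡ P ⟪ ξ′ , u ⟫
renFm-⟪⟫ {ρ = ρ} {t = t} p q P = trans (renFm≡subFm id ρ (λ _ → refl) _)
  (subFm-⟪⟫ (λ x → cong var (p x)) (trans (sym (renTm≡subTm id ρ t)) q) P)

⟪⟫-id : ∀ (P : Fm 0 (suc n) Φ) → P ⟪ suc , var zero ⟫ ≡ P
⟪⟫-id = subFm-var (λ ()) (λ { zero → refl ; (suc x) → refl })

sub-wk : ∀ {u : Tm 0 n} t → subTm var (u Vector.∷ var) (renTm id suc t) ≡ t
sub-wk t = trans (subTm-renTm _ _ _ _ t) (subTm-var (λ ()) (λ _ → refl) t)

⊢wk¹ : {Γ : Ctx 0 n Φ} → ∀ {t σ τ} → Γ ⊢ t ⦂ τ → Γ ▸ σ ⊢ renTm id suc t ⦂ τ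
⊢wk¹ {Γ = Γ} d = ⊢-cast (renTy-id _) (⊢renTm (λ x → sym (renTy-id (typeOf Γ x))) d)

infix 4 _⊑_
-- Lets a predicate formed over one context be used at an argument living in an extension by
-- first-order variables.
record _⊑_ (Γ : Ctx 0 m Φ) (Γ′ : Ctx 0 n Φ) : Set where
  field
    ren    : Fin m → Fin n
    typeOf-ren : ∀ x → typeOf Γ′ (ren x) ≡ typeOf Γ x
    sortOf-ren : ∀ {j} (X : j ∈ Φ) → sortOf Γ′ X ≡ sortOf Γ X

⊑-refl : {Γ : Ctx 0 n Φ} → Γ ⊑ Γ
⊑-refl = record { ren = id ; typeOf-ren = λ _ → refl ; sortOf-ren = λ _ → refl }

⊑-▸ : {Γ : Ctx 0 m Φ} {Γ′ : Ctx 0 n Φ} → Γ ⊑ Γ′ → ∀ {τ} → Γ ⊑ Γ′ ▸ τ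
⊑-▸ r = record { ren = λ x → suc (_⊑_.ren r x) ; typeOf-ren = _⊑_.typeOf-ren r ; sortOf-ren = _⊑_.sortOf-ren r }

⊢⟪⟫ : {Γ : Ctx 0 m Φ} {Γ′ : Ctx 0 n Φ} (r : Γ ⊑ Γ′) → ∀ {τ P t} →
      Γ ▸ τ ⊢ P ∶Prop → Γ′ ⊢ t ⦂ τ → Γ′ ⊢ P ⟪ _⊑_.ren r , t ⟫ ∶Prop
⊢⟪⟫ r ok d = ⊢subFm
  (λ { zero → ⊢-cast (sym (subTy-var (λ ()) _)) d
     ; (suc x) → ⊢-cast (trans (_⊑_.typeOf-ren r x) (sym (subTy-var (λ ()) _))) (⊢var _) })
  (λ X → trans (_⊑_.sortOf-ren r X)
    (sym (trans (Vec.map-cong (subTy-var (λ ())) _) (Vec.map-id _)))) ok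

-- Equality

-- The only side condition with which the equality rule is ever applied; `=β⇒≐` shows that it
-- implies the Leibniz equation.
record _≃⟨_⟩_ (t : Tm 0 (n + 8)) (Γ : Ctx 0 n Φ) (u : Tm 0 (n + 8)) : Set₂ where
  constructor models
  field
    in-models : ∀ M → IsModel (Sig,, Γ) M → (∀ Q → ℋ↑ {n = n} Q → M ⊨ Q) →
                ⟦ t ⟧ (Env.terms M) =β ⟦ u ⟧ (Env.terms M)

≃β : ∀ {t u} → (∀ v → ⟦ t ⟧ v =β ⟦ u ⟧ v) → t ≃⟨ Γ ⟩ u
≃β eq = models λ M _ _ → eq (Env.terms M)

conv : ∀ {Δ : Vec _ d} {τ F t u} (Q : Fm 0 (suc n + 8) Φ) {Γ : Ctx 0 n Φ} →
       (Sig,, Γ) ▸ τ ⊢ Q ∶Prop → Sig,, Γ ⊢ t ⦂ τ → Sig,, Γ ⊢ u ⦂ τ → t ≃⟨ Γ ⟩ u →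
       Pf Γ Δ (Q [ t ]¹) F → Pf Γ Δ (Q [ u ]¹) F
conv {n = n} {t = t} {u} Q ok d e (models eq) (pf p s) = pf (equality Q ok d e (=β⇒≐ {T = ℋ↑ {n = n}} {t = t} {u} eq) p) s

conv⟪⟫ : ∀ {Δ : Vec _ d} {τ F t u} {Γ₀ : Ctx 0 m Φ} (Q : Fm 0 (suc m) Φ) {Γ : Ctx 0 n Φ}
         (r : Γ₀ ⊑ Sig,, Γ) → Γ₀ ▸ τ ⊢ Q ∶Prop → Sig,, Γ ⊢ t ⦂ τ → Sig,, Γ ⊢ u ⦂ τ → t ≃⟨ Γ ⟩ u →
         Pf Γ Δ (Q ⟪ _⊑_.ren r , t ⟫) F → Pf Γ Δ (Q ⟪ _⊑_.ren r , u ⟫) F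
conv⟪⟫ Q r ok d e eq p =
  cast (subFm-⟪⟫ (λ _ → refl) refl Q) (conv (Q ⟪ _ , var zero ⟫) (⊢⟪⟫ (⊑-▸ r) ok (⊢var zero)) d e eq
    (cast (sym (subFm-⟪⟫ (λ _ → refl) refl Q)) p))

wkT : Tm 0 n → Tm 0 (suc n)
wkT = renTm id suc

-- For `A` a bare predicate variable and `G` the successor, this is definitionally the premise of
-- the induction inside `N`.
S : (τ : Ty 0) → Fm 0 (suc n) Φ → Tm 0 n → Fm 0 n Φ
S τ A G = ∀¹ τ (A ⊸ A ⟪ suc , wkT G · var 0F ⟫)

⊢Sig : ∀ {Γ : Ctx 0 n Φ} i → Sig,, Γ ⊢ var (n ↑ʳ i) ⦂ typeOf Sig i
⊢Sig {Γ = Γ} i = ⊢-cast (typeOf-Sig Γ i) (⊢var _)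

⊢o : {Γ : Ctx 0 n Φ} → Sig,, Γ ⊢ o′ n ⦂ nat
⊢o {Γ = Γ} = ⊢Sig {Γ = Γ} 7F

⊢s : {Γ : Ctx 0 n Φ} → Sig,, Γ ⊢ s′ n ⦂ nat ⇒ nat
⊢s {Γ = Γ} = ⊢Sig {Γ = Γ} 6F

S-ok : ∀ {Γ : Ctx 0 n Φ} {τ A G} → Γ ▸ τ ⊢ A ∶Prop → Γ ⊢ G ⦂ τ ⇒ τ → Γ ⊢ S τ A G ∶Prop
S-ok ok d = ok-∀¹ (ok-⊸ ok (⊢⟪⟫ (⊑-▸ ⊑-refl) ok (⊢· (⊢wk¹ d) (⊢var 0F))))

N-ok : ∀ {Γ : Ctx 0 n Φ} {x} → Sig,, Γ ⊢ x ⦂ nat → Sig,, Γ ⊢ N n x ∶Prop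
N-ok {n = n} {Γ = Γ} d = ok-∀² (ok-⊸
  (ok-! (S-ok {A = atom (here refl) (var 0F ∷ [])} (ok-atom _ λ { 0F → ⊢var 0F })
    (⊢s {Γ = Γ ▸² (nat ∷ [])})))
  (ok-! (ok-⊸ (ok-atom _ λ { 0F → ⊢o {Γ = Γ ▸² (nat ∷ [])} }) (ok-atom _ λ { 0F → ⊢wk² d }))))

-- `N` mentions `0` and `s`, so `θ` has to send the variables of Σ to those of Σ in the new scope.
N-sub : ∀ m n (θ : Fin (m + 8) → Tm 0 (n + 8)) → (∀ i → θ (m ↑ʳ i) ≡ var (n ↑ʳ i)) →
        ∀ x → subFm {Φ = Φ} var θ (N m x) ≡ N n (subTm var θ x)
N-sub m n θ p x rewrite p 6F | p 7F = refl

N-wk² : ∀ x → wk² {k = k} (N {Φ = Φ} n x) ≡ N n x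
N-wk² {n = n} x = cong (λ y → ∀² (nat ∷ [])
  (! (S nat (atom (here refl) (var 0F ∷ [])) (s′ n)) ⊸
   ! (atom (here refl) (o′ n ∷ []) ⊸ atom (here refl) (y ∷ [])))) (renTm-id x)

-- Induction

inst : ∀ {Δ : Vec _ d} {y F} (Q : Fm 0 (suc n + 8) Φ) {Γ : Ctx 0 n Φ} →
       (Sig,, Γ) ▸ nat ⊢ Q ∶Prop → Pf Γ Δ (N n y) F →
       Pf Γ Δ (! (S nat Q (s′ n)) ⊸ ! (Q [ o′ n ]¹ ⊸ Q [ y ]¹)) F
inst {n = n} Q ok p = cast (cong₂ _⊸_
  (cong (λ P → ! (∀¹ nat P)) (cong₂ _⊸_ (trans (lemma λ { 0F → refl ; (suc x) → refl }) (⟪⟫-id Q))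
    (lemma λ { 0F → refl ; (suc x) → refl })))
  (cong ! (cong₂ _⊸_ (subFm-cong (λ ()) (λ { 0F → refl ; (suc x) → refl }) Q)
    (subFm-cong (λ ()) (λ { 0F → refl ; (suc x) → refl }) Q)))) (∀²E p ok)
  where
  -- Substituting `Q` for the predicate variable below the quantifier over `y` first weakens `Q` and
  -- then inserts the argument; the two are fused into one substitution.
  lemma : ∀ {ξ : Fin (suc n + 8) → Fin m} {θ : Fin m → Tm 0 (suc n + 8)} {θ′} →
          (∀ x → θ (ξ x) ≡ θ′ x) → subFm var θ (renFm id ξ id Q) ≡ subFm var θ′ Q
  lemma p = trans (cong (subFm var _) (renFm≡subFm id _ (λ _ → refl) Q))
    (trans (subFm-subFm _ _ _ _ Q) (subFm-cong (λ ()) p Q))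

S-elim : ∀ {Δ : Vec _ d} {τ A G F u} → Pf Γ Δ (S τ A G) F → Sig,, Γ ⊢ u ⦂ τ →
         Pf Γ Δ (A [ u ]¹ ⊸ A [ G · u ]¹) F
S-elim {A = A} {G} p d = cast (cong (A [ _ ]¹ ⊸_)
  (subFm-⟪⟫ (λ _ → refl) (cong (_· _) (sub-wk G)) A)) (∀¹E p d)

-- The step of the induction turning N y and ! (S τ A G) into
-- ! (S τ A (y ·ᵗ τ · G)).
⌜step⌝ : Lam → Lam
⌜step⌝ r = lam (lam (var 1 ∙ (shift (shift r) ∙ var 0)))

module Iterate {Γ : Ctx 0 n Φ} {τ : Ty 0} (A : Fm 0 (suc n + 8) Φ) (ok : (Sig,, Γ) ▸ τ ⊢ A ∶Prop)
               {G : Tm 0 (n + 8)} (⊢G : Sig,, Γ ⊢ G ⦂ τ ⇒ τ) where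

  Q : Fm 0 (suc n + 8) Φ
  Q = ∀¹ τ (A ⟪ (λ x → suc (suc x)) , var 0F ⟫ ⊸
            A ⟪ (λ x → suc (suc x)) , var 1F ·ᵗ τ · wkT (wkT G) · var 0F ⟫)

  Q[_] : ∀ y → Q [ y ]¹ ≡ S τ A (y ·ᵗ τ · G)
  Q[ y ] = cong₂ ∀¹ (subTy-var (λ _ → refl) τ) (cong₂ _⊸_
    (trans (subFm-⟪⟫ {ξ′ = suc} (λ _ → refl) refl A) (⟪⟫-id A))
    (subFm-⟪⟫ (λ _ → refl) (cong (_· var 0F) (cong₂ _·_
      (cong (wkT y ·ᵗ_) (trans (subTy-var (λ _ → refl) τ) (sym (renTy-id τ))))
      (trans (subTm-renTm _ _ _ _ (wkT G)) (trans (subTm-renTm _ _ _ _ G) (sym (renTm≡subTm _ _ G)))))) A))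

  ⊢iter : ∀ {y} → Sig,, Γ ⊢ y ⦂ nat → Sig,, Γ ⊢ y ·ᵗ τ · G ⦂ τ ⇒ τ
  ⊢iter d = ⊢· (⊢·ᵗ d τ) ⊢G

  base : Pf Γ [] (S τ A (o′ n ·ᵗ τ · G)) (λ _ → lam (var 0))
  base = ∀¹I refl (abs (conv⟪⟫ A (⊑-▸ ⊑-refl) ok (⊢var 0F)
    (⊢· (⊢wk¹ (⊢iter (⊢o {Γ = Γ}))) (⊢var 0F))
    (models λ M mod th → =β-sym (o-=β {Γ = Γ ▸ τ} mod th _ _))
    (cast (sym (⟪⟫-id A)) (ax ok))))

  Q-ok : (Sig,, Γ) ▸ nat ⊢ Q ∶Prop
  Q-ok = ok-∀¹ (ok-⊸ (⊢⟪⟫ (⊑-▸ (⊑-▸ ⊑-refl)) ok (⊢var 0F))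
    (⊢⟪⟫ (⊑-▸ (⊑-▸ ⊑-refl)) ok (⊢· (⊢· (⊢·ᵗ (⊢var 1F) τ) (⊢wk¹ (⊢wk¹ ⊢G))) (⊢var 0F))))

  private
    w³ : Fin (n + 8) → Fin (suc (suc (suc (n + 8))))
    w³ x = suc (suc (suc x))

    G² : Tm 0 (suc (suc (n + 8)))
    G² = wkT (wkT G)

    ⊢G² : (Sig,, Γ) ▸ nat ▸ τ ⊢ G² ⦂ τ ⇒ τ
    ⊢G² = ⊢wk¹ (⊢wk¹ ⊢G)

    Q↑ S↑ : Fm 0 (suc (suc (n + 8))) Φ
    Q↑ = ∀¹ τ (A ⟪ w³ , var 0F ⟫ ⊸ A ⟪ w³ , var 2F ·ᵗ τ · wkT G² · var 0F ⟫)
    S↑ = ∀¹ τ (A ⟪ w³ , var 0F ⟫ ⊸ A ⟪ w³ , wkT G² · var 0F ⟫)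

    ok³ : ∀ {t} → (Sig,, Γ) ▸ nat ▸ τ ▸ τ ⊢ t ⦂ τ → (Sig,, Γ) ▸ nat ▸ τ ▸ τ ⊢ A ⟪ w³ , t ⟫ ∶Prop
    ok³ = ⊢⟪⟫ (⊑-▸ (⊑-▸ (⊑-▸ ⊑-refl))) ok

    Q-wk : wk¹ Q ≡ Q↑
    Q-wk = cong₂ ∀¹ (renTy-id τ) (cong₂ _⊸_ (renFm-⟪⟫ (λ _ → refl) refl A)
      (renFm-⟪⟫ (λ _ → refl) (cong (_· var 0F) (cong₂ _·_ (cong (var 2F ·ᵗ_) (renTy-id τ))
        (trans (renTm-renTm _ _ _ _ (wkT G)) (sym (renTm-renTm _ _ _ _ (wkT G)))))) A))

    S-wk : wk¹ (wk¹ (S τ A G)) ≡ S↑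
    S-wk = cong₂ ∀¹ (trans (renTy-id _) (renTy-id τ)) (cong₂ _⊸_
      (trans (cong (λ P → renFm id _ id (renFm id _ id P)) (sym (⟪⟫-id A)))
        (trans (cong (renFm id _ id) (renFm-⟪⟫ {ξ′ = λ x → suc (suc x)} (λ _ → refl) refl A))
          (renFm-⟪⟫ (λ _ → refl) refl A)))
      (trans (cong (renFm id _ id) (renFm-⟪⟫ {ξ′ = λ x → suc (suc x)} (λ _ → refl) refl A))
        (renFm-⟪⟫ (λ _ → refl) (cong (_· var 0F) (trans (renTm-renTm _ _ _ _ (wkT G))
          (trans (renTm-renTm _ _ _ _ G) (sym (trans (renTm-renTm _ _ _ _ (wkT G)) (renTm-renTm _ _ _ _ G)))))) A)))

    Q-s : Q ⟪ suc , s′ (suc n) · var 0F ⟫ ≡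
          ∀¹ τ (A ⟪ (λ x → suc (suc x)) , var 0F ⟫ ⊸
                A ⟪ (λ x → suc (suc x)) , s′ (suc (suc n)) · var 1F ·ᵗ τ · G² · var 0F ⟫)
    Q-s = cong₂ ∀¹ (subTy-var (λ _ → refl) τ) (cong₂ _⊸_ (subFm-⟪⟫ (λ _ → refl) refl A)
      (subFm-⟪⟫ (λ _ → refl) (cong (_· var 0F) (cong₂ _·_
        (cong (s′ (suc (suc n)) · var 1F ·ᵗ_) (subTy-var (λ _ → refl) τ))
        (trans (subTm-renTm _ _ _ _ (wkT G)) (trans (subTm-renTm _ _ _ _ G)
          (sym (trans (renTm-renTm _ _ _ _ G) (renTm≡subTm _ _ G))))))) A))

  -- The induction hypothesis for `y` is used at the argument `G u`: `A u` gives `A (G u)`, then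
  -- `A (y τ G (G u))`, which is `A ((s y) τ G u)` by the successor equation. Closure under `G` is
  -- used exactly once, so one promotion puts the whole step under a bang.
  step : Pf Γ (S τ A G ∷ []) (S nat Q (s′ n)) (λ v → ⌜step⌝ (v 0F))
  step = ∀¹I refl (abs (cast (sym Q-s) (∀¹I (cong₂ (λ P R → P ∷ R ∷ []) Q-wk S-wk)
    (abs (exch (1F ∷ 2F ∷ 0F ∷ []) (2F ∷ 0F ∷ 1F ∷ [])
      (conv⟪⟫ A (⊑-▸ (⊑-▸ ⊑-refl)) ok
        (⊢· (⊢· (⊢·ᵗ (⊢var 1F) τ) ⊢G²) (⊢· ⊢G² (⊢var 0F)))
        (⊢· (⊢· (⊢·ᵗ (⊢· (⊢s {Γ = Γ ▸ nat ▸ τ}) (⊢var 1F)) τ) ⊢G²) (⊢var 0F))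
        -- Variable 1 is the integer `y`; the successor equation is available because a model
        -- interprets it in the domain of `nat`.
        (models λ M mod th → =β-sym (s-=β {Γ = Γ ▸ nat ▸ τ} mod th (IsModel.terms-ok mod 1F) _ _))
        (elim (ax (ok-∀¹ (ok-⊸ (ok³ (⊢var 0F))
                (ok³ (⊢· (⊢· (⊢·ᵗ (⊢var 2F) τ) (⊢wk¹ ⊢G²)) (⊢var 0F))))))
              (⊢· ⊢G² (⊢var 0F)) refl (cong₂ (λ υ H → var 1F ·ᵗ υ · H · (G² · var 0F)) (subTy-var (λ _ → refl) τ) (sub-wk G²))
         $ (elim (ax (ok-∀¹ (ok-⊸ (ok³ (⊢var 0F)) (ok³ (⊢· (⊢wk¹ ⊢G²) (⊢var 0F))))))
              (⊢var 0F) refl (cong (_· _) (sub-wk G²))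
            $ ax (⊢⟪⟫ (⊑-▸ (⊑-▸ ⊑-refl)) ok (⊢var 0F))))))))))
    where
    elim : ∀ {t t′ u u′ w} {Δ : Vec _ d} {F} →
           Pf (Γ ▸ nat ▸ τ) Δ (∀¹ τ (A ⟪ w³ , t ⟫ ⊸ A ⟪ w³ , u ⟫)) F →
           (Sig,, Γ) ▸ nat ▸ τ ⊢ w ⦂ τ →
           subTm var (w Vector.∷ var) t ≡ t′ → subTm var (w Vector.∷ var) u ≡ u′ →
           Pf (Γ ▸ nat ▸ τ) Δ (A ⟪ (λ x → suc (suc x)) , t′ ⟫ ⊸ A ⟪ (λ x → suc (suc x)) , u′ ⟫) F
    elim p d eq eq′ = cast (cong₂ _⊸_ (subFm-⟪⟫ (λ _ → refl) eq A) (subFm-⟪⟫ (λ _ → refl) eq′ A)) (∀¹E p d)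

  Q[]-ok : ∀ {y} → Sig,, Γ ⊢ y ⦂ nat → Sig,, Γ ⊢ Q [ y ]¹ ∶Prop
  Q[]-ok {y} d = subst (Sig,, Γ ⊢_∶Prop) (sym Q[ y ]) (S-ok ok (⊢iter d))

  -- The closed proof `base` is supplied inside the outer promotion, so the conclusion sits under no
  -- more bangs than the hypothesis. Iterations can therefore be nested at constant depth.
  iter : ∀ {y} → Sig,, Γ ⊢ y ⦂ nat → Pf Γ (N n y ∷ ! (S τ A G) ∷ []) (! (S τ A (y ·ᵗ τ · G)))
           (λ v → v 0F ∙ ⌜step⌝ (v 1F) ∙ lam (var 0))
  iter {y} d = prom₁
    (inst Q Q-ok (ax (N-ok {Γ = Γ} d)) $ prom₁ (ax (ok-! (S-ok ok ⊢G))) step)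
    (cast Q[ y ] (ax (ok-⊸ (Q[]-ok (⊢o {Γ = Γ})) (Q[]-ok d)) $ cast (sym Q[ o′ n ]) base))

-- Closed programs

⌜iter⌝ ⌜suc⌝ ⌜coerce⌝ ⌜plus⌝ ⌜mult⌝ ⌜pred-step⌝ ⌜pred⌝ ⌜minus⌝ : Lam
⌜iter⌝   = lam (lam (var 1 ∙ ⌜step⌝ (var 0) ∙ lam (var 0)))
⌜suc⌝    = lam (lam (lam (var 1 ∙ (var 2 ∙ var 1 ∙ var 0))))
⌜coerce⌝ = lam (var 0 ∙ ⌜suc⌝ ∙ ⌜ 0 ⌝)
⌜plus⌝   = lam (lam (lam (lam (⌜iter⌝ ∙ var 2 ∙ var 1 ∙ (⌜iter⌝ ∙ var 3 ∙ var 1 ∙ var 0)))))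
⌜mult⌝   = lam (lam (lam (lam (⌜iter⌝ ∙ var 2 ∙ (⌜iter⌝ ∙ var 3 ∙ var 1) ∙ var 0))))
⌜pred-step⌝ = lam (lam (lam (var 0 ∙ (var 1 ∙ var 2))))
⌜pred⌝   = lam (lam (lam (⌜iter⌝ ∙ var 2 ∙ (⌜pred-step⌝ ∙ var 1) ∙ lam (var 1) ∙ lam (var 0))))
⌜minus⌝  = lam (lam (⌜iter⌝ ∙ var 0 ∙ ⌜pred⌝ ∙ (⌜coerce⌝ ∙ var 1)))

iterP : ∀ {Γ : Ctx 0 n Φ} {τ A G y} → (Sig,, Γ) ▸ τ ⊢ A ∶Prop → Sig,, Γ ⊢ G ⦂ τ ⇒ τ →
        Sig,, Γ ⊢ y ⦂ nat →
        Pf Γ [] (N n y ⊸ ! (S τ A G) ⊸ ! (S τ A (y ·ᵗ τ · G))) (λ _ → ⌜iter⌝)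
iterP {Γ = Γ} {A = A} ok d e =
  abs (abs (exch (1F ∷ 0F ∷ []) (1F ∷ 0F ∷ []) (Iterate.iter {Γ = Γ} A ok d e)))

-- The predicate variable introduced by unfolding N
XA : Fm 0 (suc m) (1 ∷ Φ)
XA = atom (here refl) (var 0F ∷ [])

X : Tm 0 m → Fm 0 m (1 ∷ Φ)
X t = atom (here refl) (t ∷ [])

XA-ok : {Γ : Ctx 0 n Φ} → Γ ▸² (nat ∷ []) ▸ nat ⊢ XA ∶Prop
XA-ok = ok-atom _ λ { 0F → ⊢var 0F }

X-ok : ∀ {Γ : Ctx 0 n Φ} {t} → Γ ▸² (nat ∷ []) ⊢ t ⦂ nat → Γ ▸² (nat ∷ []) ⊢ X t ∶Prop
X-ok d = ok-atom _ λ { 0F → d }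

S-X-ok : ∀ {Γ : Ctx 0 n Φ} {G} → Γ ▸² (nat ∷ []) ⊢ G ⦂ nat ⇒ nat → Γ ▸² (nat ∷ []) ⊢ S nat XA G ∶Prop
S-X-ok d = S-ok {A = XA} XA-ok d

zeroP : {Γ : Ctx 0 n Φ} → Pf Γ [] (N n (o′ n)) (λ _ → ⌜ 0 ⌝)
zeroP {Γ = Γ} = ∀²I refl (abs (wk (ok-! (S-X-ok (⊢s {Γ = Γ ▸² (nat ∷ [])})))
  (nec (abs (ax (X-ok (⊢o {Γ = Γ ▸² (nat ∷ [])})))))))

-- The closure hypothesis is contracted: one copy feeds the induction in `N x`, the other makes the
-- last step.
sucP : ∀ {Γ : Ctx 0 n Φ} {x} → Sig,, Γ ⊢ x ⦂ nat → Pf Γ [] (N n x ⊸ N n (s′ n · x)) (λ _ → ⌜suc⌝)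
sucP {n = n} {Γ = Γ} {x} d = abs (∀²I (cong (_∷ []) (N-wk² x)) (abs (contr
  (exch (0F ∷ 2F ∷ 1F ∷ []) (0F ∷ 2F ∷ 1F ∷ [])
    (prom₂ (ax (ok-! S-s-ok)) (inst XA XA-ok (ax (N-ok {Γ = Γ′} d′)) $ ax (ok-! S-s-ok))
      (abs (exch (1F ∷ 2F ∷ 0F ∷ []) (2F ∷ 0F ∷ 1F ∷ [])
        (S-elim {A = XA} (ax S-s-ok) d′ $
         (ax (ok-⊸ (X-ok (⊢o {Γ = Γ′})) (X-ok d′)) $ ax (X-ok (⊢o {Γ = Γ′})))))))))))
  where
  Γ′ = Γ ▸² (nat ∷ [])
  d′ = ⊢wk² {τs = nat ∷ []} d
  S-s-ok : Sig,, Γ′ ⊢ S nat XA (s′ n) ∶Prop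
  S-s-ok = S-X-ok (⊢s {Γ = Γ′})

N⟨0⟩-ok : {Γ : Ctx 0 n Φ} → (Sig,, Γ) ▸ nat ⊢ N (suc n) (var 0F) ∶Prop
N⟨0⟩-ok {Γ = Γ} = N-ok {Γ = Γ ▸ nat} (⊢var 0F)

N[_] : ∀ (x : Tm 0 (n + 8)) → N {Φ = Φ} (suc n) (var 0F) [ x ]¹ ≡ N n x
N[_] {n = n} x = N-sub (suc n) n (x Vector.∷ var) (λ _ → refl) (var 0F)

N⟨_⟩ : ∀ (x : Tm 0 (suc n + 8)) → N {Φ = Φ} (suc n) (var 0F) ⟪ suc , x ⟫ ≡ N (suc n) x
N⟨_⟩ {n = n} x = N-sub (suc n) (suc n) (x Vector.∷ λ i → var (suc i)) (λ _ → refl) (var 0F)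

-- Induction on the predicate `N` itself. Its step `sucP` is closed and hence can be promoted, its
-- base `zeroP` is closed and enters the box, and what comes out is boxed. The program rebuilds the
-- numeral from zero by successors.
coerceP : ∀ {Γ : Ctx 0 n Φ} {x} → Sig,, Γ ⊢ x ⦂ nat → Pf Γ [] (N n x ⊸ ! (N n x)) (λ _ → ⌜coerce⌝)
coerceP {n = n} {Γ = Γ} {x} d = abs (prom₁
  (cast (cong (λ P → ! (S nat (N (suc n) (var 0F)) (s′ n)) ⊸ ! P) (cong₂ _⊸_ N[ o′ n ] N[ x ]))
    (inst (N (suc n) (var 0F)) (N⟨0⟩-ok {Γ = Γ}) (ax (N-ok {Γ = Γ} d)))
   $ nec (∀¹I refl (cast (cong (N (suc n) (var 0F) ⊸_) (sym N⟨ s′ (suc n) · var 0F ⟩)) (sucP {Γ = Γ ▸ nat} (⊢var 0F)))))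
  (ax (ok-⊸ (N-ok {Γ = Γ} (⊢o {Γ = Γ})) (N-ok {Γ = Γ} d)) $ zeroP))

-- Addition and multiplication

iterT : Ty 0 → Tm 0 m → Tm 0 m → Tm 0 m → Tm 0 m
iterT τ y G u = y ·ᵗ τ · G · u

⊢iterT : ∀ {Γ : Ctx 0 n Φ} {τ y G u} → Γ ⊢ y ⦂ nat → Γ ⊢ G ⦂ τ ⇒ τ → Γ ⊢ u ⦂ τ → Γ ⊢ iterT τ y G u ⦂ τ
⊢iterT {τ = τ} d e f = ⊢· (⊢· (⊢·ᵗ d τ) e) f

plusT multT : ∀ n → Tm 0 (n + 8) → Tm 0 (n + 8) → Tm 0 (n + 8)
plusT n x y = iterT nat y (s′ n) (iterT nat x (s′ n) (o′ n))
multT n x y = iterT nat y (x ·ᵗ nat · s′ n) (o′ n)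

module _ {Γ : Ctx 0 n Φ} where
  private
    Γ′ : Ctx 0 n (1 ∷ Φ)
    Γ′ = Γ ▸² (nat ∷ [])

    S-s-ok : Sig,, Γ′ ⊢ S nat XA (s′ n) ∶Prop
    S-s-ok = S-X-ok (⊢s {Γ = Γ′})

    ⊢iter : ∀ {x G} → Sig,, Γ ⊢ x ⦂ nat → Sig,, Γ′ ⊢ G ⦂ nat ⇒ nat → Sig,, Γ′ ⊢ x ·ᵗ nat · G ⦂ nat ⇒ nat
    ⊢iter d e = ⊢· (⊢·ᵗ (⊢wk² d) nat) e

  plusP : ∀ {x y} → Sig,, Γ ⊢ x ⦂ nat → Sig,, Γ ⊢ y ⦂ nat →
          Pf Γ [] (N n x ⊸ N n y ⊸ N n (plusT n x y)) (λ _ → ⌜plus⌝)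
  plusP {x} {y} d e = abs (abs (∀²I (cong₂ (λ P Q → P ∷ Q ∷ []) (N-wk² y) (N-wk² x)) (abs (contr
    (exch (2F ∷ 0F ∷ 3F ∷ 1F ∷ []) (1F ∷ 3F ∷ 0F ∷ 2F ∷ [])
      (prom₂
        (iterP {Γ = Γ′} {A = XA} XA-ok (⊢s {Γ = Γ′}) (⊢wk² e) $ ax (N-ok {Γ = Γ′} (⊢wk² e)) $ ax (ok-! S-s-ok))
        (iterP {Γ = Γ′} {A = XA} XA-ok (⊢s {Γ = Γ′}) (⊢wk² d) $ ax (N-ok {Γ = Γ′} (⊢wk² d)) $ ax (ok-! S-s-ok))
        (abs (exch (1F ∷ 2F ∷ 0F ∷ []) (2F ∷ 0F ∷ 1F ∷ [])
          (S-elim {A = XA} (ax (S-X-ok (⊢iter e (⊢s {Γ = Γ′})))) (⊢· (⊢iter d (⊢s {Γ = Γ′})) (⊢o {Γ = Γ′})) $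
           (S-elim {A = XA} (ax (S-X-ok (⊢iter d (⊢s {Γ = Γ′})))) (⊢o {Γ = Γ′}) $
            ax (X-ok (⊢o {Γ = Γ′}))))))))))))

  -- The inner iteration turns closure of `X` under `s` into closure under `x nat s`, still behind
  -- one bang, and the outer one repeats this `y` times. Closure under `s` is used once, so unlike
  -- for addition nothing is contracted.
  multP : ∀ {x y} → Sig,, Γ ⊢ x ⦂ nat → Sig,, Γ ⊢ y ⦂ nat →
          Pf Γ [] (N n x ⊸ N n y ⊸ N n (multT n x y)) (λ _ → ⌜mult⌝)
  multP {x} {y} d e = abs (abs (∀²I (cong₂ (λ P Q → P ∷ Q ∷ []) (N-wk² y) (N-wk² x)) (abs
    (exch (1F ∷ 2F ∷ 0F ∷ []) (2F ∷ 0F ∷ 1F ∷ [])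
      (prom₁
        (iterP {Γ = Γ′} {A = XA} XA-ok (⊢iter d (⊢s {Γ = Γ′})) (⊢wk² e) $ ax (N-ok {Γ = Γ′} (⊢wk² e)) $
          (iterP {Γ = Γ′} {A = XA} XA-ok (⊢s {Γ = Γ′}) (⊢wk² d) $ ax (N-ok {Γ = Γ′} (⊢wk² d)) $ ax (ok-! S-s-ok)))
        (abs (exch (1F ∷ 0F ∷ []) (1F ∷ 0F ∷ [])
          (S-elim {A = XA} (ax (S-X-ok (⊢iter e (⊢iter d (⊢s {Γ = Γ′}))))) (⊢o {Γ = Γ′}) $
           ax (X-ok (⊢o {Γ = Γ′}))))))))))

-- Chains of implications and conversion below them

infixr 6 _⊸*_
_⊸*_ : Vec (Fm 0 n Φ) k → Fm 0 n Φ → Fm 0 n Φ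
[]       ⊸* Q = Q
(P ∷ Ps) ⊸* Q = P ⊸ (Ps ⊸* Q)

⊸*-ok : ∀ {Γ : Ctx 0 n Φ} {Ps : Vec _ k} {Q} → All (Γ ⊢_∶Prop) Ps → Γ ⊢ Q ∶Prop → Γ ⊢ Ps ⊸* Q ∶Prop
⊸*-ok []         ok = ok
⊸*-ok (ok′ ∷ oks) ok = ok-⊸ ok′ (⊸*-ok oks ok)

wk¹-ok : ∀ {Γ : Ctx 0 n Φ} {τ P} → Γ ⊢ P ∶Prop → Γ ▸ τ ⊢ wk¹ P ∶Prop
wk¹-ok ok = subst (_ ⊢_∶Prop) (sym (wk¹≡subFm _)) (⊢subFm
  (λ x → ⊢-cast (sym (subTy-var (λ ()) _)) (⊢var (suc x)))
  (λ X → sym (trans (Vec.map-cong (subTy-var (λ ())) _) (Vec.map-id _))) ok)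

All-wk¹ : ∀ {Γ : Ctx 0 n Φ} {Ps : Vec _ k} {τ} →
          All (Γ ⊢_∶Prop) Ps → All (Γ ▸ τ ⊢_∶Prop) (map wk¹ Ps)
All-wk¹ []         = []
All-wk¹ (ok ∷ oks) = wk¹-ok ok ∷ All-wk¹ oks

wk¹-[]¹ : ∀ {t : Tm 0 n} (P : Fm 0 n Φ) → wk¹ P [ t ]¹ ≡ P
wk¹-[]¹ P = trans (cong (subFm var _) (wk¹≡subFm P)) (trans (subFm-subFm _ _ _ _ P)
  (subFm-var (λ ()) (λ _ → refl) P))

⊸*-[]¹ : ∀ {t : Tm 0 n} (Ps : Vec (Fm 0 n Φ) k) Q → (map wk¹ Ps ⊸* Q) [ t ]¹ ≡ Ps ⊸* (Q [ t ]¹)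
⊸*-[]¹ []       Q = refl
⊸*-[]¹ (P ∷ Ps) Q = cong₂ _⊸_ (wk¹-[]¹ P) (⊸*-[]¹ Ps Q)

conv⊸* : ∀ {Δ : Vec _ d} {τ F t u} (Ps : Vec (Fm 0 (n + 8) Φ) k) (Q : Fm 0 (suc n + 8) Φ) {Γ : Ctx 0 n Φ} →
         All (Sig,, Γ ⊢_∶Prop) Ps → (Sig,, Γ) ▸ τ ⊢ Q ∶Prop →
         Sig,, Γ ⊢ t ⦂ τ → Sig,, Γ ⊢ u ⦂ τ → t ≃⟨ Γ ⟩ u →
         Pf Γ Δ (Ps ⊸* (Q [ t ]¹)) F → Pf Γ Δ (Ps ⊸* (Q [ u ]¹)) F
conv⊸* Ps Q oks ok d e eq p = cast (⊸*-[]¹ Ps Q)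
  (conv (map wk¹ Ps ⊸* Q) (⊸*-ok (All-wk¹ oks) ok) d e eq (cast (sym (⊸*-[]¹ Ps Q)) p))

convN : ∀ {Δ : Vec _ d} {F t u} {Γ : Ctx 0 n Φ} k (Ps : Vec _ m) →
        All (Sig,, Γ ⊢_∶Prop) Ps → Sig,, Γ ⊢ t ⦂ nat → Sig,, Γ ⊢ u ⦂ nat → t ≃⟨ Γ ⟩ u →
        Pf Γ Δ (Ps ⊸* !^ k (N n t)) F → Pf Γ Δ (Ps ⊸* !^ k (N n u)) F
convN {n = n} {t = t} {u} {Γ} k Ps oks d e eq p = cast (cong (Ps ⊸*_) (!^N u k))
  (conv⊸* Ps (!^ k (N (suc n) (var 0F))) oks (ok k) d e eq (cast (cong (Ps ⊸*_) (sym (!^N t k))) p))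
  where
  ok : ∀ k → (Sig,, Γ) ▸ nat ⊢ !^ k (N (suc n) (var 0F)) ∶Prop
  ok zero    = N⟨0⟩-ok {Γ = Γ}
  ok (suc k) = ok-! (ok k)

  !^N : ∀ t k → !^ k (N (suc n) (var 0F)) [ t ]¹ ≡ !^ k (N n t)
  !^N t zero    = N[ t ]
  !^N t (suc k) = cong ! (!^N t k)

β₂ : ∀ {σ τ} (t : Tm a (suc (suc n))) v x y →
     ⟦ ƛ σ (ƛ τ t) ⟧ v ∙ x ∙ y ⟶* ⟦ t ⟧ (y Vector.∷ (x Vector.∷ v))
β₂ {τ = τ} t v x y = ⟶*-∙ (β-⟦ƛ⟧ τ (ƛ τ t) v x) ε ◅◅ β-⟦ƛ⟧ τ t _ y

β₃ : ∀ {σ τ υ} (t : Tm a (suc (suc (suc n)))) v x y z →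
     ⟦ ƛ σ (ƛ τ (ƛ υ t)) ⟧ v ∙ x ∙ y ∙ z ⟶* ⟦ t ⟧ (z Vector.∷ (y Vector.∷ (x Vector.∷ v)))
β₃ {σ = σ} {τ} {υ} t v x y z = ⟶*-∙ (β₂ {σ = σ} {τ} (ƛ υ t) v x y) ε ◅◅ β-⟦ƛ⟧ υ t _ z

-- Predecessor: iterate g ↦ λ h. h (g s) from λ h. 0 and apply to the identity.

Predᵗ : Ty 0
Predᵗ = (nat ⇒ nat) ⇒ nat

predG pred₀ : ∀ n → Tm 0 (n + 8)
predG n = ƛ Predᵗ (ƛ (nat ⇒ nat) (var 0F · (var 1F · s′ (suc (suc n)))))
pred₀ n = ƛ (nat ⇒ nat) (o′ (suc n))

idT : Tm 0 n
idT = ƛ nat (var 0F)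

predT : ∀ n → Tm 0 (n + 8) → Tm 0 (n + 8)
predT n y = iterT Predᵗ y (predG n) (pred₀ n) · idT

⊢predG : {Γ : Ctx 0 n Φ} → Sig,, Γ ⊢ predG n ⦂ Predᵗ ⇒ Predᵗ
⊢predG {Γ = Γ} = ⊢ƛ (⊢ƛ (⊢· (⊢var 0F) (⊢· (⊢var 1F) (⊢s {Γ = Γ ▸ Predᵗ ▸ nat ⇒ nat}))))

⊢pred₀ : {Γ : Ctx 0 n Φ} → Sig,, Γ ⊢ pred₀ n ⦂ Predᵗ
⊢pred₀ {Γ = Γ} = ⊢ƛ (⊢o {Γ = Γ ▸ nat ⇒ nat})

⊢idT : {Γ : Ctx 0 n Φ} → Γ ⊢ idT ⦂ nat ⇒ nat
⊢idT = ⊢ƛ (⊢var 0F)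

⊢predT : ∀ {Γ : Ctx 0 n Φ} {y} → Sig,, Γ ⊢ y ⦂ nat → Sig,, Γ ⊢ predT n y ⦂ nat
⊢predT {Γ = Γ} d = ⊢· (⊢iterT d (⊢predG {Γ = Γ}) (⊢pred₀ {Γ = Γ})) ⊢idT

-- The state `g` sends every `h` that preserves `X` to an element of `X`. Both maps to which it gets
-- applied preserve `X`: the successor inside each step, by hypothesis, and the identity at the end,
-- trivially. The outermost `h` being the identity is what drops one successor.
PredA : Fm 0 (suc m) (1 ∷ Φ)
PredA = ∀¹ (nat ⇒ nat) (S nat XA (var 0F) ⊸ X (var 1F · var 0F))

module _ {Γ : Ctx 0 n Φ} where
  private
    Γ′ : Ctx 0 n (1 ∷ Φ)
    Γ′ = Γ ▸² (nat ∷ [])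

    S-ok′ : ∀ {m} {Γ : Ctx 0 m Φ} {G σ τ} → (Γ ▸² (nat ∷ [])) ▸ σ ▸ τ ⊢ G ⦂ nat ⇒ nat →
            (Γ ▸² (nat ∷ [])) ▸ σ ▸ τ ⊢ S nat XA G ∶Prop
    S-ok′ d = S-ok {A = XA} (ok-atom _ λ { 0F → ⊢var 0F }) d

    PredA-ok : (Sig,, Γ′) ▸ Predᵗ ⊢ PredA ∶Prop
    PredA-ok = ok-∀¹ (ok-⊸ (S-ok′ {Γ = Sig,, Γ} (⊢var 0F)) (ok-atom _ λ { 0F → ⊢· (⊢var 1F) (⊢var 0F) }))

  pred-stepP : Pf Γ′ [] (S nat XA (s′ n) ⊸ S Predᵗ PredA (predG n)) (λ _ → ⌜pred-step⌝)
  pred-stepP = abs (∀¹I refl (abs (∀¹I refl (abs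
    (conv XA (ok-atom _ λ { 0F → ⊢var 0F })
      (⊢· (⊢var 0F) (⊢· (⊢var 1F) (⊢s {Γ = Γ′ ▸ Predᵗ ▸ nat ⇒ nat})))
      (⊢· (⊢· (⊢predG {Γ = Γ′ ▸ Predᵗ ▸ nat ⇒ nat}) (⊢var 1F)) (⊢var 0F))
      (≃β λ v → =β-sym (⟶*⇒=β (β₂ {a = 0} {σ = nat} {nat} (var 0F · (var 1F · s′ (suc (suc (suc (suc n)))))) v _ _)))
      (S-elim {A = XA} (ax (S-ok′ {Γ = Sig,, Γ} (⊢var 0F))) (⊢· (⊢var 1F) (⊢s {Γ = Γ′ ▸ Predᵗ ▸ nat ⇒ nat})) $
       (∀¹E (ax {P = ∀¹ (nat ⇒ nat) (S nat XA (var 0F) ⊸ X (var 2F · var 0F))}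
         (ok-∀¹ (ok-⊸ (S-ok {A = XA} (ok-atom _ λ { 0F → ⊢var 0F }) (⊢var 0F)) (ok-atom _ λ { 0F → ⊢· (⊢var 2F) (⊢var 0F) }))))
         (⊢s {Γ = Γ′ ▸ Predᵗ ▸ nat ⇒ nat}) $
        ax (S-ok′ {Γ = Sig,, Γ} (⊢s {Γ = Γ′ ▸ Predᵗ ▸ nat ⇒ nat})))))))))

  predP : ∀ {y} → Sig,, Γ ⊢ y ⦂ nat → Pf Γ [] (N n y ⊸ N n (predT n y)) (λ _ → ⌜pred⌝)
  predP {y} d = abs (∀²I (cong (_∷ []) (N-wk² y)) (abs (exch (1F ∷ 0F ∷ []) (1F ∷ 0F ∷ [])
    (prom₁ (iterP {Γ = Γ′} PredA-ok (⊢predG {Γ = Γ′}) ⊢y $ ax (N-ok {Γ = Γ′} ⊢y) $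
            prom₁ (ax (ok-! ok-s)) (pred-stepP $ ax ok-s))
      (abs (exch (1F ∷ 0F ∷ []) (1F ∷ 0F ∷ [])
        (cast (cong (λ t → S nat XA idT ⊸ X (t · idT)) (sub-wk (iterT Predᵗ y (predG n) (pred₀ n))))
          (∀¹E (S-elim {A = PredA} {y ·ᵗ Predᵗ · predG n} (ax (S-ok {A = PredA} PredA-ok (⊢· (⊢·ᵗ ⊢y Predᵗ) (⊢predG {Γ = Γ′})))) (⊢pred₀ {Γ = Γ′}) $
                ∀¹I refl (abs (wk (S-ok {A = XA} (ok-atom _ λ { 0F → ⊢var 0F }) (⊢var 0F))
                  (conv XA (ok-atom _ λ { 0F → ⊢var 0F })
                    (⊢o {Γ = Γ′ ▸ nat ⇒ nat}) (⊢· (⊢pred₀ {Γ = Γ′ ▸ nat ⇒ nat}) (⊢var 0F))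
                    (≃β λ v → =β-sym (⟶*⇒=β (β-⟦ƛ⟧ {a = 0} nat (o′ (suc (suc n))) v _)))
                    (ax (ok-atom _ λ { 0F → ⊢o {Γ = Γ′ ▸ nat ⇒ nat} }))))))
            ⊢idT))
         $ ∀¹I refl (abs (conv XA (ok-atom _ λ { 0F → ⊢var 0F }) (⊢var 0F) (⊢· ⊢idT (⊢var 0F))
             (≃β λ v → =β-sym (⟶*⇒=β (β-⟦ƛ⟧ {a = 0} nat (var 0F) v _)))
             (ax (ok-atom _ λ { 0F → ⊢var 0F }))))))))))
    where
    ⊢y : Sig,, Γ′ ⊢ y ⦂ nat
    ⊢y = ⊢wk² d
    ok-s : Sig,, Γ′ ⊢ S nat XA (s′ n) ∶Prop
    ok-s = S-X-ok (⊢s {Γ = Γ′})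

-- Subtraction

predF : ∀ n → Tm 0 (n + 8)
predF n = ƛ nat (predT (suc n) (var 0F))

⊢predF : {Γ : Ctx 0 n Φ} → Sig,, Γ ⊢ predF n ⦂ nat ⇒ nat
⊢predF {Γ = Γ} = ⊢ƛ (⊢predT {Γ = Γ ▸ nat} (⊢var 0F))

minusT : ∀ n → Tm 0 (n + 8) → Tm 0 (n + 8) → Tm 0 (n + 8)
minusT n x y = iterT nat y (predF n) x

-- A predicate closed under successor need not be closed under predecessor, so the iteration runs on
-- `N` itself rather than on the predicate variable of the goal. Its result is boxed, which costs
-- the bang in the conclusion and requires coercing `N x` into the box.
minusP : ∀ {Γ : Ctx 0 n Φ} {x y} → Sig,, Γ ⊢ x ⦂ nat → Sig,, Γ ⊢ y ⦂ nat →
         Pf Γ [] (N n x ⊸ N n y ⊸ ! (N n (minusT n x y))) (λ _ → ⌜minus⌝)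
minusP {n = n} {Γ = Γ} {x} {y} d e = abs (abs
  (prom₂
    (iterP {Γ = Γ} {A = A} (N⟨0⟩-ok {Γ = Γ}) (⊢predF {Γ = Γ}) e $ ax (N-ok {Γ = Γ} e) $
      nec (∀¹I refl (cast (cong (A ⊸_) (sym N⟨ _ ⟩))
        (convN {Γ = Γ ▸ nat} 0 (A ∷ []) (N⟨0⟩-ok {Γ = Γ} ∷ []) (⊢predT {Γ = Γ ▸ nat} (⊢var 0F))
          (⊢· (⊢wk¹ (⊢predF {Γ = Γ})) (⊢var 0F))
          (≃β λ v → =β-sym (⟶*⇒=β (β-⟦ƛ⟧ nat (predT (suc (suc n)) (var 0F)) v _)))
          (predP {Γ = Γ ▸ nat} (⊢var 0F))))))
    (coerceP {Γ = Γ} d $ ax (N-ok {Γ = Γ} d))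
    (cast (cong₂ _⊸_ N[ x ] N[ y ·ᵗ nat · predF n · x ]) (S-elim {A = A}
      (ax (S-ok (N⟨0⟩-ok {Γ = Γ}) (⊢· (⊢·ᵗ e nat) (⊢predF {Γ = Γ})))) d)
     $ ax (N-ok {Γ = Γ} d))))
  where A = N (suc n) (var 0F)

-- Reductions of the extracted programs

subLam-iterate : ∀ θ m f x → subLam θ (iterate m f x) ≡ iterate m (subLam θ f) (subLam θ x)
subLam-iterate θ zero    f x = refl
subLam-iterate θ (suc m) f x = cong (subLam θ f ∙_) (subLam-iterate θ m f x)

renLam-iterate : ∀ ρ m f x → renLam ρ (iterate m f x) ≡ iterate m (renLam ρ f) (renLam ρ x)
renLam-iterate ρ zero    f x = refl
renLam-iterate ρ (suc m) f x = cong (renLam ρ f ∙_) (renLam-iterate ρ m f x)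

iterate-+ : ∀ m n f x → iterate m f (iterate n f x) ≡ iterate (m + n) f x
iterate-+ zero    n f x = refl
iterate-+ (suc m) n f x = cong (f ∙_) (iterate-+ m n f x)

iterate-⟶* : ∀ m {f x y} → x ⟶* y → iterate m f x ⟶* iterate m f y
iterate-⟶* zero    r = r
iterate-⟶* (suc m) r = ⟶*-∙ ε (iterate-⟶* m r)

shift-⌜⌝ : ∀ m → shift ⌜ m ⌝ ≡ ⌜ m ⌝
shift-⌜⌝ m = cong (λ t → lam (lam t)) (renLam-iterate _ m (var 1) (var 0))

⌜⌝-iterates : ∀ m f x → ⌜ m ⌝ ∙ f ∙ x ⟶* iterate m f x
⌜⌝-iterates m f x = ∙-l β ◅ β ◅ ≡⇒⟶*
  (trans (cong (subLam _) (subLam-iterate _ m _ _)) (trans (subLam-iterate _ m _ _)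
    (cong (λ g → iterate m g x) (shift-[] f x))))

infixr 8 λ̇_
λ̇_ : Tm 0 (suc n) → Tm 0 n
λ̇_ = ƛ nat

-- Terms with dummy annotations, possibly ill-typed, whose erasures are the programs. Through them
-- `β-⟦ƛ⟧` contracts a redex by extending an environment, so no substitution has to be pushed
-- through a program by hand.
iterᵗ sucᵗ coerceᵗ pred-stepᵗ predᵗ : Tm 0 n
iterᵗ      = λ̇ λ̇ (var 1F · (λ̇ λ̇ (var 1F · (var 2F · var 0F))) · (λ̇ var 0F))
sucᵗ       = λ̇ λ̇ λ̇ (var 1F · (var 2F · var 1F · var 0F))
coerceᵗ    = λ̇ (var 0F · sucᵗ · (λ̇ λ̇ var 0F))
pred-stepᵗ = λ̇ λ̇ λ̇ (var 0F · (var 1F · var 2F))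
predᵗ      = λ̇ λ̇ λ̇ (iterᵗ · var 2F · (pred-stepᵗ · var 1F) · (λ̇ var 1F) · (λ̇ var 0F))

β₁ : ∀ (t : Tm 0 (suc n)) v x → ⟦ λ̇ t ⟧ v ∙ x ⟶* ⟦ t ⟧ (x Vector.∷ v)
β₁ = β-⟦ƛ⟧ nat

none : Vector Lam 0
none ()

⌜iter⌝-red : ∀ m r x → ⌜iter⌝ ∙ ⌜ m ⌝ ∙ r ∙ x ⟶* iterate m r x
⌜iter⌝-red m r x = ⟶*-∙ (β₂ {a = 0} {σ = nat} {nat} (var 1F · (λ̇ λ̇ (var 1F · (var 2F · var 0F))) · (λ̇ var 0F)) none ⌜ m ⌝ r) ε
  ◅◅ ⟶*-∙ (⌜⌝-iterates m (⌜step⌝ r) (lam (var 0))) ε ◅◅ steps m x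
  where
  steps : ∀ m x → iterate m (⌜step⌝ r) (lam (var 0)) ∙ x ⟶* iterate m r x
  steps zero    x = reduces β
  steps (suc m) x = β₂ {a = 0} {σ = nat} {nat} (var 1F · (var 2F · var 0F)) (r Vector.∷ none) _ x
    ◅◅ steps m (r ∙ x) ◅◅ ≡⇒⟶* (trans (iterate-+ m 1 r x) (cong (λ j → iterate j r x) (+-comm m 1)))

⌜suc⌝-red : ∀ m → ⌜suc⌝ ∙ ⌜ m ⌝ ⟶* ⌜ suc m ⌝
⌜suc⌝-red m = β₁ (λ̇ λ̇ (var 1F · (var 2F · var 1F · var 0F))) none ⌜ m ⌝
  ◅◅ ⟶*-lam (⟶*-lam (⟶*-∙ ε (≡⇒⟶* (cong (λ c → c ∙ var 1 ∙ var 0) (trans (cong shift (shift-⌜⌝ m)) (shift-⌜⌝ m)))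
    ◅◅ ⌜⌝-iterates m (var 1) (var 0))))

⌜coerce⌝-red : ∀ m → ⌜coerce⌝ ∙ ⌜ m ⌝ ⟶* ⌜ m ⌝
⌜coerce⌝-red m = β₁ (var 0F · sucᵗ · (λ̇ λ̇ var 0F)) none ⌜ m ⌝ ◅◅ ⌜⌝-iterates m ⌜suc⌝ ⌜ 0 ⌝ ◅◅ sucs m
  where
  sucs : ∀ m → iterate m ⌜suc⌝ ⌜ 0 ⌝ ⟶* ⌜ m ⌝
  sucs zero    = ε
  sucs (suc m) = ⟶*-∙ ε (sucs m) ◅◅ ⌜suc⌝-red m

shift²-⌜⌝ : ∀ m → shift (shift ⌜ m ⌝) ≡ ⌜ m ⌝
shift²-⌜⌝ m = trans (cong shift (shift-⌜⌝ m)) (shift-⌜⌝ m)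

⌜plus⌝-red : ∀ m n → ⌜plus⌝ ∙ ⌜ m ⌝ ∙ ⌜ n ⌝ ⟶* ⌜ m + n ⌝
⌜plus⌝-red m n =
  β₂ {a = 0} {σ = nat} {nat} (λ̇ λ̇ (iterᵗ · var 2F · var 1F · (iterᵗ · var 3F · var 1F · var 0F))) none ⌜ m ⌝ ⌜ n ⌝
  ◅◅ ⟶*-lam (⟶*-lam (≡⇒⟶* (cong₂ (λ c d → ⌜iter⌝ ∙ c ∙ var 1 ∙ (⌜iter⌝ ∙ d ∙ var 1 ∙ var 0)) (shift²-⌜⌝ n) (shift²-⌜⌝ m))
    ◅◅ ⌜iter⌝-red n (var 1) _ ◅◅ iterate-⟶* n (⌜iter⌝-red m (var 1) (var 0))
    ◅◅ ≡⇒⟶* (trans (iterate-+ n m _ _) (cong (λ j → iterate j (var 1) (var 0)) (+-comm n m)))))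

⌜mult⌝-red : ∀ m n → ⌜mult⌝ ∙ ⌜ m ⌝ ∙ ⌜ n ⌝ ⟶* ⌜ m * n ⌝
⌜mult⌝-red m n =
  β₂ {a = 0} {σ = nat} {nat} (λ̇ λ̇ (iterᵗ · var 2F · (iterᵗ · var 3F · var 1F) · var 0F)) none ⌜ m ⌝ ⌜ n ⌝
  ◅◅ ⟶*-lam (⟶*-lam (≡⇒⟶* (cong₂ (λ c d → ⌜iter⌝ ∙ c ∙ (⌜iter⌝ ∙ d ∙ var 1) ∙ var 0) (shift²-⌜⌝ n) (shift²-⌜⌝ m))
    ◅◅ ⌜iter⌝-red n _ _ ◅◅ iterates n
    ◅◅ ≡⇒⟶* (cong (λ j → iterate j (var 1) (var 0)) (*-comm n m))))
  where
  iterates : ∀ n → iterate n (⌜iter⌝ ∙ ⌜ m ⌝ ∙ var 1) (var 0) ⟶* iterate (n * m) (var 1) (var 0)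
  iterates zero    = ε
  iterates (suc n) = ⌜iter⌝-red m (var 1) _ ◅◅ iterate-⟶* m (iterates n) ◅◅ ≡⇒⟶* (iterate-+ m (n * m) _ _)

⌜pred⌝-red : ∀ m → ⌜pred⌝ ∙ ⌜ m ⌝ ⟶* ⌜ pred m ⌝
⌜pred⌝-red m =
  β₁ (λ̇ λ̇ (iterᵗ · var 2F · (pred-stepᵗ · var 1F) · (λ̇ var 1F) · (λ̇ var 0F))) none ⌜ m ⌝
  ◅◅ ⟶*-lam (⟶*-lam (≡⇒⟶* (cong (λ c → ⌜iter⌝ ∙ c ∙ G ∙ lam (var 1) ∙ lam (var 0)) (shift²-⌜⌝ m))
    ◅◅ ⟶*-∙ (⌜iter⌝-red m G _) ε ◅◅ steps m))
  where
  G = ⌜pred-step⌝ ∙ var 1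
  step-red : ∀ g h → G ∙ g ∙ h ⟶* h ∙ (g ∙ var 1)
  step-red g h = β₃ {a = 0} {σ = nat} {nat} {nat} (var 0F · (var 1F · var 2F)) none (var 1) g h
  -- Applied to the successor, here `var 1`, a state counts fully; below, applied to the identity,
  -- it loses the outermost successor.
  iterates : ∀ m → iterate m G (lam (var 1)) ∙ var 1 ⟶* iterate m (var 1) (var 0)
  iterates zero    = reduces β
  iterates (suc m) = step-red _ _ ◅◅ ⟶*-∙ ε (iterates m)
  steps : ∀ m → iterate m G (lam (var 1)) ∙ lam (var 0) ⟶* iterate (pred m) (var 1) (var 0)
  steps zero    = reduces β
  steps (suc m) = step-red _ _ ◅◅ β ◅ iterates m

⌜minus⌝-red : ∀ m n → ⌜minus⌝ ∙ ⌜ m ⌝ ∙ ⌜ n ⌝ ⟶* ⌜ m ∸ n ⌝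
⌜minus⌝-red m n =
  β₂ {a = 0} {σ = nat} {nat} (iterᵗ · var 0F · predᵗ · (coerceᵗ · var 1F)) none ⌜ m ⌝ ⌜ n ⌝
  ◅◅ ⌜iter⌝-red n ⌜pred⌝ _ ◅◅ iterate-⟶* n (⌜coerce⌝-red m) ◅◅ iterates n
  where
  iterates : ∀ n → iterate n ⌜pred⌝ ⌜ m ⌝ ⟶* ⌜ m ∸ n ⌝
  iterates zero    = ε
  iterates (suc n) = ⟶*-∙ ε (iterates n) ◅◅ ⌜pred⌝-red (m ∸ n) ◅◅ ≡⇒⟶* (cong ⌜_⌝ (pred[m∸n]≡m∸[1+n] m n))

-- Combinators with n parameters, which build both the term f and the program

fun : ℕ → Ty a → Ty a
fun zero    τ = τ
fun (suc n) τ = nat ⇒ fun n τ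

kT : ℕ → Ty 0 → Tm 0 m
kT zero    τ = ƛ τ (var 0F)
kT (suc n) τ = ƛ τ (ƛ nat (kT n τ · var 1F))

-- `sT` is application in the reader monad. `cT` moves a leading argument behind the parameters; it
-- turns a function of a counter and parameters into a sequence depending on the parameters.
sT cT : ℕ → Ty 0 → Ty 0 → Tm 0 m
sT zero    σ τ = ƛ (σ ⇒ τ) (ƛ σ (var 1F · var 0F))
sT (suc n) σ τ = ƛ (fun (suc n) (σ ⇒ τ)) (ƛ (fun (suc n) σ) (ƛ nat
  (sT n σ τ · (var 2F · var 0F) · (var 1F · var 0F))))
cT zero    σ τ = ƛ (σ ⇒ τ) (var 0F)
cT (suc n) σ τ = ƛ (σ ⇒ fun (suc n) τ) (ƛ nat (cT n σ τ · ƛ σ (var 2F · var 0F · var 1F)))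

pT : ∀ n → Fin n → Tm 0 m
pT (suc n) zero    = kT n nat
pT (suc n) (suc i) = kT 1 (fun n nat) · pT n i

⊢kT : ∀ {Γ : Ctx 0 m Φ} n {τ} → Γ ⊢ kT n τ ⦂ τ ⇒ fun n τ
⊢kT zero    = ⊢ƛ (⊢var 0F)
⊢kT (suc n) = ⊢ƛ (⊢ƛ (⊢· (⊢kT n) (⊢var 1F)))

⊢sT : ∀ {Γ : Ctx 0 m Φ} n {σ τ} → Γ ⊢ sT n σ τ ⦂ fun n (σ ⇒ τ) ⇒ fun n σ ⇒ fun n τ
⊢sT zero    = ⊢ƛ (⊢ƛ (⊢· (⊢var 1F) (⊢var 0F)))
⊢sT (suc n) = ⊢ƛ (⊢ƛ (⊢ƛ (⊢· (⊢· (⊢sT n) (⊢· (⊢var 2F) (⊢var 0F))) (⊢· (⊢var 1F) (⊢var 0F)))))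

⊢cT : ∀ {Γ : Ctx 0 m Φ} n {σ τ} → Γ ⊢ cT n σ τ ⦂ (σ ⇒ fun n τ) ⇒ fun n (σ ⇒ τ)
⊢cT zero    = ⊢ƛ (⊢var 0F)
⊢cT (suc n) = ⊢ƛ (⊢ƛ (⊢· (⊢cT n) (⊢ƛ (⊢· (⊢· (⊢var 2F) (⊢var 0F)) (⊢var 1F)))))

⊢pT : ∀ {Γ : Ctx 0 m Φ} n i → Γ ⊢ pT n i ⦂ fun n nat
⊢pT (suc n) zero    = ⊢kT n
⊢pT (suc n) (suc i) = ⊢· (⊢kT 1) (⊢pT n i)

-- `⌜η⌝ n` is what remains of moving a bang or a first-order quantifier through a chain of `n`
-- hypotheses; the other two on its side also coerce every argument.
⌜K⌝ ⌜S⌝ ⌜C⌝ ⌜η⌝ ⌜boost⌝ ⌜coerce*⌝ : ℕ → Lam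
⌜K⌝ zero    = lam (var 0)
⌜K⌝ (suc n) = lam (lam (⌜K⌝ n ∙ var 1))
⌜S⌝ zero    = lam (lam (var 1 ∙ var 0))
⌜S⌝ (suc n) = lam (lam (lam (⌜S⌝ n ∙ (var 2 ∙ var 0) ∙ (var 1 ∙ var 0))))
⌜C⌝ zero    = lam (var 0)
⌜C⌝ (suc n) = lam (lam (⌜C⌝ n ∙ lam (var 2 ∙ var 0 ∙ var 1)))
⌜η⌝ zero    = lam (var 0)
⌜η⌝ (suc n) = lam (lam (⌜η⌝ n ∙ (var 1 ∙ var 0)))

⌜coerce!⌝ : Lam
⌜coerce!⌝ = lam (⌜coerce⌝ ∙ var 0)

⌜boost⌝ zero    = lam (var 0)
⌜boost⌝ (suc n) = lam (lam (⌜boost⌝ n ∙ (var 1 ∙ (⌜coerce!⌝ ∙ var 0))))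
⌜coerce*⌝ zero    = lam (var 0)
⌜coerce*⌝ (suc n) = lam (lam (⌜coerce*⌝ n ∙ (var 1 ∙ (⌜coerce⌝ ∙ var 0))))

⌜P⌝ : Fin n → Lam
⌜P⌝ {suc n} zero    = ⌜K⌝ n
⌜P⌝ {suc n} (suc i) = ⌜K⌝ 1 ∙ ⌜P⌝ i

⟦kT⟧ : ∀ n {τ} (v : Vector Lam m) → ⟦ kT n τ ⟧ v ≡ ⌜K⌝ n
⟦kT⟧ zero    v = refl
⟦kT⟧ (suc n) v = cong (λ c → lam (lam (c ∙ var 1))) (⟦kT⟧ n _)

⟦sT⟧ : ∀ n {σ τ} (v : Vector Lam m) → ⟦ sT n σ τ ⟧ v ≡ ⌜S⌝ n
⟦sT⟧ zero    v = refl
⟦sT⟧ (suc n) v = cong (λ c → lam (lam (lam (c ∙ (var 2 ∙ var 0) ∙ (var 1 ∙ var 0))))) (⟦sT⟧ n _)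

⟦cT⟧ : ∀ n {σ τ} (v : Vector Lam m) → ⟦ cT n σ τ ⟧ v ≡ ⌜C⌝ n
⟦cT⟧ zero    v = refl
⟦cT⟧ (suc n) v = cong (λ c → lam (lam (c ∙ lam (var 2 ∙ var 0 ∙ var 1)))) (⟦cT⟧ n _)

⟦pT⟧ : ∀ n i (v : Vector Lam m) → ⟦ pT n i ⟧ v ≡ ⌜P⌝ i
⟦pT⟧ (suc n) zero    v = ⟦kT⟧ n v
⟦pT⟧ (suc n) (suc i) v = cong (⌜K⌝ 1 ∙_) (⟦pT⟧ n i v)

ηT boostT coerce*T : ℕ → Tm 0 m
ηT zero    = λ̇ var 0F
ηT (suc n) = λ̇ λ̇ (ηT n · (var 1F · var 0F))
boostT zero    = λ̇ var 0F
boostT (suc n) = λ̇ λ̇ (boostT n · (var 1F · ((λ̇ (coerceᵗ · var 0F)) · var 0F)))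
coerce*T zero    = λ̇ var 0F
coerce*T (suc n) = λ̇ λ̇ (coerce*T n · (var 1F · (coerceᵗ · var 0F)))

⟦ηT⟧ : ∀ n (v : Vector Lam m) → ⟦ ηT n ⟧ v ≡ ⌜η⌝ n
⟦ηT⟧ zero    v = refl
⟦ηT⟧ (suc n) v = cong (λ c → lam (lam (c ∙ (var 1 ∙ var 0)))) (⟦ηT⟧ n _)

⟦boostT⟧ : ∀ n (v : Vector Lam m) → ⟦ boostT n ⟧ v ≡ ⌜boost⌝ n
⟦boostT⟧ zero    v = refl
⟦boostT⟧ (suc n) v = cong (λ c → lam (lam (c ∙ (var 1 ∙ (⌜coerce!⌝ ∙ var 0))))) (⟦boostT⟧ n _)

⟦coerce*T⟧ : ∀ n (v : Vector Lam m) → ⟦ coerce*T n ⟧ v ≡ ⌜coerce*⌝ n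
⟦coerce*T⟧ zero    v = refl
⟦coerce*T⟧ (suc n) v = cong (λ c → lam (lam (c ∙ (var 1 ∙ (⌜coerce⌝ ∙ var 0))))) (⟦coerce*T⟧ n _)

-- Reductions of the combinators

apps : Lam → Vec Lam n → Lam
apps = foldl (λ _ → Lam) _∙_

apps-⟶* : ∀ {c c′} (us : Vec Lam n) → c ⟶* c′ → apps c us ⟶* apps c′ us
apps-⟶* []       r = r
apps-⟶* (u ∷ us) r = apps-⟶* us (⟶*-∙ r ε)

⌜K⌝-red : ∀ (us : Vec Lam n) c → apps (⌜K⌝ n ∙ c) us ⟶* c
⌜K⌝-red []       c = reduces β
⌜K⌝-red {suc n} (u ∷ us) c = apps-⟶* us (≡⇒⟶* (cong (λ k → k ∙ c ∙ u) (sym (⟦kT⟧ (suc n) {nat} none)))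
  ◅◅ β₂ {a = 0} {σ = nat} {nat} (kT n nat · var 1F) none c u
  ◅◅ ≡⇒⟶* (cong (_∙ c) (⟦kT⟧ n _))) ◅◅ ⌜K⌝-red us c

⌜S⌝-red : ∀ (us : Vec Lam n) c e → apps (⌜S⌝ n ∙ c ∙ e) us ⟶* apps c us ∙ apps e us
⌜S⌝-red []       c e = β₂ {a = 0} {σ = nat} {nat} (var 1F · var 0F) none c e
⌜S⌝-red {suc n} (u ∷ us) c e = apps-⟶* us (≡⇒⟶* (cong (λ k → k ∙ c ∙ e ∙ u) (sym (⟦sT⟧ (suc n) {nat} {nat} none)))
  ◅◅ β₃ {a = 0} {σ = nat} {nat} {nat} (sT n nat nat · (var 2F · var 0F) · (var 1F · var 0F)) none c e u
  ◅◅ ≡⇒⟶* (cong (λ k → k ∙ (c ∙ u) ∙ (e ∙ u)) (⟦sT⟧ n _))) ◅◅ ⌜S⌝-red us _ _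

⌜C⌝-red : ∀ (us : Vec Lam n) c x → apps (⌜C⌝ n ∙ c) us ∙ x ⟶* apps (c ∙ x) us
⌜C⌝-red []       c x = ⟶*-∙ (reduces β) ε
⌜C⌝-red {suc n} (u ∷ us) c x = ⟶*-∙ (apps-⟶* us (≡⇒⟶* (cong (λ k → k ∙ c ∙ u) (sym (⟦cT⟧ (suc n) {nat} {nat} none)))
  ◅◅ β₂ {a = 0} {σ = nat} {nat} (cT n nat nat · (λ̇ (var 2F · var 0F · var 1F))) none c u
  ◅◅ ≡⇒⟶* (cong (_∙ _) (⟦cT⟧ n _)))) ε ◅◅ ⌜C⌝-red us _ x
  ◅◅ apps-⟶* us (β₁ (var 2F · var 0F · var 1F) (u Vector.∷ (c Vector.∷ none)) x)

⌜P⌝-red : ∀ (us : Vec Lam n) i → apps (⌜P⌝ i) us ⟶* lookup us i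
⌜P⌝-red (u ∷ us) zero    = ⌜K⌝-red us u
⌜P⌝-red (u ∷ us) (suc i) = apps-⟶* us (⌜K⌝-red (u ∷ []) _) ◅◅ ⌜P⌝-red us i

⌜η⌝-red : ∀ (us : Vec Lam n) c → apps (⌜η⌝ n ∙ c) us ⟶* apps c us
⌜η⌝-red []       c = reduces β
⌜η⌝-red {suc n} (u ∷ us) c = apps-⟶* us (≡⇒⟶* (cong (λ k → k ∙ c ∙ u) (sym (⟦ηT⟧ (suc n) none)))
  ◅◅ β₂ {a = 0} {σ = nat} {nat} (ηT n · (var 1F · var 0F)) none c u
  ◅◅ ≡⇒⟶* (cong (_∙ _) (⟦ηT⟧ n _))) ◅◅ ⌜η⌝-red us _

⌜coerce!⌝-red : ∀ m → ⌜coerce!⌝ ∙ ⌜ m ⌝ ⟶* ⌜ m ⌝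
⌜coerce!⌝-red m = β₁ (coerceᵗ · var 0F) none ⌜ m ⌝ ◅◅ ⌜coerce⌝-red m

⌜boost⌝-red : ∀ (ms : Vec ℕ n) c → apps (⌜boost⌝ n ∙ c) (map ⌜_⌝ ms) ⟶* apps c (map ⌜_⌝ ms)
⌜boost⌝-red []       c = reduces β
⌜boost⌝-red {suc n} (m ∷ ms) c = apps-⟶* (map ⌜_⌝ ms) (≡⇒⟶* (cong (λ k → k ∙ c ∙ ⌜ m ⌝) (sym (⟦boostT⟧ (suc n) none)))
  ◅◅ β₂ {a = 0} {σ = nat} {nat} (boostT n · (var 1F · ((λ̇ (coerceᵗ · var 0F)) · var 0F))) none c ⌜ m ⌝
  ◅◅ ⟶*-∙ (≡⇒⟶* (⟦boostT⟧ n _)) (⟶*-∙ ε (⌜coerce!⌝-red m))) ◅◅ ⌜boost⌝-red ms _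

⌜coerce*⌝-red : ∀ (ms : Vec ℕ n) c → apps (⌜coerce*⌝ n ∙ c) (map ⌜_⌝ ms) ⟶* apps c (map ⌜_⌝ ms)
⌜coerce*⌝-red []       c = reduces β
⌜coerce*⌝-red {suc n} (m ∷ ms) c = apps-⟶* (map ⌜_⌝ ms) (≡⇒⟶* (cong (λ k → k ∙ c ∙ ⌜ m ⌝) (sym (⟦coerce*T⟧ (suc n) none)))
  ◅◅ β₂ {a = 0} {σ = nat} {nat} (coerce*T n · (var 1F · (coerceᵗ · var 0F))) none c ⌜ m ⌝
  ◅◅ ⟶*-∙ (≡⇒⟶* (⟦coerce*T⟧ n _)) (⟶*-∙ ε (⌜coerce⌝-red m))) ◅◅ ⌜coerce*⌝-red ms _

-- Derivations of the combinators

All-! : ∀ {Γ : Ctx 0 n Φ} {Ps : Vec _ k} → All (Γ ⊢_∶Prop) Ps → All (Γ ⊢_∶Prop) (map ! Ps)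
All-! []         = []
All-! (ok ∷ oks) = ok-! ok ∷ All-! oks

kP : ∀ {Γ : Ctx 0 n Φ} {Ps : Vec _ k} {P} → All (Sig,, Γ ⊢_∶Prop) Ps → Sig,, Γ ⊢ P ∶Prop →
     Pf Γ [] (P ⊸ (Ps ⊸* P)) (λ _ → ⌜K⌝ k)
kP []         ok = abs (ax ok)
kP (ok′ ∷ oks) ok = abs (abs (wk ok′ (kP oks ok $ ax ok)))

sP : ∀ {Γ : Ctx 0 n Φ} {Ps : Vec _ k} {P Q} → All (Sig,, Γ ⊢_∶Prop) Ps →
     Sig,, Γ ⊢ P ∶Prop → Sig,, Γ ⊢ Q ∶Prop →
     Pf Γ [] ((map ! Ps ⊸* (P ⊸ Q)) ⊸ (map ! Ps ⊸* P) ⊸ (map ! Ps ⊸* Q)) (λ _ → ⌜S⌝ k)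
sP []         ok ok′ = abs (abs (exch (1F ∷ 0F ∷ []) (1F ∷ 0F ∷ []) (ax (ok-⊸ ok ok′) $ ax ok)))
sP (ok″ ∷ oks) ok ok′ = abs (abs (abs (contr (exch (3F ∷ 0F ∷ 2F ∷ 1F ∷ []) (1F ∷ 3F ∷ 2F ∷ 0F ∷ [])
  (sP oks ok ok′
   $ (ax (ok-⊸ (ok-! ok″) (⊸*-ok (All-! oks) (ok-⊸ ok ok′))) $ ax (ok-! ok″))
   $ (ax (ok-⊸ (ok-! ok″) (⊸*-ok (All-! oks) ok)) $ ax (ok-! ok″)))))))

cP : ∀ {Γ : Ctx 0 n Φ} {Ps : Vec _ k} {P Q} → All (Sig,, Γ ⊢_∶Prop) Ps →
     Sig,, Γ ⊢ P ∶Prop → Sig,, Γ ⊢ Q ∶Prop →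
     Pf Γ [] ((P ⊸ (Ps ⊸* Q)) ⊸ (Ps ⊸* (P ⊸ Q))) (λ _ → ⌜C⌝ k)
cP []         ok ok′ = abs (ax (ok-⊸ ok ok′))
cP (ok″ ∷ oks) ok ok′ = abs (abs (cP oks ok ok′ $ abs (exch (2F ∷ 0F ∷ 1F ∷ []) (1F ∷ 2F ∷ 0F ∷ [])
  (ax (ok-⊸ ok (ok-⊸ ok″ (⊸*-ok oks ok′))) $ ax ok $ ax ok″))))

pP : ∀ {Γ : Ctx 0 n Φ} {Ps : Vec _ k} → All (Sig,, Γ ⊢_∶Prop) Ps → ∀ i →
     Pf Γ [] (Ps ⊸* lookup Ps i) (λ _ → ⌜P⌝ i)
pP (ok ∷ oks) zero    = kP oks ok
pP {Ps = _ ∷ Ps} (ok ∷ oks) (suc i) = kP (ok ∷ []) (⊸*-ok oks (lookup-ok oks i)) $ pP oks i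
  where
  lookup-ok : ∀ {Γ : Ctx 0 n Φ} {Ps : Vec _ k} → All (Γ ⊢_∶Prop) Ps → ∀ i → Γ ⊢ lookup Ps i ∶Prop
  lookup-ok (ok ∷ oks) zero    = ok
  lookup-ok (ok ∷ oks) (suc i) = lookup-ok oks i

!-⊸*P : ∀ {Γ : Ctx 0 n Φ} {Ps : Vec _ k} {P} → All (Sig,, Γ ⊢_∶Prop) Ps → Sig,, Γ ⊢ P ∶Prop →
        Pf Γ [] (! (Ps ⊸* P) ⊸ (map ! Ps ⊸* ! P)) (λ _ → ⌜η⌝ k)
!-⊸*P []          ok = abs (ax (ok-! ok))
!-⊸*P (ok′ ∷ oks) ok = abs (abs (exch (1F ∷ 0F ∷ []) (1F ∷ 0F ∷ [])
  (!-⊸*P oks ok $ prom₂ (ax (ok-! ok″)) (ax (ok-! ok′)) (ax ok″ $ ax ok′))))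
  where ok″ = ok-⊸ ok′ (⊸*-ok oks ok)

-- The hypotheses do not depend on the quantified variable. Each is fed to an instance of the
-- quantified chain at a fresh variable, which is then generalized again.
∀¹-⊸*P : ∀ {Γ : Ctx 0 n Φ} {Ps : Vec _ k} {τ P} → All (Sig,, Γ ⊢_∶Prop) Ps → (Sig,, Γ) ▸ τ ⊢ P ∶Prop →
         Pf Γ [] (∀¹ τ (map wk¹ Ps ⊸* P) ⊸ (Ps ⊸* ∀¹ τ P)) (λ _ → ⌜η⌝ k)
∀¹-⊸*P []          ok = abs (ax (ok-∀¹ ok))
∀¹-⊸*P {Ps = P₀ ∷ Ps} {τ} {P} (ok′ ∷ oks) ok = abs (abs (exch (1F ∷ 0F ∷ []) (1F ∷ 0F ∷ [])
  (∀¹-⊸*P oks ok $ ∀¹I refl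
    (cast elim (∀¹E (ax (wk¹-ok ok″)) (⊢-cast (sym (renTy-id τ)) (⊢var 0F))) $ ax (wk¹-ok ok′)))))
  where
  R = map wk¹ Ps ⊸* P
  ok″ = ok-∀¹ (ok-⊸ (wk¹-ok ok′) (⊸*-ok (All-wk¹ oks) ok))
  -- Weakening below the binder and then instantiating at the fresh variable is the identity.
  elim : renFm id _ id (wk¹ P₀ ⊸ R) [ var 0F ]¹ ≡ wk¹ P₀ ⊸ R
  elim = trans (cong (subFm var _) (renFm≡subFm id _ (λ _ → refl) (wk¹ P₀ ⊸ R)))
    (trans (subFm-subFm _ _ _ _ (wk¹ P₀ ⊸ R))
      (subFm-var (λ ()) (λ { zero → refl ; (suc x) → refl }) (wk¹ P₀ ⊸ R)))

Ns : ∀ n → Vec (Tm 0 (n + 8)) k → Vec (Fm 0 (n + 8) Φ) k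
Ns n = map (N n)

Ns-ok : ∀ {Γ : Ctx 0 n Φ} {xs : Vec _ k} → All (Sig,, Γ ⊢_⦂ nat) xs → All (Sig,, Γ ⊢_∶Prop) (Ns n xs)
Ns-ok []       = []
Ns-ok {Γ = Γ} (d ∷ ds) = N-ok {Γ = Γ} d ∷ Ns-ok {Γ = Γ} ds

-- The coercion is carried under `k` bangs by `k` promotions, which do not show in the program;
-- hence one program for all `k`.
coerce!P : ∀ {Γ : Ctx 0 n Φ} {x} → Sig,, Γ ⊢ x ⦂ nat → ∀ k →
           Pf Γ [] (!^ k (N n x) ⊸ !^ (suc k) (N n x)) (λ _ → ⌜coerce!⌝)
coerce!P {n = n} {Γ = Γ} {x} d k = abs (go k)
  where
  ok : ∀ k → Sig,, Γ ⊢ !^ k (N n x) ∶Prop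
  ok zero    = N-ok {Γ = Γ} d
  ok (suc k) = ok-! (ok k)
  go : ∀ k → Pf Γ (!^ k (N n x) ∷ []) (!^ (suc k) (N n x)) (λ v → ⌜coerce⌝ ∙ v 0F)
  go zero    = coerceP {Γ = Γ} d $ ax (ok 0)
  go (suc k) = prom₁ (ax (ok (suc k))) (go k)

-- Functoriality of the bang alone would ask for arguments `! ! N`. Coercing `! N` to `! ! N`
-- restores the original hypotheses, so the conclusion gains a bang while the chain keeps its shape,
-- and the step can be repeated.
boostP : ∀ {Γ : Ctx 0 n Φ} {xs : Vec _ k} {P} → All (Sig,, Γ ⊢_⦂ nat) xs → Sig,, Γ ⊢ P ∶Prop →
         Pf Γ [] (! (map ! (Ns n xs) ⊸* P) ⊸ (map ! (Ns n xs) ⊸* ! P)) (λ _ → ⌜boost⌝ k)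
boostP []       ok = abs (ax (ok-! ok))
boostP {Γ = Γ} (d ∷ ds) ok = abs (abs (exch (1F ∷ 0F ∷ []) (1F ∷ 0F ∷ [])
  (boostP {Γ = Γ} ds ok $ prom₂ (ax (ok-! ok″)) (coerce!P {Γ = Γ} d 1 $ ax ok′) (ax ok″ $ ax ok′))))
  where
  ok′ = ok-! (N-ok {Γ = Γ} d)
  ok″ = ok-⊸ ok′ (⊸*-ok (All-! (Ns-ok {Γ = Γ} ds)) ok)

coerce*P : ∀ {Γ : Ctx 0 n Φ} {xs : Vec _ k} {P} → All (Sig,, Γ ⊢_⦂ nat) xs → Sig,, Γ ⊢ P ∶Prop →
           Pf Γ [] ((map ! (Ns n xs) ⊸* P) ⊸ (Ns n xs ⊸* P)) (λ _ → ⌜coerce*⌝ k)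
coerce*P []       ok = abs (ax ok)
coerce*P {Γ = Γ} (d ∷ ds) ok = abs (abs (exch (1F ∷ 0F ∷ []) (1F ∷ 0F ∷ [])
  (coerce*P {Γ = Γ} ds ok $ (ax (ok-⊸ (ok-! ok′) (⊸*-ok (All-! (Ns-ok {Γ = Γ} ds)) ok)) $ (coerceP {Γ = Γ} d $ ax ok′)))))
  where ok′ = N-ok {Γ = Γ} d

-- Bounded sums and products

↑ : ∀ n → Tm 0 8 → Tm 0 (n + 8)
↑ n = renTm id (n ↑ʳ_)

⊢↑ : ∀ {Γ : Ctx 0 n Φ} {t τ} → Sig ⊢ t ⦂ τ → Sig,, Γ ⊢ ↑ n t ⦂ τ
⊢↑ {Γ = Γ} d = ⊢-cast (renTy-id _) (⊢renTm (λ x → trans (typeOf-Sig Γ x) (sym (renTy-id _))) d)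

sub-lift-wk : ∀ {θ : Fin m → Tm 0 n} t → subTm var (liftTm θ) (wkT t) ≡ wkT (subTm var θ t)
sub-lift-wk t = trans (subTm-renTm _ _ _ _ t) (sym (wk-subTm _ _ t))

⟦wkT³⟧ : ∀ (t : Tm 0 n) v → ⟦ wkT (wkT (wkT t)) ⟧ v ≡ ⟦ t ⟧ (λ x → v (suc (suc (suc x))))
⟦wkT³⟧ t v = trans (⟦renTm⟧ id suc (wkT (wkT t)) v)
  (trans (⟦renTm⟧ id suc (wkT t) _) (⟦renTm⟧ id suc t _))

!^-sub : ∀ {θ : Fin m → Tm 0 n} k {P : Fm 0 m Φ} {Q} → subFm var θ P ≡ Q → subFm var θ (!^ k P) ≡ !^ k Q
!^-sub zero    eq = eq
!^-sub (suc k) eq = cong ! (!^-sub k eq)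

!^-ok : ∀ {Γ : Ctx 0 n Φ} k {P} → Γ ⊢ P ∶Prop → Γ ⊢ !^ k P ∶Prop
!^-ok zero    ok = ok
!^-ok (suc k) ok = ok-! (!^-ok k ok)

Bounds : ∀ k n → Tm 0 (n + 8) → Fm 0 (n + 8) Φ
Bounds k n f = ∀¹ nat (! (N (suc n) (var 0F)) ⊸ !^ k (N (suc n) (wkT f · var 0F)))

-- The accumulator has the depth `k` of the values that `Bounds` provides: it is combined with them
-- under `k` promotions, and no rule would bring a value back to a smaller depth.
Accumulates : ∀ k n → Tm 0 (n + 8) → Fm 0 (n + 8) Φ
Accumulates k n h = ∀¹ nat (∀¹ nat (! (N (suc (suc n)) (var 1F)) ⊸
  !^ k (N (suc (suc n)) (var 0F)) ⊸ !^ k (N (suc (suc n)) (wkT (wkT h) · var 1F · var 0F))))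

module _ (θ : Fin (m + 8) → Tm 0 (n + 8)) (p : ∀ i → θ (m ↑ʳ i) ≡ var (n ↑ʳ i)) where

  Bounds-sub : ∀ k f → subFm {Φ = Φ} var θ (Bounds k m f) ≡ Bounds k n (subTm var θ f)
  Bounds-sub k f = cong (∀¹ nat) (cong₂ _⊸_ (cong ! (N↑ (var 0F)))
    (!^-sub k (trans (N↑ (wkT f · var 0F)) (cong (λ t → N (suc n) (t · var 0F)) (sub-lift-wk f)))))
    where N↑ = N-sub (suc m) (suc n) (liftTm θ) (λ i → cong (renTm id suc) (p i))

  Accumulates-sub : ∀ k h → subFm {Φ = Φ} var θ (Accumulates k m h) ≡ Accumulates k n (subTm var θ h)
  Accumulates-sub k h = cong (λ P → ∀¹ nat (∀¹ nat P)) (cong₂ _⊸_ (cong ! (N↑ (var 1F)))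
    (cong₂ _⊸_ (!^-sub k (N↑ (var 0F))) (!^-sub k (trans (N↑ (wkT (wkT h) · var 1F · var 0F))
      (cong (λ t → N (suc (suc n)) (t · var 1F · var 0F))
        (trans (sub-lift-wk (wkT h)) (cong wkT (sub-lift-wk h))))))))
    where N↑ = N-sub (suc (suc m)) (suc (suc n)) (liftTm (liftTm θ))
                 (λ i → cong (λ t → renTm id suc (renTm id suc t)) (p i))

Bounds-wk : ∀ k n f → wk¹ {Φ = Φ} (Bounds k n f) ≡ Bounds k (suc n) (wkT f)
Bounds-wk k n f = trans (wk¹≡subFm (Bounds k n f)) (trans (Bounds-sub (λ x → var (suc x)) (λ _ → refl) k f)
  (cong (Bounds k (suc n)) (sym (renTm≡subTm id suc f))))

Accumulates-wk : ∀ k n h → wk¹ {Φ = Φ} (Accumulates k n h) ≡ Accumulates k (suc n) (wkT h)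
Accumulates-wk k n h = trans (wk¹≡subFm (Accumulates k n h))
  (trans (Accumulates-sub (λ x → var (suc x)) (λ _ → refl) k h)
    (cong (Accumulates k (suc n)) (sym (renTm≡subTm id suc h))))

Bounds-ok : ∀ {Γ : Ctx 0 n Φ} k {f} → Sig,, Γ ⊢ f ⦂ nat ⇒ nat → Sig,, Γ ⊢ Bounds k n f ∶Prop
Bounds-ok {Γ = Γ} k d = ok-∀¹ (ok-⊸ (ok-! (N-ok {Γ = Γ ▸ nat} (⊢var 0F)))
  (!^-ok k (N-ok {Γ = Γ ▸ nat} (⊢· (⊢wk¹ d) (⊢var 0F)))))

Accumulates-ok : ∀ {Γ : Ctx 0 n Φ} k {h} → Sig,, Γ ⊢ h ⦂ nat ⇒ nat ⇒ nat → Sig,, Γ ⊢ Accumulates k n h ∶Prop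
Accumulates-ok {Γ = Γ} k d = ok-∀¹ (ok-∀¹ (ok-⊸ (ok-! (N-ok {Γ = Γ ▸ nat ▸ nat} (⊢var 1F)))
  (ok-⊸ (!^-ok k (N-ok {Γ = Γ ▸ nat ▸ nat} (⊢var 0F)))
    (!^-ok k (N-ok {Γ = Γ ▸ nat ▸ nat} (⊢· (⊢· (⊢wk¹ (⊢wk¹ d)) (⊢var 1F)) (⊢var 0F)))))))

Bounds-elim : ∀ {Γ : Ctx 0 n Φ} {Δ : Vec _ d} k {f F i} → Pf Γ Δ (Bounds k n f) F → Sig,, Γ ⊢ i ⦂ nat →
              Pf Γ Δ (! (N n i) ⊸ !^ k (N n (f · i))) F
Bounds-elim {n = n} k {f} {i = i} p d = cast (cong₂ _⊸_ (cong ! (N↓ (var 0F)))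
  (!^-sub k (trans (N↓ (wkT f · var 0F)) (cong (λ t → N n (t · i)) (sub-wk f))))) (∀¹E p d)
  where N↓ = N-sub (suc n) n (i Vector.∷ var) (λ _ → refl)

Accumulates-elim : ∀ {Γ : Ctx 0 n Φ} {Δ : Vec _ d} k {h F i x} → Pf Γ Δ (Accumulates k n h) F →
                   Sig,, Γ ⊢ i ⦂ nat → Sig,, Γ ⊢ x ⦂ nat →
                   Pf Γ Δ (! (N n i) ⊸ !^ k (N n x) ⊸ !^ k (N n (h · i · x))) F
Accumulates-elim {n = n} k {h} {i = i} {x} p d e = cast
  (trans (subFm-subFm _ _ _ _ body) (trans
    (subFm-cong {θ′ = θ} (λ ()) (λ { 0F → refl ; 1F → sub-wk i ; (suc (suc _)) → refl }) body)
    (cong₂ _⊸_ (cong ! (N↓ (var 1F))) (cong₂ _⊸_ (!^-sub k (N↓ (var 0F)))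
      (!^-sub k (trans (N↓ (wkT (wkT h) · var 1F · var 0F)) (cong (λ t → N n (t · i · x))
        (trans (subTm-renTm _ _ _ _ (wkT h)) (trans (subTm-renTm _ _ _ _ h)
          (subTm-var (λ ()) (λ _ → refl) h)))))))))
  ) (∀¹E (∀¹E p d) e)
  where
  θ = x Vector.∷ (i Vector.∷ var)
  N↓ = N-sub (suc (suc n)) n θ (λ _ → refl)
  body = ! (N (suc (suc n)) (var 1F)) ⊸ !^ k (N (suc (suc n)) (var 0F)) ⊸
         !^ k (N (suc (suc n)) (wkT (wkT h) · var 1F · var 0F))

-- The program `c` is abstract in what follows; `shift-c` records that it is unchanged by passing
-- under a λ.
record Numeric₂ (op : Tm 0 8) (c : Lam) : Set₂ where
  field
    ⊢op    : Sig ⊢ op ⦂ nat ⇒ nat ⇒ nat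
    opP    : ∀ {n} {Γ : Ctx 0 n []} {x y} → Sig,, Γ ⊢ x ⦂ nat → Sig,, Γ ⊢ y ⦂ nat →
             Pf Γ [] (N n x ⊸ N n y ⊸ N n (↑ n op · x · y)) (λ _ → c)
    shift-c : shift c ≡ c

record Numeric₀ (e : Tm 0 8) (c : Lam) : Set₂ where
  field
    ⊢e : Sig ⊢ e ⦂ nat
    eP : ∀ {n} {Γ : Ctx 0 n []} → Pf Γ [] (N n (↑ n e)) (λ _ → c)

-- The state h maps a counter i and an accumulator x to the final result.
module Bounded {op e : Tm 0 8} {c₂ c₀ : Lam} (OP : Numeric₂ op c₂) (E : Numeric₀ e c₀) where
  open Numeric₂ OP
  open Numeric₀ E

  State : Ty 0
  State = nat ⇒ nat ⇒ nat

  -- A step puts one round in front of the state `h`: advance the counter, absorb `f i` into the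
  -- accumulator, continue with `h`. As the outermost step runs first, `y` steps started at counter
  -- 0 absorb `f 0` up to `f (y - 1)` in the order of `Σ<` and `Π<`.
  stepT : ∀ n → Tm 0 (n + 8) → Tm 0 (n + 8)
  stepT n f = ƛ State (ƛ nat (ƛ nat (var 2F · (s′ (suc (suc (suc n))) · var 1F) ·
    (↑ (suc (suc (suc n))) op · var 0F · (wkT (wkT (wkT f)) · var 1F)))))

  initT : Tm 0 m
  initT = ƛ nat (ƛ nat (var 0F))

  boundedT : ∀ n → Tm 0 (n + 8) → Tm 0 (n + 8) → Tm 0 (n + 8)
  boundedT n f y = iterT State y (stepT n f) initT · o′ n · ↑ n e

  ⌜op⌝ ⌜bounded-step⌝ ⌜bounded⌝ : Lam
  ⌜op⌝ = lam (lam (c₂ ∙ var 1 ∙ var 0))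
  ⌜bounded-step⌝ = lam (lam (lam (lam (var 2 ∙ (lam (⌜suc⌝ ∙ var 0) ∙ var 1) ∙ (⌜op⌝ ∙ var 0 ∙ (var 3 ∙ var 1))))))
  ⌜bounded⌝ = lam (lam (⌜iter⌝ ∙ var 1 ∙ (⌜bounded-step⌝ ∙ var 0) ∙ lam (lam (var 0)) ∙ ⌜ 0 ⌝ ∙ c₀))

  module _ {Γ : Ctx 0 n []} where

    ⊢stepT : ∀ {f} → Sig,, Γ ⊢ f ⦂ nat ⇒ nat → Sig,, Γ ⊢ stepT n f ⦂ State ⇒ State
    ⊢stepT d = ⊢ƛ (⊢ƛ (⊢ƛ (⊢· (⊢· (⊢var 2F) (⊢· (⊢s {Γ = Γ ▸ State ▸ nat ▸ nat}) (⊢var 1F)))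
      (⊢· (⊢· (⊢↑ {Γ = Γ ▸ State ▸ nat ▸ nat} ⊢op) (⊢var 0F)) (⊢· (⊢wk¹ (⊢wk¹ (⊢wk¹ d))) (⊢var 1F))))))

    ⊢initT : Sig,, Γ ⊢ initT ⦂ State
    ⊢initT = ⊢ƛ (⊢ƛ (⊢var 0F))

    ⊢boundedT : ∀ {f y} → Sig,, Γ ⊢ f ⦂ nat ⇒ nat → Sig,, Γ ⊢ y ⦂ nat → Sig,, Γ ⊢ boundedT n f y ⦂ nat
    ⊢boundedT d d′ = ⊢· (⊢· (⊢iterT d′ (⊢stepT d) ⊢initT) (⊢o {Γ = Γ})) (⊢↑ {Γ = Γ} ⊢e)

    op-!^P : ∀ {x y} k → Sig,, Γ ⊢ x ⦂ nat → Sig,, Γ ⊢ y ⦂ nat →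
             Pf Γ [] (!^ k (N n x) ⊸ !^ k (N n y) ⊸ !^ k (N n (↑ n op · x · y))) (λ _ → ⌜op⌝)
    op-!^P {x} {y} k d d′ = abs (abs (exch (1F ∷ 0F ∷ []) (1F ∷ 0F ∷ []) (go k)))
      where
      go : ∀ k → Pf Γ (!^ k (N n x) ∷ !^ k (N n y) ∷ []) (!^ k (N n (↑ n op · x · y))) (λ v → c₂ ∙ v 0F ∙ v 1F)
      go zero    = opP {Γ = Γ} d d′ $ ax (N-ok {Γ = Γ} d) $ ax (N-ok {Γ = Γ} d′)
      go (suc k) = prom₂ (ax (ok-! (!^-ok k (N-ok {Γ = Γ} d)))) (ax (ok-! (!^-ok k (N-ok {Γ = Γ} d′)))) (go k)

    suc!P : ∀ {x} → Sig,, Γ ⊢ x ⦂ nat → Pf Γ [] (! (N n x) ⊸ ! (N n (s′ n · x))) (λ _ → lam (⌜suc⌝ ∙ var 0))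
    suc!P d = abs (prom₁ (ax (ok-! (N-ok {Γ = Γ} d))) (sucP {Γ = Γ} d $ ax (N-ok {Γ = Γ} d)))

  module _ {Γ : Ctx 0 n []} (k : ℕ) {f : Tm 0 (n + 8)} (⊢f : Sig,, Γ ⊢ f ⦂ nat ⇒ nat) where

    private
      A : Fm 0 (suc n + 8) []
      A = Accumulates k (suc n) (var 0F)

      A-ok : (Sig,, Γ) ▸ State ⊢ A ∶Prop
      A-ok = Accumulates-ok {Γ = Γ ▸ State} k (⊢var 0F)

      h³ : ℕ
      h³ = suc (suc (suc n))

      Γ³ : Ctx 0 h³ []
      Γ³ = Γ ▸ State ▸ nat ▸ nat

      f³ : Tm 0 (h³ + 8)
      f³ = wkT (wkT (wkT f))
      ⊢f³ : Sig,, Γ³ ⊢ f³ ⦂ nat ⇒ nat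
      ⊢f³ = ⊢wk¹ (⊢wk¹ (⊢wk¹ ⊢f))

      step-body : Pf Γ³ (!^ k (N h³ (var 0F)) ∷ ! (N h³ (var 1F)) ∷ Accumulates k h³ (var 2F) ∷ Bounds k h³ f³ ∷ [])
        (!^ k (N h³ (wkT (wkT (wkT (stepT n f) · var 0F)) · var 1F · var 0F)))
        (λ v → v 2F ∙ (lam (⌜suc⌝ ∙ var 0) ∙ v 1F) ∙ (⌜op⌝ ∙ v 0F ∙ (v 3F ∙ v 1F)))
      step-body = convN {Γ = Γ³} k [] []
        (⊢· (⊢· (⊢var 2F) ⊢si) ⊢x)
        (⊢· (⊢· (⊢wk¹ (⊢wk¹ (⊢· (⊢wk¹ (⊢stepT {Γ = Γ} ⊢f)) (⊢var 0F)))) (⊢var 1F)) (⊢var 0F))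
        (≃β λ v → =β-sym (⟶*⇒=β (≡⇒⟶* (cong (λ t → t ∙ v 2F ∙ v 1F ∙ v 0F) (⟦wkT³⟧ (stepT n f) v))
          ◅◅ β₃ {a = 0} {σ = nat} {nat} {nat} (var 2F · (s′ h³ · var 1F) ·
               (↑ h³ op · var 0F · (f³ · var 1F))) (λ x → v (suc (suc (suc x)))) _ _ _
          ◅◅ ≡⇒⟶* (cong₂ (λ o g → v 2F ∙ (v (h³ ↑ʳ 6F) ∙ v 1F) ∙ (o ∙ v 0F ∙ (g ∙ v 1F)))
               (trans (⟦renTm⟧ id _ op _) (sym (⟦renTm⟧ id _ op _)))
               (trans (⟦wkT³⟧ f _) (sym (⟦wkT³⟧ f v)))))))
        (exch (1F ∷ 0F ∷ 2F ∷ 3F ∷ []) (1F ∷ 0F ∷ 2F ∷ 3F ∷ [])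
          -- The counter is needed twice, to be advanced and as the argument of `f`.
          (contr (exch (3F ∷ 0F ∷ 2F ∷ 4F ∷ 1F ∷ []) (1F ∷ 4F ∷ 2F ∷ 0F ∷ 3F ∷ [])
            (Accumulates-elim {Γ = Γ³} k (ax (Accumulates-ok {Γ = Γ³} k (⊢var 2F))) ⊢si ⊢x
             $ (suc!P {Γ = Γ³} (⊢var 1F) $ ax ok-i)
             $ (op-!^P {Γ = Γ³} k (⊢var 0F) (⊢· ⊢f³ (⊢var 1F)) $ ax (!^-ok k (N-ok {Γ = Γ³} (⊢var 0F)))
                $ (Bounds-elim {Γ = Γ³} k (ax (Bounds-ok {Γ = Γ³} k ⊢f³)) (⊢var 1F) $ ax ok-i))))))
        where
        ok-i = ok-! (N-ok {Γ = Γ³} (⊢var 1F))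
        ⊢si : Sig,, Γ³ ⊢ s′ h³ · var 1F ⦂ nat
        ⊢si = ⊢· (⊢s {Γ = Γ³}) (⊢var 1F)
        ⊢x : Sig,, Γ³ ⊢ ↑ h³ op · var 0F · (f³ · var 1F) ⦂ nat
        ⊢x = ⊢· (⊢· (⊢↑ {Γ = Γ³} ⊢op) (⊢var 0F)) (⊢· ⊢f³ (⊢var 1F))

    bounded-stepP : Pf Γ [] (Bounds k n f ⊸ S State A (stepT n f)) (λ _ → ⌜bounded-step⌝)
    bounded-stepP = abs (∀¹I (cong (_∷ []) (Bounds-wk k n f)) (abs
      (cast (sym (Accumulates-sub ((wkT (stepT n f) · var 0F) Vector.∷ λ x → var (suc x)) (λ _ → refl) k (var 0F)))
        (∀¹I refl (∀¹I
          (cong₂ (λ P Q → P ∷ Q ∷ [])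
            (trans (cong wk¹ (Accumulates-wk k (suc n) (var 0F))) (Accumulates-wk k (suc (suc n)) (var 1F)))
            (trans (cong wk¹ (Bounds-wk k (suc n) (wkT f))) (Bounds-wk k (suc (suc n)) (wkT (wkT f)))))
          (abs (abs step-body)))))))

    -- A round uses `Bounds` once, so a single bang on it suffices for the iteration. Once inside
    -- the box of the result, the initial counter and accumulator come from closed proofs and can be
    -- promoted to whatever depth `Accumulates` asks for.
    boundedP : ∀ {y} → Sig,, Γ ⊢ y ⦂ nat →
               Pf Γ [] (N n y ⊸ ! (Bounds k n f) ⊸ ! (!^ k (N n (boundedT n f y)))) (λ _ → ⌜bounded⌝)
    boundedP {y} d = abs (abs (exch (1F ∷ 0F ∷ []) (1F ∷ 0F ∷ [])
      (prom₁
        (iterP {Γ = Γ} {A = A} A-ok (⊢stepT {Γ = Γ} ⊢f) d $ ax (N-ok {Γ = Γ} d)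
         $ prom₁ (ax (ok-! ok-f)) (bounded-stepP $ ax ok-f))
        (Accumulates-elim {Γ = Γ} k
          (cast (cong₂ _⊸_ (A[ initT ]) (A[ y ·ᵗ State · stepT n f · initT ]))
            (S-elim {A = A} {y ·ᵗ State · stepT n f}
              (ax (S-ok {A = A} A-ok (⊢· (⊢·ᵗ d State) (⊢stepT {Γ = Γ} ⊢f)))) (⊢initT {Γ = Γ}))
           $ initP)
          (⊢o {Γ = Γ}) (⊢↑ {Γ = Γ} ⊢e)
         $ nec (zeroP {Γ = Γ}) $ !^-nec k (eP {Γ = Γ})))))
      where
      ok-f = Bounds-ok {Γ = Γ} k ⊢f

      A[_] : ∀ t → A [ t ]¹ ≡ Accumulates k n t
      A[ t ] = Accumulates-sub (t Vector.∷ var) (λ _ → refl) k (var 0F)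

      !^-nec : ∀ k {P c} → Pf Γ [] P c → Pf Γ [] (!^ k P) c
      !^-nec zero    p = p
      !^-nec (suc k) p = nec (!^-nec k p)

      initP : Pf Γ [] (Accumulates k n initT) (λ _ → lam (lam (var 0)))
      initP = ∀¹I refl (∀¹I refl (abs (abs (exch (1F ∷ 0F ∷ []) (1F ∷ 0F ∷ []) (wk ok₁
        (convN {Γ = Γ ▸ nat ▸ nat} k [] [] (⊢var 0F) (⊢· (⊢· (⊢wk¹ (⊢wk¹ (⊢initT {Γ = Γ}))) (⊢var 1F)) (⊢var 0F))
          (≃β λ v → =β-sym (⟶*⇒=β (β₂ {a = 0} {σ = nat} {nat} (var 0F) v _ _)))
          (ax (!^-ok k (N-ok {Γ = Γ ▸ nat ▸ nat} (⊢var 0F))))))))))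
        where ok₁ = ok-! (N-ok {Γ = Γ ▸ nat ▸ nat} (⊢var 1F))

fold< : (ℕ → ℕ → ℕ) → ℕ → ℕ → (ℕ → ℕ) → ℕ
fold< _⊕_ z zero    f = z
fold< _⊕_ z (suc y) f = fold< _⊕_ z y f ⊕ f y

module BoundedRed {op e : Tm 0 8} {c₂ c₀ : Lam} (OP : Numeric₂ op c₂) (E : Numeric₀ e c₀)
                  {_⊕_ : ℕ → ℕ → ℕ} {z : ℕ} (shift-c₀ : shift c₀ ≡ c₀)
                  (c₂-red : ∀ x y → c₂ ∙ ⌜ x ⌝ ∙ ⌜ y ⌝ ⟶* ⌜ x ⊕ y ⌝) (c₀-red : c₀ ⟶* ⌜ z ⌝) where
  open Bounded OP E
  open Numeric₂ OP using (shift-c)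

  private
    extend : Vector Lam m → Vector Lam (suc m)
    extend v = var zero Vector.∷ (shift ∘ v)

    -- `c₂` is a bare λ-term and not the erasure of a given typed term, so it enters as the value of
    -- the variable `x`.
    opᵗ : Fin m → Tm 0 m
    opᵗ x = λ̇ λ̇ (var (suc (suc x)) · var 1F · var 0F)

    step-bodyᵗ : Fin m → Tm 0 (suc (suc (suc (suc m))))
    step-bodyᵗ x = var 2F · ((λ̇ (sucᵗ · var 0F)) · var 1F) ·
      (opᵗ (suc (suc (suc (suc x)))) · var 0F · (var 3F · var 1F))

    stepᵗ : Fin m → Tm 0 m
    stepᵗ x = λ̇ λ̇ λ̇ λ̇ step-bodyᵗ x

    shift^ : ℕ → Lam → Lam
    shift^ zero    t = t
    shift^ (suc j) t = shift (shift^ j t)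

    shifts : ∀ {c} → shift c ≡ c → ∀ j → shift^ j c ≡ c
    shifts eq zero    = refl
    shifts eq (suc j) = trans (cong shift (shifts eq j)) eq

    ⟦opᵗ⟧ : ∀ (x : Fin m) v → v x ≡ c₂ → ⟦ opᵗ x ⟧ v ≡ ⌜op⌝
    ⟦opᵗ⟧ x v eq = cong (λ c → lam (lam (c ∙ var 1 ∙ var 0)))
      (trans (cong (shift ∘ shift) eq) (shifts shift-c 2))

    ⟦stepᵗ⟧ : ∀ (x : Fin m) v → v x ≡ c₂ → ⟦ stepᵗ x ⟧ v ≡ ⌜bounded-step⌝
    ⟦stepᵗ⟧ x v eq = cong (λ c → lam (lam (lam (lam (var 2 ∙ (lam (⌜suc⌝ ∙ var 0) ∙ var 1) ∙ (c ∙ var 0 ∙ (var 3 ∙ var 1)))))))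
      (⟦opᵗ⟧ (suc (suc (suc (suc x)))) (extend (extend (extend (extend v)))) (trans (cong (shift ∘ shift ∘ shift ∘ shift) eq) (shifts shift-c 4)))

    v₀ : Vector Lam 2
    v₀ = c₂ Vector.∷ (c₀ Vector.∷ none)

  module _ {φ : Lam} {f : ℕ → ℕ} (φ-red : ∀ i → φ ∙ ⌜ i ⌝ ⟶* ⌜ f i ⌝) where

    bounded-step-red : ∀ h i x → ⌜bounded-step⌝ ∙ φ ∙ h ∙ ⌜ i ⌝ ∙ ⌜ x ⌝ ⟶* h ∙ ⌜ suc i ⌝ ∙ ⌜ x ⊕ f i ⌝
    bounded-step-red h i x = ≡⇒⟶* (cong (λ c → c ∙ φ ∙ h ∙ ⌜ i ⌝ ∙ ⌜ x ⌝) (sym (⟦stepᵗ⟧ 0F v₀ refl)))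
      ◅◅ ⟶*-∙ (β₃ {a = 0} {σ = nat} {nat} {nat} (λ̇ step-bodyᵗ 0F) v₀ φ h ⌜ i ⌝) ε
      ◅◅ β₁ (step-bodyᵗ 0F) v₃ ⌜ x ⌝
      ◅◅ ⟶*-∙ (⟶*-∙ ε (β₁ (sucᵗ · var 0F) (⌜ x ⌝ Vector.∷ v₃) ⌜ i ⌝ ◅◅ ⌜suc⌝-red i))
              (⟶*-∙ ε (φ-red i) ◅◅ ≡⇒⟶* (cong (λ c → c ∙ ⌜ x ⌝ ∙ ⌜ f i ⌝) (⟦opᵗ⟧ 4F (⌜ x ⌝ Vector.∷ v₃) refl))
               ◅◅ op-red x (f i))
      where
      v₃ = ⌜ i ⌝ Vector.∷ (h Vector.∷ (φ Vector.∷ v₀))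
      op-red : ∀ x y → ⌜op⌝ ∙ ⌜ x ⌝ ∙ ⌜ y ⌝ ⟶* ⌜ x ⊕ y ⌝
      op-red x y = ≡⇒⟶* (cong (λ c → c ∙ ⌜ x ⌝ ∙ ⌜ y ⌝) (sym (⟦opᵗ⟧ 0F v₀ refl)))
        ◅◅ β₂ {a = 0} {σ = nat} {nat} (var 2F · var 1F · var 0F) v₀ ⌜ x ⌝ ⌜ y ⌝ ◅◅ c₂-red x y

    -- The invariant: when the counter is `j`, the accumulator is the fold of the first `j` values.
    -- With `y` rounds left the run ends at `j + y`.
    iterates : ∀ y j → iterate y (⌜bounded-step⌝ ∙ φ) (lam (lam (var 0))) ∙ ⌜ j ⌝ ∙ ⌜ fold< _⊕_ z j f ⌝ ⟶* ⌜ fold< _⊕_ z (j + y) f ⌝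
    iterates zero    j = β₂ {a = 0} {σ = nat} {nat} (var 0F) none ⌜ j ⌝ ⌜ fold< _⊕_ z j f ⌝
      ◅◅ ≡⇒⟶* (cong (λ i → ⌜ fold< _⊕_ z i f ⌝) (sym (+-identityʳ j)))
    iterates (suc y) j = bounded-step-red _ j (fold< _⊕_ z j f) ◅◅ iterates y (suc j)
      ◅◅ ≡⇒⟶* (cong (λ i → ⌜ fold< _⊕_ z i f ⌝) (sym (+-suc j y)))

    bounded-red : ∀ y → ⌜bounded⌝ ∙ ⌜ y ⌝ ∙ φ ⟶* ⌜ fold< _⊕_ z y f ⌝
    bounded-red y = ≡⇒⟶* (cong₂ (λ s c → lam (lam (⌜iter⌝ ∙ var 1 ∙ (s ∙ var 0) ∙ lam (lam (var 0)) ∙ ⌜ 0 ⌝ ∙ c)) ∙ ⌜ y ⌝ ∙ φ)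
        (sym (⟦stepᵗ⟧ 2F (var 0 Vector.∷ (var 1 Vector.∷ v₀↑)) (shifts shift-c 2))) (sym (shifts shift-c₀ 2)))
      ◅◅ β₂ {a = 0} {σ = nat} {nat} (iterᵗ · var 1F · (stepᵗ 2F · var 0F) · (λ̇ λ̇ var 0F) · (λ̇ λ̇ var 0F) · var 3F) v₀ ⌜ y ⌝ φ
      ◅◅ ⟶*-∙ (≡⇒⟶* (cong (λ s → ⌜iter⌝ ∙ ⌜ y ⌝ ∙ (s ∙ φ) ∙ lam (lam (var 0)) ∙ ⌜ 0 ⌝)
                 (⟦stepᵗ⟧ 2F (φ Vector.∷ (⌜ y ⌝ Vector.∷ v₀)) refl))
               ◅◅ ⟶*-∙ (⌜iter⌝-red y _ _) ε) c₀-red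
      ◅◅ iterates y 0
      where v₀↑ = shift ∘ shift ∘ v₀

-- Closed terms for the operations

plusᶜ multᶜ minusᶜ oneᶜ : Tm 0 8
plusᶜ  = λ̇ λ̇ plusT 2 (var 1F) (var 0F)
multᶜ  = λ̇ λ̇ multT 2 (var 1F) (var 0F)
minusᶜ = λ̇ λ̇ minusT 2 (var 1F) (var 0F)
oneᶜ   = s′ 0 · o′ 0

↑-β₂ : ∀ (t : Tm 0 10) (x y : Tm 0 (n + 8)) v →
       ⟦ ↑ n (λ̇ λ̇ t) · x · y ⟧ v ⟶* ⟦ t ⟧ (⟦ y ⟧ v Vector.∷ (⟦ x ⟧ v Vector.∷ (v ∘ (n ↑ʳ_))))
↑-β₂ {n = n} t x y v = ≡⇒⟶* (cong (λ c → c ∙ ⟦ x ⟧ v ∙ ⟦ y ⟧ v) (⟦renTm⟧ id (n ↑ʳ_) (λ̇ λ̇ t) v))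
  ◅◅ β₂ {a = 0} {σ = nat} {nat} t (v ∘ (n ↑ʳ_)) (⟦ x ⟧ v) (⟦ y ⟧ v)

plus : Numeric₂ plusᶜ ⌜plus⌝
plus = record
  { ⊢op = ⊢plus
  ; opP = λ {n} {Γ} {x} {y} d e → convN {Γ = Γ} 0 (N n x ∷ N n y ∷ []) (N-ok {Γ = Γ} d ∷ N-ok {Γ = Γ} e ∷ [])
      (⊢iterT e (⊢s {Γ = Γ}) (⊢iterT d (⊢s {Γ = Γ}) (⊢o {Γ = Γ})))
      (⊢· (⊢· (⊢↑ {Γ = Γ} ⊢plus) d) e)
      (≃β λ v → =β-sym (⟶*⇒=β (↑-β₂ {n = n} (plusT 2 (var 1F) (var 0F)) x y v)))
      (plusP {Γ = Γ} d e)
  ; shift-c = refl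
  }
  where
  ⊢plus : Sig ⊢ plusᶜ ⦂ nat ⇒ nat ⇒ nat
  ⊢plus = ⊢ƛ (⊢ƛ (⊢iterT (⊢var 0F) (⊢var _) (⊢iterT (⊢var 1F) (⊢var _) (⊢var _))))

mult : Numeric₂ multᶜ ⌜mult⌝
mult = record
  { ⊢op = ⊢mult
  ; opP = λ {n} {Γ} {x} {y} d e → convN {Γ = Γ} 0 (N n x ∷ N n y ∷ []) (N-ok {Γ = Γ} d ∷ N-ok {Γ = Γ} e ∷ [])
      (⊢iterT e (⊢· (⊢·ᵗ d nat) (⊢s {Γ = Γ})) (⊢o {Γ = Γ}))
      (⊢· (⊢· (⊢↑ {Γ = Γ} ⊢mult) d) e)
      (≃β λ v → =β-sym (⟶*⇒=β (↑-β₂ {n = n} (multT 2 (var 1F) (var 0F)) x y v)))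
      (multP {Γ = Γ} d e)
  ; shift-c = refl
  }
  where
  ⊢mult : Sig ⊢ multᶜ ⦂ nat ⇒ nat ⇒ nat
  ⊢mult = ⊢ƛ (⊢ƛ (⊢iterT (⊢var 0F) (⊢· (⊢·ᵗ (⊢var 1F) nat) (⊢var _)) (⊢var _)))

zeroᴺ : Numeric₀ (o′ 0) ⌜ 0 ⌝
zeroᴺ = record { ⊢e = ⊢var 7F ; eP = zeroP }

oneᴺ : Numeric₀ oneᶜ (⌜suc⌝ ∙ ⌜ 0 ⌝)
oneᴺ = record { ⊢e = ⊢· (⊢var 6F) (⊢var 7F) ; eP = λ {_} {Γ} → sucP {Γ = Γ} (⊢o {Γ = Γ}) $ zeroP {Γ = Γ} }

-- Elementary functions

appT : Tm 0 m → Vec (Tm 0 m) n → Tm 0 m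
appT {m = m} = foldl (λ _ → Tm 0 m) _·_

⊢appT : ∀ {Γ : Ctx 0 m Φ} {xs : Vec _ n} {t τ} → Γ ⊢ t ⦂ fun n τ → All (Γ ⊢_⦂ nat) xs → Γ ⊢ appT t xs ⦂ τ
⊢appT d []       = d
⊢appT d (e ∷ es) = ⊢appT (⊢· d e) es

values : Vec (Tm 0 m) n → Vector Lam m → Vec Lam n
values xs v = map (λ x → ⟦ x ⟧ v) xs

⟦appT⟧ : ∀ t (xs : Vec (Tm 0 m) n) v → ⟦ appT t xs ⟧ v ≡ apps (⟦ t ⟧ v) (values xs v)
⟦appT⟧ t []       v = refl
⟦appT⟧ t (x ∷ xs) v = ⟦appT⟧ (t · x) xs v

hyps : ∀ m → Vec (Tm 0 (m + 8)) n → Vec (Fm 0 (m + 8) Φ) n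
hyps m xs = map ! (Ns m xs)

module _ {Γ : Ctx 0 m Φ} where

  hyps-ok : ∀ {xs : Vec _ n} → All (Sig,, Γ ⊢_⦂ nat) xs → All (Sig,, Γ ⊢_∶Prop) (hyps m xs)
  hyps-ok ds = All-! (Ns-ok {Γ = Γ} ds)

  !^N-ok : ∀ k {x} → Sig,, Γ ⊢ x ⦂ nat → Sig,, Γ ⊢ !^ k (N m x) ∶Prop
  !^N-ok k d = !^-ok k (N-ok {Γ = Γ} d)

hyps-wk : ∀ (xs : Vec (Tm 0 (m + 8)) n) → hyps {Φ = Φ} (suc m) (map wkT xs) ≡ map wk¹ (hyps m xs)
hyps-wk []       = refl
hyps-wk (x ∷ xs) = cong (_ ∷_) (hyps-wk xs)

-- The result has at least one bang, because that is what a projection yields from banged arguments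
-- and what a further function expects of its own. Totality is stated for arbitrary typed arguments
-- in any context: composition instantiates it at compound terms, bounded operations at a freshly
-- bound counter.
record Extracted (k n : ℕ) (g : Vec ℕ n → ℕ) : Set₂ where
  field
    f        : Tm 0 8
    ⊢f       : Sig ⊢ f ⦂ fun n nat
    program  : Lam
    totality : ∀ {m} {Γ : Ctx 0 m []} {xs : Vec (Tm 0 (m + 8)) n} → All (Sig,, Γ ⊢_⦂ nat) xs →
               Pf Γ [] (hyps m xs ⊸* !^ (suc k) (N m (appT (↑ m f) xs))) (λ _ → program)
    computes : Represents program g

  ⊢app : ∀ {m} {Γ : Ctx 0 m []} {xs : Vec (Tm 0 (m + 8)) n} → All (Sig,, Γ ⊢_⦂ nat) xs →
         Sig,, Γ ⊢ appT (↑ m f) xs ⦂ nat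
  ⊢app {Γ = Γ} ds = ⊢appT (⊢↑ {Γ = Γ} ⊢f) ds

module _ {Γ : Ctx 0 m []} {xs : Vec (Tm 0 (m + 8)) n} (ds : All (Sig,, Γ ⊢_⦂ nat) xs) where

  conv-app : ∀ k {t f F} → Sig,, Γ ⊢ t ⦂ nat → Sig ⊢ f ⦂ fun n nat →
             (∀ v → apps (⟦ f ⟧ (v ∘ (m ↑ʳ_))) (values xs v) =β ⟦ t ⟧ v) →
             Pf Γ [] (hyps m xs ⊸* !^ k (N m t)) F →
             Pf Γ [] (hyps m xs ⊸* !^ k (N m (appT (↑ m f) xs))) F
  conv-app k {f = f} d e eq = convN {Γ = Γ} k (hyps m xs) (hyps-ok {Γ = Γ} ds) d (⊢appT (⊢↑ {Γ = Γ} e) ds)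
    (≃β λ v → =β-sym (≡⇒=β (trans (⟦appT⟧ (↑ m f) xs v)
      (cong (λ c → apps c (values xs v)) (⟦renTm⟧ id (m ↑ʳ_) f v))) ◅◅ eq v))

extract-ext : ∀ {g h : Vec ℕ n → ℕ} → (∀ xs → g xs ≡ h xs) → Extracted k n g → Extracted k n h
extract-ext eq E = record
  { f = f ; ⊢f = ⊢f ; program = program ; totality = λ {_} {Γ} → totality {_} {Γ}
  ; computes = λ ms → computes ms ◅◅ ≡⇒⟶* (cong ⌜_⌝ (eq ms)) }
  where open Extracted E

numeral : ℕ → Tm 0 8
numeral zero    = o′ 0
numeral (suc c) = s′ 0 · numeral c

extract-constant : ∀ c → Extracted 0 n (λ _ → c)
extract-constant {n} c = record
  { f        = kT n nat · numeral c
  ; ⊢f       = ⊢· (⊢kT n) (⊢numeral c)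
  ; program  = ⌜K⌝ n ∙ ⌜numeral⌝ c
  ; totality = λ {m} {Γ} {xs} ds → conv-app {Γ = Γ} ds 1 (⊢↑ {Γ = Γ} (⊢numeral c)) (⊢· (⊢kT n) (⊢numeral c))
      (λ v → ≡⇒=β (cong (λ k → apps (k ∙ _) (values xs v)) (⟦kT⟧ n _))
        ◅◅ ⟶*⇒=β (⌜K⌝-red (values xs v) _) ◅◅ ≡⇒=β (sym (⟦renTm⟧ id (m ↑ʳ_) (numeral c) v)))
      (kP (hyps-ok {Γ = Γ} ds) (!^N-ok {Γ = Γ} 1 (⊢↑ {Γ = Γ} (⊢numeral c))) $ nec (numeralP {Γ = Γ} c))
  ; computes = λ ms → ⌜K⌝-red (map ⌜_⌝ ms) _ ◅◅ numeral-red c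
  }
  where
  ⊢numeral : ∀ c → Sig ⊢ numeral c ⦂ nat
  ⊢numeral zero    = ⊢var 7F
  ⊢numeral (suc c) = ⊢· (⊢var 6F) (⊢numeral c)
  ⌜numeral⌝ : ℕ → Lam
  ⌜numeral⌝ zero    = ⌜ 0 ⌝
  ⌜numeral⌝ (suc c) = ⌜suc⌝ ∙ ⌜numeral⌝ c
  numeralP : ∀ {m} {Γ : Ctx 0 m []} c → Pf Γ [] (N m (↑ m (numeral c))) (λ _ → ⌜numeral⌝ c)
  numeralP zero    = zeroP
  numeralP {Γ = Γ} (suc c) = sucP {Γ = Γ} (⊢↑ {Γ = Γ} (⊢numeral c)) $ numeralP c
  numeral-red : ∀ c → ⌜numeral⌝ c ⟶* ⌜ c ⌝
  numeral-red zero    = ε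
  numeral-red (suc c) = ⟶*-∙ ε (numeral-red c) ◅◅ ⌜suc⌝-red c

extract-projection : ∀ i → Extracted 0 n (λ xs → lookup xs i)
extract-projection {n} i = record
  { f        = pT n i
  ; ⊢f       = ⊢pT n i
  ; program  = ⌜P⌝ i
  ; totality = λ {m} {Γ} {xs} ds → conv-app {Γ = Γ} ds 1 (lookup⁺ ds i) (⊢pT n i)
      (λ v → ≡⇒=β (cong (λ k → apps k (values xs v)) (⟦pT⟧ n i _))
        ◅◅ ⟶*⇒=β (⌜P⌝-red (values xs v) i) ◅◅ ≡⇒=β (Vec.lookup-map i (λ x → ⟦ x ⟧ v) xs))
      (cast (cong (hyps m xs ⊸*_) (trans (Vec.lookup-map i ! (Ns m xs)) (cong ! (Vec.lookup-map i (N m) xs))))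
        (pP (hyps-ok {Γ = Γ} ds) i))
  ; computes = λ ms → ⌜P⌝-red (map ⌜_⌝ ms) i ◅◅ ≡⇒⟶* (Vec.lookup-map i ⌜_⌝ ms)
  }

extract-binary : ∀ {g : ℕ → ℕ → ℕ} {t : Tm 0 10} {c} k → Sig ⊢ λ̇ λ̇ t ⦂ nat ⇒ nat ⇒ nat →
  (∀ {m} {Γ : Ctx 0 m []} {x y} → Sig,, Γ ⊢ x ⦂ nat → Sig,, Γ ⊢ y ⦂ nat →
   Pf Γ [] (N m x ⊸ N m y ⊸ !^ k (N m (↑ m (λ̇ λ̇ t) · x · y))) (λ _ → c)) →
  (∀ x y → c ∙ ⌜ x ⌝ ∙ ⌜ y ⌝ ⟶* ⌜ g x y ⌝) → Extracted k 2 (onPair g)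
extract-binary {t = t} {c} k d p r = record
  { f        = λ̇ λ̇ t
  ; ⊢f       = d
  ; program  = ⌜η⌝ 2 ∙ c
  ; totality = λ { {m} {Γ} (e ∷ e′ ∷ []) →
      !-⊸*P (N-ok {Γ = Γ} e ∷ N-ok {Γ = Γ} e′ ∷ [])
        (!^N-ok {Γ = Γ} k (⊢· (⊢· (⊢↑ {Γ = Γ} d) e) e′)) $ nec (p {m} {Γ} e e′) }
  ; computes = λ { (x ∷ y ∷ []) → ⌜η⌝-red (⌜ x ⌝ ∷ ⌜ y ⌝ ∷ []) c ◅◅ r x y }
  }

⊢minusᶜ : Sig ⊢ minusᶜ ⦂ nat ⇒ nat ⇒ nat
⊢minusᶜ = ⊢ƛ (⊢ƛ (⊢iterT (⊢var 0F) (⊢predF {Γ = ∅ ▸ nat ▸ nat}) (⊢var 1F)))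

minusᶜP : ∀ {m} {Γ : Ctx 0 m []} {x y} → Sig,, Γ ⊢ x ⦂ nat → Sig,, Γ ⊢ y ⦂ nat →
          Pf Γ [] (N m x ⊸ N m y ⊸ ! (N m (↑ m minusᶜ · x · y))) (λ _ → ⌜minus⌝)
minusᶜP {m} {Γ} {x} {y} d e = convN {Γ = Γ} 1 (N m x ∷ N m y ∷ []) (N-ok {Γ = Γ} d ∷ N-ok {Γ = Γ} e ∷ [])
  (⊢iterT e (⊢predF {Γ = Γ}) d) (⊢· (⊢· (⊢↑ {Γ = Γ} ⊢minusᶜ) d) e)
  (≃β λ v → =β-sym (⟶*⇒=β (↑-β₂ {n = m} (minusT 2 (var 1F) (var 0F)) x y v)))
  (minusP {Γ = Γ} d e)

raise : ∀ {g : Vec ℕ n → ℕ} → Extracted k n g → Extracted (suc k) n g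
raise {n} {k} E = record
  { f        = f
  ; ⊢f       = ⊢f
  ; program  = ⌜S⌝ n ∙ (⌜K⌝ n ∙ ⌜coerce!⌝) ∙ program
  ; totality = λ {_} {Γ} ds →
      sP (Ns-ok {Γ = Γ} ds) (!^N-ok {Γ = Γ} (suc k) (⊢app {Γ = Γ} ds)) (!^N-ok {Γ = Γ} (suc (suc k)) (⊢app {Γ = Γ} ds))
      $ (kP (hyps-ok {Γ = Γ} ds) (ok-⊸ (!^N-ok {Γ = Γ} (suc k) (⊢app {Γ = Γ} ds)) (!^N-ok {Γ = Γ} (suc (suc k)) (⊢app {Γ = Γ} ds)))
         $ coerce!P {Γ = Γ} (⊢app {Γ = Γ} ds) (suc k))
      $ totality {_} {Γ} ds
  ; computes = λ ms → ⌜S⌝-red (map ⌜_⌝ ms) _ _ ◅◅ ⟶*-∙ (⌜K⌝-red (map ⌜_⌝ ms) _) (computes ms) ◅◅ ⌜coerce!⌝-red _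
  }
  where open Extracted E

raise* : ∀ j {g : Vec ℕ n → ℕ} → Extracted k n g → Extracted (j + k) n g
raise* zero    E = E
raise* (suc j) E = raise (raise* j E)

-- Composition

compose* : ∀ (n : ℕ) → (Fin m → Lam) → Lam → Lam
compose* {zero}  n c e = e
compose* {suc m} n c e = compose* n (c ∘ suc) (⌜S⌝ n ∙ e ∙ c zero)

compose*-red : ∀ (us : Vec Lam n) (c : Fin m → Lam) e →
               apps (compose* n c e) us ⟶* apps (apps e us) (tabulate λ i → apps (c i) us)
compose*-red {m = zero}  us c e = ε
compose*-red {m = suc m} us c e = compose*-red us (c ∘ suc) _ ◅◅ apps-⟶* (tabulate λ i → apps (c (suc i)) us) (⌜S⌝-red us e (c zero))

apps-⟶*-args : ∀ {us us′ : Fin m → Lam} c → (∀ i → us i ⟶* us′ i) → apps c (tabulate us) ⟶* apps c (tabulate us′)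
apps-⟶*-args {zero}  c r = ε
apps-⟶*-args {suc m} {us} c r = apps-⟶* (tabulate (us ∘ suc)) (⟶*-∙ ε (r zero)) ◅◅ apps-⟶*-args _ (r ∘ suc)

composeT : ∀ (n : ℕ) → (Fin m → Tm 0 8) → Tm 0 8 → Tm 0 8
composeT {zero}  n g t = t
composeT {suc m} n g t = composeT n (g ∘ suc) (sT n nat (fun m nat) · t · g zero)

⊢composeT : ∀ n {g : Fin m → Tm 0 8} {t} → (∀ i → Sig ⊢ g i ⦂ fun n nat) → Sig ⊢ t ⦂ fun n (fun m nat) →
            Sig ⊢ composeT n g t ⦂ fun n nat
⊢composeT {zero}  n ds d = d
⊢composeT {suc m} n ds d = ⊢composeT n (ds ∘ suc) (⊢· (⊢· (⊢sT n) d) (ds zero))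

⟦composeT⟧ : ∀ n (g : Fin m → Tm 0 8) t v → ⟦ composeT n g t ⟧ v ≡ compose* n (λ i → ⟦ g i ⟧ v) (⟦ t ⟧ v)
⟦composeT⟧ {zero}  n g t v = refl
⟦composeT⟧ {suc m} n g t v = trans (⟦composeT⟧ n (g ∘ suc) _ v)
  (cong (λ s → compose* n (λ i → ⟦ g (suc i) ⟧ v) (s ∙ ⟦ t ⟧ v ∙ ⟦ g zero ⟧ v)) (⟦sT⟧ n {nat} {fun m nat} v))

compose*P : ∀ {Γ : Ctx 0 k []} {Ps : Vec _ n} {Qs : Vec _ m} {P c e} → All (Sig,, Γ ⊢_∶Prop) Ps →
            All (Sig,, Γ ⊢_∶Prop) Qs → Sig,, Γ ⊢ P ∶Prop →
            Pf Γ [] (map ! Ps ⊸* (Qs ⊸* P)) (λ _ → e) → (∀ i → Pf Γ [] (map ! Ps ⊸* lookup Qs i) (λ _ → c i)) →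
            Pf Γ [] (map ! Ps ⊸* P) (λ _ → compose* n c e)
compose*P oks []           ok p ps = p
compose*P oks (ok′ ∷ oks′) ok p ps =
  compose*P oks oks′ ok (sP oks ok′ (⊸*-ok oks′ ok) $ p $ ps zero) (λ i → ps (suc i))

!^-⊸* : ℕ → ℕ → Lam → Lam
!^-⊸* zero    m c = c
!^-⊸* (suc k) m c = ⌜η⌝ m ∙ !^-⊸* k m c

All-!^ : ∀ {Γ : Ctx 0 n Φ} k {Ps : Vec _ m} → All (Γ ⊢_∶Prop) Ps → All (Γ ⊢_∶Prop) (map (!^ k) Ps)
All-!^ k []         = []
All-!^ k (ok ∷ oks) = !^-ok k ok ∷ All-!^ k oks

!^-⊸*P : ∀ k {Γ : Ctx 0 n []} {Ps : Vec _ m} {P c} → All (Sig,, Γ ⊢_∶Prop) Ps → Sig,, Γ ⊢ P ∶Prop →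
         Pf Γ [] (Ps ⊸* P) (λ _ → c) → Pf Γ [] (map (!^ k) Ps ⊸* !^ k P) (λ _ → !^-⊸* k m c)
!^-⊸*P zero    {Ps = Ps} oks ok p = cast (cong (_⊸* _) (sym (Vec.map-id Ps))) p
!^-⊸*P (suc k) {Ps = Ps} oks ok p = cast (cong (_⊸* _) (sym (Vec.map-∘ ! (!^ k) Ps)))
  (!-⊸*P (All-!^ k oks) (!^-ok k ok) $ nec (!^-⊸*P k oks ok p))

!^-⊸*-red : ∀ k (us : Vec Lam m) c → apps (!^-⊸* k m c) us ⟶* apps c us
!^-⊸*-red zero    us c = ε
!^-⊸*-red (suc k) us c = ⌜η⌝-red us _ ◅◅ !^-⊸*-red k us c

!^-! : ∀ k (P : Fm 0 n Φ) → !^ k (! P) ≡ !^ (suc k) P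
!^-! zero    P = refl
!^-! (suc k) P = cong ! (!^-! k P)

!^-+ : ∀ j k (P : Fm 0 n Φ) → !^ j (!^ k P) ≡ !^ (j + k) P
!^-+ zero    k P = refl
!^-+ (suc j) k P = cong ! (!^-+ j k P)

-- Depths add. Each inner result is `!^ k (! N)`, and the totality of the outer function, promoted
-- `k` times, takes such arguments to `!^ k (!^ (suc l) N)`.
extract-compose : ∀ {l} {f : Vec ℕ m → ℕ} {gs : Fin m → Vec ℕ n → ℕ} →
                  Extracted l m f → (∀ i → Extracted k n (gs i)) →
                  Extracted (k + l) n (λ xs → f (tabulate λ i → gs i xs))
extract-compose {m} {n} {k} {l} {fun-f} {gs} F G = record
  { f        = h
  ; ⊢f       = ⊢h
  ; program  = prog
  ; totality = total
  ; computes = λ ms → compose*-red (map ⌜_⌝ ms) G.program _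
      ◅◅ apps-⟶* (tabulate λ i → apps (G.program i) (map ⌜_⌝ ms)) (⌜K⌝-red (map ⌜_⌝ ms) _)
      ◅◅ apps-⟶*-args (!^-⊸* k m F.program) (λ i → G.computes i ms)
      ◅◅ !^-⊸*-red k (tabulate λ i → ⌜ gs i ms ⌝) F.program
      ◅◅ ≡⇒⟶* (cong (apps F.program) (Vec.tabulate-∘ ⌜_⌝ (λ i → gs i ms)))
      ◅◅ F.computes (tabulate λ i → gs i ms)
  }
  where
  module F = Extracted F
  module G i = Extracted (G i)
  prog : Lam
  prog = compose* n G.program (⌜K⌝ n ∙ !^-⊸* k m F.program)
  h : Tm 0 8
  h = composeT n G.f (kT n (fun m nat) · F.f)
  ⊢h : Sig ⊢ h ⦂ fun n nat
  ⊢h = ⊢composeT n G.⊢f (⊢· (⊢kT n) F.⊢f)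
  total : ∀ {j} {Γ : Ctx 0 j []} {xs : Vec (Tm 0 (j + 8)) n} → All (Sig,, Γ ⊢_⦂ nat) xs →
          Pf Γ [] (hyps j xs ⊸* !^ (suc (k + l)) (N j (appT (↑ j h) xs))) (λ _ → prog)
  total {j} {Γ} {xs} ds = conv-app {Γ = Γ} ds (suc (k + l)) (F.⊢app {Γ = Γ} ⊢ys) ⊢h
    (λ v → ≡⇒=β (cong (λ c → apps c (values xs v)) (trans (⟦composeT⟧ n G.f (kT n (fun m nat) · F.f) (v ∘ (j ↑ʳ_)))
             (cong (λ c → compose* n (λ i → ⟦ G.f i ⟧ (v ∘ (j ↑ʳ_))) (c ∙ ⟦ F.f ⟧ (v ∘ (j ↑ʳ_)))) (⟦kT⟧ n {fun m nat} (v ∘ (j ↑ʳ_))))))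
      ◅◅ ⟶*⇒=β (compose*-red (values xs v) (λ i → ⟦ G.f i ⟧ (v ∘ (j ↑ʳ_))) _ ◅◅ apps-⟶* (tabulate λ i → apps (⟦ G.f i ⟧ (v ∘ (j ↑ʳ_))) (values xs v)) (⌜K⌝-red (values xs v) _))
      ◅◅ ≡⇒=β (sym (trans (⟦appT⟧ (↑ j F.f) ys v) (cong₂ apps (⟦renTm⟧ id (j ↑ʳ_) F.f v)
           (trans (sym (Vec.tabulate-∘ (λ x → ⟦ x ⟧ v) _)) (Vec.tabulate-cong λ i →
             trans (⟦appT⟧ (↑ j (G.f i)) xs v)
               (cong (λ c → apps c (values xs v)) (⟦renTm⟧ id (j ↑ʳ_) (G.f i) v))))))))
    (compose*P (Ns-ok {Γ = Γ} ds) (All-!^ k (hyps-ok {Γ = Γ} ⊢ys)) okZ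
      (kP (hyps-ok {Γ = Γ} ds) (⊸*-ok (All-!^ k (hyps-ok {Γ = Γ} ⊢ys)) okZ)
       $ cast (cong (map (!^ k) (hyps j ys) ⊸*_) (trans (!^-+ k (suc l) (N j z)) (cong (λ i → !^ i (N j z)) (+-suc k l))))
           (!^-⊸*P k (hyps-ok {Γ = Γ} ⊢ys) (!^N-ok {Γ = Γ} (suc l) (F.⊢app {Γ = Γ} ⊢ys)) (F.totality {_} {Γ} ⊢ys)))
      (λ i → cast (cong (hyps j xs ⊸*_) (sym (trans (Vec.lookup-map i (!^ k) (hyps j ys))
          (trans (cong (!^ k) (trans (Vec.lookup-map i ! (Ns j ys)) (cong ! (trans (Vec.lookup-map i (N j) ys)
            (cong (N j) (Vec.lookup∘tabulate _ i)))))) (!^-! k _)))))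
        (G.totality i {_} {Γ} ds)))
    where
    ys : Vec (Tm 0 (j + 8)) m
    ys = tabulate λ i → appT (↑ j (G.f i)) xs
    ⊢ys : All (Sig,, Γ ⊢_⦂ nat) ys
    ⊢ys = tabulate⁺ λ i → G.⊢app i {_} {Γ} ds
    z : Tm 0 (j + 8)
    z = appT (↑ j F.f) ys
    okZ : Sig,, Γ ⊢ !^ (suc (k + l)) (N j z) ∶Prop
    okZ = !^N-ok {Γ = Γ} (suc (k + l)) (F.⊢app {Γ = Γ} ⊢ys)

-- Extraction of bounded operations and of all elementary functions

module ExtractBounded {op e : Tm 0 8} {c₂ c₀ : Lam} (OP : Numeric₂ op c₂) (E : Numeric₀ e c₀)
                      {_⊕_ : ℕ → ℕ → ℕ} {z : ℕ} (shift-c₀ : shift c₀ ≡ c₀)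
                      (c₂-red : ∀ x y → c₂ ∙ ⌜ x ⌝ ∙ ⌜ y ⌝ ⟶* ⌜ x ⊕ y ⌝) (c₀-red : c₀ ⟶* ⌜ z ⌝) where
  open Bounded OP E
  open BoundedRed OP E {_⊕_} {z} shift-c₀ c₂-red c₀-red

  private
    seq : Ty 0
    seq = nat ⇒ nat

    boundedᶜ : Tm 0 8
    boundedᶜ = ƛ seq (ƛ nat (boundedT 2 (var 1F) (var 0F)))

    ⊢boundedᶜ : Sig ⊢ boundedᶜ ⦂ seq ⇒ nat ⇒ nat
    ⊢boundedᶜ = ⊢ƛ (⊢ƛ (⊢boundedT {Γ = ∅ ▸ seq ▸ nat} (⊢var 1F) (⊢var 0F)))

    boundedᶜ-β : ∀ {m} (f y : Tm 0 (m + 8)) v →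
                 ⟦ boundedᶜ ⟧ (v ∘ (m ↑ʳ_)) ∙ ⟦ f ⟧ v ∙ ⟦ y ⟧ v ⟶* ⟦ boundedT m f y ⟧ v
    boundedᶜ-β {m} f y v =
      β₂ {a = 0} {σ = seq} {nat} (boundedT 2 (var 1F) (var 0F)) w (⟦ f ⟧ v) (⟦ y ⟧ v)
      ◅◅ ≡⇒⟶* (cong₂ (λ s c → ⟦ y ⟧ v ∙ s ∙ lam (lam (var 0)) ∙ w 7F ∙ c)
        -- Below the three binders of `stepT`, one side is the value of `f` shifted three times and
        -- the other is `f` evaluated in the shifted environment.
        (cong₂ (λ o g → lam (lam (lam (var 2 ∙ (shift (shift (shift (w 6F))) ∙ var 1) ∙ (o ∙ var 0 ∙ (g ∙ var 1))))))
          (trans (⟦renTm⟧ id (5 ↑ʳ_) op _) (sym (⟦renTm⟧ id (suc (suc (suc m)) ↑ʳ_) op _)))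
          (sym (trans (⟦wkT³⟧ f _) (sym (trans (cong (shift ∘ shift) (renLam-⟦⟧ suc f v))
            (trans (cong shift (renLam-⟦⟧ suc f _)) (renLam-⟦⟧ suc f _)))))))
        (trans (⟦renTm⟧ id (2 ↑ʳ_) e _) (sym (⟦renTm⟧ id (m ↑ʳ_) e v))))
      where
      w : Vector Lam 8
      w = v ∘ (m ↑ʳ_)

  extract-bounded : ∀ {f : Vec ℕ (suc n) → ℕ} → Extracted k (suc n) f →
                    Extracted (suc (suc k)) (suc n) (bounded (fold< _⊕_ z) f)
  extract-bounded {n} {k} {fun-f} F = record
    { f        = h
    ; ⊢f       = ⊢h
    ; program  = prog
    ; totality = λ { {m} {Γ} {y ∷ xs} (d ∷ ds) → total {m} {Γ} d ds }
    ; computes = λ { (y ∷ ms) → let us = map ⌜_⌝ (y ∷ ms) in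
        ⌜S⌝-red us _ _
        ◅◅ ⟶*-∙ (⌜S⌝-red us _ _ ◅◅ ⟶*-∙ (⌜K⌝-red us _) (⌜P⌝-red us zero))
                 (apps-⟶* (map ⌜_⌝ ms) (⌜K⌝-red (⌜ y ⌝ ∷ []) φ))
        ◅◅ ⌜η⌝-red (⌜ y ⌝ ∷ apps φ (map ⌜_⌝ ms) ∷ []) ⌜bounded⌝
        ◅◅ bounded-red (φ-red ms) y }
    }
    where
    module F = Extracted F

    φ : Lam
    -- One boost for the bang that `boundedP` wants on `Bounds`, a second because `boundedP` is
    -- itself promoted to accept `! N y`.
    φ = ⌜boost⌝ n ∙ (⌜boost⌝ n ∙ (⌜η⌝ n ∙ (⌜C⌝ n ∙ F.program)))

    φ-red : ∀ ms i → apps φ (map ⌜_⌝ ms) ∙ ⌜ i ⌝ ⟶* ⌜ fun-f (i ∷ ms) ⌝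
    φ-red ms i = ⟶*-∙ (⌜boost⌝-red ms _ ◅◅ ⌜boost⌝-red ms _ ◅◅ ⌜η⌝-red (map ⌜_⌝ ms) _) ε
      ◅◅ ⌜C⌝-red (map ⌜_⌝ ms) F.program ⌜ i ⌝ ◅◅ F.computes (i ∷ ms)

    prog : Lam
    prog = ⌜S⌝ (suc n) ∙ (⌜S⌝ (suc n) ∙ (⌜K⌝ (suc n) ∙ (⌜η⌝ 2 ∙ ⌜bounded⌝)) ∙ ⌜P⌝ {suc n} zero) ∙ (⌜K⌝ 1 ∙ φ)

    g h : Tm 0 8
    g = cT n nat nat · F.f
    h = sT (suc n) nat nat · (sT (suc n) seq seq · (kT (suc n) (seq ⇒ seq) · boundedᶜ) · (kT 1 (fun n seq) · g))
        · pT (suc n) zero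

    ⊢g : Sig ⊢ g ⦂ fun n seq
    ⊢g = ⊢· (⊢cT n) F.⊢f

    ⊢h : Sig ⊢ h ⦂ fun (suc n) nat
    ⊢h = ⊢· (⊢· (⊢sT (suc n)) (⊢· (⊢· (⊢sT (suc n)) (⊢· (⊢kT (suc n)) ⊢boundedᶜ)) (⊢· (⊢kT 1) ⊢g)))
      (⊢pT (suc n) zero)

    module _ {m} {Γ : Ctx 0 m []} {y} {xs : Vec (Tm 0 (m + 8)) n}
             (d : Sig,, Γ ⊢ y ⦂ nat) (ds : All (Sig,, Γ ⊢_⦂ nat) xs) where

      values-of : Tm 0 (m + 8)
      values-of = appT (↑ m g) xs

      ⊢values-of : Sig,, Γ ⊢ values-of ⦂ seq
      ⊢values-of = ⊢appT (⊢↑ {Γ = Γ} ⊢g) ds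

      ⟦values-of⟧ : ∀ v → ⟦ values-of ⟧ v ≡ apps (⌜C⌝ n ∙ ⟦ F.f ⟧ (v ∘ (m ↑ʳ_))) (values xs v)
      ⟦values-of⟧ v = trans (⟦appT⟧ (↑ m g) xs v) (cong (λ c → apps c (values xs v))
        (trans (⟦renTm⟧ id (m ↑ʳ_) g v) (cong (_∙ ⟦ F.f ⟧ (v ∘ (m ↑ʳ_))) (⟦cT⟧ n {nat} {nat} (v ∘ (m ↑ʳ_))))))

      h-β : ∀ v → apps (⟦ h ⟧ (v ∘ (m ↑ʳ_))) (values (y ∷ xs) v) =β ⟦ boundedT m values-of y ⟧ v
      h-β v = ≡⇒=β (cong₂ (λ s k → apps (s ∙ (⟦ sT (suc n) seq seq ⟧ w ∙ (k ∙ B) ∙ (⟦ kT 1 (fun n seq) ⟧ w ∙ G)) ∙ ⟦ pT (suc n) zero ⟧ w) us)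
                (⟦sT⟧ (suc n) {nat} {nat} w) (⟦kT⟧ (suc n) {seq ⇒ seq} w))
        ◅◅ ≡⇒=β (cong₂ (λ s p → apps (⌜S⌝ (suc n) ∙ (s ∙ (⌜K⌝ (suc n) ∙ B) ∙ (⌜K⌝ 1 ∙ G)) ∙ p) us)
                (⟦sT⟧ (suc n) {seq} {seq} w) (⟦pT⟧ (suc n) zero w))
        ◅◅ ⟶*⇒=β (⌜S⌝-red us _ _ ◅◅ ⟶*-∙ (⌜S⌝-red us _ _ ◅◅ ⟶*-∙ (⌜K⌝-red us B)
                (apps-⟶* (values xs v) (⌜K⌝-red (⟦ y ⟧ v ∷ []) G))) (⌜P⌝-red us zero)
              ◅◅ ≡⇒⟶* (cong (λ c → B ∙ c ∙ ⟦ y ⟧ v) (trans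
                   (cong (λ c → apps (c ∙ ⟦ F.f ⟧ w) (values xs v)) (⟦cT⟧ n {nat} {nat} w)) (sym (⟦values-of⟧ v))))
              ◅◅ boundedᶜ-β values-of y v)
        where
        w = v ∘ (m ↑ʳ_)
        us = values (y ∷ xs) v
        B = ⟦ boundedᶜ ⟧ w
        G = ⟦ g ⟧ w

      -- The totality of `f`, taken at a fresh counter, has the counter first; `cP` moves it behind
      -- the parameters and `∀¹-⊸*P` moves its quantifier there. No bang is spent.
      boundsP : Pf Γ [] (hyps m xs ⊸* Bounds (suc k) m values-of) (λ _ → ⌜η⌝ n ∙ (⌜C⌝ n ∙ F.program))
      boundsP = ∀¹-⊸*P (hyps-ok {Γ = Γ} ds) (ok-⊸ ok-i ok-fi) $ ∀¹I refl
        (cast (cong (_⊸* (! (N (suc m) (var 0F)) ⊸ !^ (suc k) (N (suc m) (wkT values-of · var 0F)))) (hyps-wk xs))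
          (cP (hyps-ok {Γ = Γ ▸ nat} ds↑) ok-i ok-fi $
           convN {Γ = Γ ▸ nat} (suc k) (! (N (suc m) (var 0F)) ∷ hyps (suc m) (map wkT xs))
             (ok-i ∷ hyps-ok {Γ = Γ ▸ nat} ds↑)
             (F.⊢app {Γ = Γ ▸ nat} (⊢var 0F ∷ ds↑)) (⊢· (⊢wk¹ ⊢values-of) (⊢var 0F))
             (≃β λ v → =β-sym (≡⇒=β (cong (_∙ v 0F) (trans (⟦renTm⟧ id suc values-of v) (⟦values-of⟧ (v ∘ suc))))
               ◅◅ ⟶*⇒=β (⌜C⌝-red (values xs (v ∘ suc)) _ (v 0F))
               ◅◅ ≡⇒=β (sym (trans (⟦appT⟧ (↑ (suc m) F.f · var 0F) (map wkT xs) v)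
                    (cong₂ (λ c us → apps (c ∙ v 0F) us) (⟦renTm⟧ id (suc m ↑ʳ_) F.f v)
                      (trans (sym (Vec.map-∘ (λ x → ⟦ x ⟧ v) wkT xs))
                        (Vec.map-cong (λ x → ⟦renTm⟧ id suc x v) xs)))))))
             (F.totality {_} {Γ ▸ nat} (⊢var 0F ∷ ds↑))))
        where
        ⊢wks : ∀ {n} {xs : Vec (Tm 0 (m + 8)) n} → All (Sig,, Γ ⊢_⦂ nat) xs → All ((Sig,, Γ) ▸ nat ⊢_⦂ nat) (map wkT xs)
        ⊢wks []       = []
        ⊢wks (d ∷ ds) = ⊢wk¹ d ∷ ⊢wks ds
        ds↑ : All ((Sig,, Γ) ▸ nat ⊢_⦂ nat) (map wkT xs)
        ds↑ = ⊢wks ds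
        ok-i : (Sig,, Γ) ▸ nat ⊢ ! (N (suc m) (var 0F)) ∶Prop
        ok-i = !^N-ok {Γ = Γ ▸ nat} 1 (⊢var 0F)
        ok-fi : (Sig,, Γ) ▸ nat ⊢ !^ (suc k) (N (suc m) (wkT values-of · var 0F)) ∶Prop
        ok-fi = !^N-ok {Γ = Γ ▸ nat} (suc k) (⊢· (⊢wk¹ ⊢values-of) (⊢var 0F))

      total : Pf Γ [] (hyps m (y ∷ xs) ⊸* !^ (3 + k) (N m (appT (↑ m h) (y ∷ xs)))) (λ _ → prog)
      total = conv-app {Γ = Γ} (d ∷ ds) (3 + k) ⊢b ⊢h h-β
        (sP (Ns-ok {Γ = Γ} (d ∷ ds)) ok-B ok-Z
         $ (sP (Ns-ok {Γ = Γ} (d ∷ ds)) ok-y (ok-⊸ ok-B ok-Z)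
            $ (kP (hyps-ok {Γ = Γ} (d ∷ ds)) (ok-⊸ ok-y (ok-⊸ ok-B ok-Z))
               -- The depth `3 + k` is `suc k` for the values of `f`, one for the iteration and one
               -- for this promotion.
               $ (!-⊸*P (N-ok {Γ = Γ} d ∷ ok-! ok-b ∷ []) (!^N-ok {Γ = Γ} (2 + k) ⊢b)
                  $ nec (boundedP {Γ = Γ} (suc k) ⊢values-of d)))
            $ pP (hyps-ok {Γ = Γ} (d ∷ ds)) zero)
         $ (kP (ok-y ∷ []) (⊸*-ok (hyps-ok {Γ = Γ} ds) ok-B)
            $ (boostP {Γ = Γ} ds (ok-! ok-b) $ nec (boostP {Γ = Γ} ds ok-b $ nec boundsP))))
        where
        ⊢b = ⊢boundedT {Γ = Γ} ⊢values-of d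
        ok-b = Bounds-ok {Γ = Γ} (suc k) ⊢values-of
        ok-B = ok-! (ok-! ok-b)
        ok-y = ok-! (N-ok {Γ = Γ} d)
        ok-Z = !^N-ok {Γ = Γ} (3 + k) ⊢b

extract-sum : ∀ {f : Vec ℕ (suc n) → ℕ} → Extracted k (suc n) f → Extracted (suc (suc k)) (suc n) (bounded Σ< f)
extract-sum F = extract-ext (λ { (y ∷ xs) → fold<≡Σ< y }) (E.extract-bounded F)
  where
  module E = ExtractBounded plus zeroᴺ {_+_} {0} refl ⌜plus⌝-red ε
  fold<≡Σ< : ∀ y {f} → fold< _+_ 0 y f ≡ Σ< y f
  fold<≡Σ< zero    = refl
  fold<≡Σ< (suc y) {f} = cong (_+ f y) (fold<≡Σ< y)

extract-product : ∀ {f : Vec ℕ (suc n) → ℕ} → Extracted k (suc n) f → Extracted (suc (suc k)) (suc n) (bounded Π< f)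
extract-product F = extract-ext (λ { (y ∷ xs) → fold<≡Π< y }) (E.extract-bounded F)
  where
  module E = ExtractBounded mult oneᴺ {_*_} {1} refl ⌜mult⌝-red (⌜suc⌝-red 0)
  fold<≡Π< : ∀ y {f} → fold< _*_ 1 y f ≡ Π< y f
  fold<≡Π< zero    = refl
  fold<≡Π< (suc y) {f} = cong (_* f y) (fold<≡Π< y)

-- Depths can be raised at will, so any common upper bound serves; the sum is used.
level : ∀ {gs : Fin m → Vec ℕ n → ℕ} → (∀ i → ∃[ k ] Extracted k n (gs i)) → ∃[ k ] (∀ i → Extracted k n (gs i))
level {zero}  Es = 0 , λ ()
level {suc m} {n} {gs} Es with Es zero | level (λ i → Es (suc i))
... | k , E | l , Es′ = k + l , λ
  { zero    → subst (λ j → Extracted j n (gs zero)) (+-comm l k) (raise* l E)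
  ; (suc i) → raise* k (Es′ i) }

extract : ∀ {g : Vec ℕ n → ℕ} → Elementary n g → ∃[ k ] Extracted k n g
extract (constant c)    = 0 , extract-constant c
extract (projection i)  = 0 , extract-projection i
extract addition        = 0 , extract-binary {g = _+_} 0 (Numeric₂.⊢op plus) (λ {_} {Γ} → Numeric₂.opP plus {_} {Γ}) ⌜plus⌝-red
extract multiply        = 0 , extract-binary {g = _*_} 0 (Numeric₂.⊢op mult) (λ {_} {Γ} → Numeric₂.opP mult {_} {Γ}) ⌜mult⌝-red
extract subtract        = 1 , extract-binary 1 ⊢minusᶜ (λ {_} {Γ} → minusᶜP {_} {Γ}) ⌜minus⌝-red
extract (compose f gs)  with extract f | level (λ i → extract (gs i))
... | l , F | k , G     = k + l , extract-compose F G
extract (boundedSum f)  with extract f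
... | k , F             = suc (suc k) , extract-sum F
extract (boundedProd f) with extract f
... | k , F             = suc (suc k) , extract-product F
extract (ext eq f)      with extract f
... | k , F             = k , extract-ext eq F

-- Totality in the stated form, under quantifiers and with hypotheses not banged

nats : ∀ n → Ctx 0 n []
nats zero    = ∅
nats (suc n) = nats n ▸ nat

∀nats-I : ∀ n {P c} → Pf (nats n) [] P c → Pf ∅ [] (∀nats n P) c
∀nats-I zero    p = p
∀nats-I (suc n) p = ∀nats-I n (∀¹I refl p)

⊢vars : ∀ n → All (Sig,, nats n ⊢_⦂ nat) (vars n)
⊢vars n = tabulate⁺ λ i → ⊢-cast (typeOf-nats n (opposite i)) (⊢var _)
  where
  typeOf-nats : ∀ n i → typeOf (Sig,, nats n) (i ↑ˡ 8) ≡ nat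
  typeOf-nats (suc n) zero    = refl
  typeOf-nats (suc n) (suc i) = typeOf-nats n i

natFun≡fun : ∀ n → natFun {a} n ≡ fun n nat
natFun≡fun zero    = refl
natFun≡fun (suc n) = cong (nat ⇒_) (natFun≡fun n)

⊸*≡foldr : ∀ (xs : Vec (Tm 0 (m + 8)) n) (P : Fm 0 (m + 8) Φ) → Ns m xs ⊸* P ≡ foldr _ (λ x P → N m x ⊸ P) P xs
⊸*≡foldr []       P = refl
⊸*≡foldr {m} (x ∷ xs) P = cong (N m x ⊸_) (⊸*≡foldr xs P)

mainTheorem3 : ∀ (n : ℕ) (g : Vec ℕ n → ℕ) → Elementary n g →
    Σ[ f ∈ Tm 0 8 ] (Sig ⊢ f ⦂ natFun n) ×
    (∃[ k ] Σ[ t ∈ Tm 0 0 ] ((∅ ⨾ [] ⊢ t ⦂ Totality n k f) × Represents (erase t) g))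
mainTheorem3 n g el with extract el
... | k , E = f , ⊢-cast (sym (natFun≡fun n)) ⊢f , suc k , Pf.tm p , Pf.der p ,
  λ ms → apps-⟶* (map ⌜_⌝ ms) (≡⇒⟶* (Pf.sem p _)) ◅◅ ⌜coerce*⌝-red ms program ◅◅ computes ms
  where
  open Extracted E
  p : Pf ∅ [] (Totality n (suc k) f) (λ _ → ⌜coerce*⌝ n ∙ program)
  p = ∀nats-I n (cast (⊸*≡foldr (vars n) _)
    (coerce*P {Γ = nats n} (⊢vars n) (!^N-ok {Γ = nats n} (suc k) (⊢app {_} {nats n} (⊢vars n)))
     $ totality {_} {nats n} (⊢vars n)))
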